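{- Let $M=Ap$, where $p$ is a prime, $A$ is a square-free positive integer, $A\le 0.1p^{0.1}$, and $(A,p)=1$. Then $$S(R_M)=2f_A(0.5)\,p+O(A^3p^{0.95}),$$ with an absolute implied constant, where $f_A$ is the rational function defined in the context.
   Context: For a positive integer $n$ and $U\subseteq\mathbb{Z}_n$ with $|U|=k\ge2$, write $U=\{u_1<\dots<u_k\}\subseteq\{0,\dots,n-1\}$, $s_i=u_{i+1}-u_i$ ($i<k$), $s_k=u_1+n-u_k$, and $S(U)=\sum_i s_i^2$. $R_M=\{a^2:a\in\mathbb{Z}_M\}$. For the positive integer $A$, write $R_A=\{0=i_1<i_2<\dots<i_r\}\subseteq\{0,\dots,A-1\}$ with $r=|R_A|$, and let $s_1,\dots,s_r$ be the consecutive distances $s_j=i_{j+1}-i_j$ ($j<r$), $s_r=A-i_r$, with indices of $s$ taken modulo $r$. Define $Q(y)=1+y+\dots+y^{r-1}$ and $F(y)=\sum_{k=0}^{r}\beta_k y^k$ where $\beta_0=\beta_r=\sum_{i=1}^r s_i^2$ and $\beta_k=2\sum_{i=1}^r s_is_{i+k}$ for $0<k<r$. Then $f_A(y)=F(y)/Q(y)$. -}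

module Defs where

open import Data.Nat as ℕ using (ℕ; zero; suc; _∸_; _%_)
open import Data.Nat.Divisibility using (_∣_)
open import Data.List using (List; []; _∷_; filter; map; upTo; length)
open import Data.Nat.ListAction using (sum)
open import Data.Bool.ListAction using (any)
open import Data.Bool using (Bool; true; false)
open import Relation.Nullary using (yes; no)
open import Relation.Nullary.Decidable using (⌊_⌋)
open import Relation.Binary.PropositionalEquality using (_≡_)
open import Data.Integer using (+_)
open import Data.Rational as ℚ using (ℚ; 0ℚ; 1ℚ; ½; ≢-nonZero)
open import Data.Rational.Properties using (_≟_)

SquareFree : ℕ → Set
SquareFree A = ∀ d → (d ℕ.* d) ∣ A → d ≡ 1

modr : ℕ → ℕ → ℕ
modr zero    i = i
modr (suc m) i = i % suc m

-- R_M = {a^2 : a ∈ Z_M}, as the increasing list of residues in {0,…,M-1}.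
isSquareMod : ℕ → ℕ → Bool
isSquareMod M x = any (λ a → ⌊ (modr M (a ℕ.* a)) ℕ.≟ x ⌋) (upTo M)

R : ℕ → List ℕ
R M = filter (λ x → isSquareMod M x Data.Bool.≟ true) (upTo M)

-- Consecutive distances s_1,…,s_k of an increasing list u_1<…<u_k in
-- {0,…,n-1}: s_i = u_{i+1} - u_i (i<k), s_k = u_1 + n - u_k.
gapsFrom : ℕ → ℕ → ℕ → List ℕ → List ℕ
gapsFrom n first x []       = (first ℕ.+ n ∸ x) ∷ []
gapsFrom n first x (y ∷ ys) = (y ∸ x) ∷ gapsFrom n first y ys

gaps : ℕ → List ℕ → List ℕ
gaps n []       = []
gaps n (u ∷ us) = gapsFrom n u u us

S : ℕ → List ℕ → ℕ
S n U = sum (map (λ s → s ℕ.* s) (gaps n U))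

SR : ℕ → ℕ
SR M = S M (R M)

nth : List ℕ → ℕ → ℕ
nth []       _       = 0
nth (x ∷ xs) zero    = x
nth (x ∷ xs) (suc i) = nth xs i

r : ℕ → ℕ
r A = length (R A)

-- s_j for R_A, 0-based index j ∈ {0,…,r-1} (paper's s_{j+1})
s : ℕ → ℕ → ℕ
s A j = nth (gaps A (R A)) j

sumTo : ℕ → (ℕ → ℕ) → ℕ
sumTo n f = sum (map f (upTo n))

β : ℕ → ℕ → ℕ
β A k with k ℕ.≟ 0 | k ℕ.≟ r A
... | yes _ | _     = sumTo (r A) (λ i → s A i ℕ.* s A i)
... | no _  | yes _ = sumTo (r A) (λ i → s A i ℕ.* s A i)
... | no _  | no _  = 2 ℕ.* sumTo (r A) (λ i → s A i ℕ.* s A (modr (r A) (i ℕ.+ k)))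

_^ℚ_ : ℚ → ℕ → ℚ
x ^ℚ zero  = 1ℚ
x ^ℚ suc n = x ℚ.* (x ^ℚ n)

sumℚ : ℕ → (ℕ → ℚ) → ℚ
sumℚ n f = Data.List.foldr ℚ._+_ 0ℚ (map f (upTo n))

F : ℕ → ℚ → ℚ
F A y = sumℚ (suc (r A)) (λ k → (+ β A k ℚ./ 1) ℚ.* (y ^ℚ k))

Q : ℕ → ℚ → ℚ
Q A y = sumℚ (r A) (λ k → y ^ℚ k)

-- division (defined as 0 on a zero denominator; Q(1/2) ≠ 0 whenever A ≥ 1)
_÷'_ : ℚ → ℚ → ℚ
x ÷' y with y ≟ 0ℚ
... | yes _ = 0ℚ
... | no y≢0 = ℚ._÷_ x y {{≢-nonZero y≢0}}

f : ℕ → ℚ → ℚ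
f A y = F A y ÷' Q A y

{-# OPTIONS --safe #-}
-- S(R_M) counts the ordered pairs of positions lying in a common gap, so it is governed by the
-- numbers N_i(d) of t mod p such that (i + tA, i + tA + d] contains no square mod M = Ap.  By the
-- Chinese remainder theorem only the w elements of (i, i + d] that are squares mod A matter, and
-- N_i(d) prescribes the Legendre symbols of w linear forms in t.  Stepanov's polynomial method bounds
-- the corresponding character sums, whence N_i(d) = p/2^w + O(u^21) with u = ⌊p^(1/40)⌋, uniformly
-- in d.  Since w grows by r = |R_A| when d grows by A, summing over d is a geometric series with
-- value 2 f_A(1/2) p.  There are few summands because runs of equal Legendre symbols have length
-- O(u^16): dividing a longer run by the integers in [4u^10, 4u^10 + u^5) produces more starting
-- points of shorter runs than the estimate for N_i(d) allows (an idea of Burgess).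
module Submission where

-- Characters are replaced by n-th powers in the field of p = 2n + 1 elements, and p^0.95 by its
-- 20-th power, so that all estimates live in ℕ. The integer u stands in for log p: a fixed power of
-- u is at most a constant times 2^u, so once u forms are prescribed the main term p / 2^u drowns in
-- the error, and larger patterns need no analysis of their own. The exponent 40 comes from
-- balancing. Stepanov's method with l = u^20, about the square root of p, costs O(u l) = O(u^21)
-- for a product of at most u forms. With κ = u^5 divisors, runs have length O(u^21 / κ) = O(u^16).
-- The sum over i < A and d < A H with H = O(u^16) then has total error O(A² u^37), and A³ u^38 is
-- at most A³ p^0.95. Stepanov's method only bounds from above the number of t with a given product
-- of signs. Since the two signs share all t, two upper bounds make both counts p / 2 up to the
-- error. Patterns are reached from products one form at a time by averaging, so the error does not
-- grow with the number of forms.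

-- Finite sums, counting and approximate equality of natural numbers

module FiniteSums where

  open import Data.Nat
  open import Data.Nat.Properties
  open import Data.Bool using (Bool; true; false; _∧_; T)
  open import Data.Unit using (tt)
  open import Data.List using (length; filter; applyUpTo)
  open import Data.Product using (_×_; _,_)
  open import Data.Nat.Solver using (module +-*-Solver)
  open import Function using (_∘_)
  open import Relation.Binary.PropositionalEquality
  open import Relation.Nullary using (Dec; does; yes; no; ¬_; contradiction)
  open import Relation.Unary using (Decidable)

  Σ< : ℕ → (ℕ → ℕ) → ℕ
  Σ< zero    h = 0
  Σ< (suc n) h = h 0 + Σ< n (h ∘ suc)

  ⟦_⟧ : Bool → ℕ
  ⟦ true ⟧  = 1
  ⟦ false ⟧ = 0

  count : ℕ → (ℕ → Bool) → ℕ
  count n b = Σ< n (λ i → ⟦ b i ⟧)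

  Σ-mono : ∀ n {h k} → (∀ i → i < n → h i ≤ k i) → Σ< n h ≤ Σ< n k
  Σ-mono zero    le = z≤n
  Σ-mono (suc n) le = +-mono-≤ (le 0 z<s) (Σ-mono n (λ i i<n → le (suc i) (s<s i<n)))

  Σ-cong : ∀ n {h k} → (∀ i → i < n → h i ≡ k i) → Σ< n h ≡ Σ< n k
  Σ-cong zero    e = refl
  Σ-cong (suc n) e = cong₂ _+_ (e 0 z<s) (Σ-cong n (λ i i<n → e (suc i) (s<s i<n)))

  +-interchange : ∀ a b c d → (a + b) + (c + d) ≡ (a + c) + (b + d)
  +-interchange = solve 4 (λ a b c d → (a :+ b) :+ (c :+ d) := (a :+ c) :+ (b :+ d)) refl
    where open +-*-Solver

  Σ-+ : ∀ n h k → Σ< n (λ i → h i + k i) ≡ Σ< n h + Σ< n k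
  Σ-+ zero    h k = refl
  Σ-+ (suc n) h k = trans (cong (h 0 + k 0 +_) (Σ-+ n (h ∘ suc) (k ∘ suc)))
    (+-interchange (h 0) (k 0) (Σ< n (h ∘ suc)) (Σ< n (k ∘ suc)))

  Σ-* : ∀ n c h → Σ< n (λ i → c * h i) ≡ c * Σ< n h
  Σ-* zero    c h = sym (*-zeroʳ c)
  Σ-* (suc n) c h = trans (cong (c * h 0 +_) (Σ-* n c (h ∘ suc))) (sym (*-distribˡ-+ c (h 0) (Σ< n (h ∘ suc))))

  Σ-const : ∀ n c → Σ< n (λ _ → c) ≡ n * c
  Σ-const zero    c = refl
  Σ-const (suc n) c = cong (c +_) (Σ-const n c)

  Σ-zero : ∀ n {h} → (∀ i → i < n → h i ≡ 0) → Σ< n h ≡ 0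
  Σ-zero n z = trans (Σ-cong n z) (trans (Σ-const n 0) (*-zeroʳ n))

  Σ-swap : ∀ m n (h : ℕ → ℕ → ℕ) → Σ< m (λ i → Σ< n (h i)) ≡ Σ< n (λ j → Σ< m (λ i → h i j))
  Σ-swap zero    n h = sym (Σ-zero n (λ _ _ → refl))
  Σ-swap (suc m) n h = trans (cong (Σ< n (h 0) +_) (Σ-swap m n (h ∘ suc)))
    (sym (Σ-+ n (h 0) (λ j → Σ< m (λ i → h (suc i) j))))

  Σ-split : ∀ m n h → Σ< (m + n) h ≡ Σ< m h + Σ< n (λ i → h (m + i))
  Σ-split zero    n h = refl
  Σ-split (suc m) n h = trans (cong (h 0 +_) (Σ-split m n (h ∘ suc)))
    (sym (+-assoc (h 0) (Σ< m (h ∘ suc)) (Σ< n (λ i → h (suc m + i)))))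

  Σ-last : ∀ n h → Σ< (suc n) h ≡ Σ< n h + h n
  Σ-last zero    h = +-comm (h 0) 0
  Σ-last (suc n) h = trans (cong (h 0 +_) (Σ-last n (h ∘ suc))) (sym (+-assoc (h 0) _ (h (suc n))))

  Σ-≤const : ∀ n c {h} → (∀ i → i < n → h i ≤ c) → Σ< n h ≤ n * c
  Σ-≤const n c le = ≤-trans (Σ-mono n le) (≤-reflexive (Σ-const n c))

  term≤Σ : ∀ n h i → i < n → h i ≤ Σ< n h
  term≤Σ (suc n) h zero    _          = m≤m+n (h 0) _
  term≤Σ (suc n) h (suc i) (s<s i<n) = ≤-trans (term≤Σ n (h ∘ suc) i i<n) (m≤n+m _ (h 0))

  ⟦⟧≤1 : ∀ b → ⟦ b ⟧ ≤ 1
  ⟦⟧≤1 true  = ≤-refl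
  ⟦⟧≤1 false = z≤n

  count≤ : ∀ n b → count n b ≤ n
  count≤ n b = ≤-trans (Σ-≤const n 1 (λ i _ → ⟦⟧≤1 (b i))) (≤-reflexive (*-identityʳ n))

  length-filter : ∀ {ℓ} {P : ℕ → Set ℓ} (P? : Decidable P) h n →
                  length (filter P? (applyUpTo h n)) ≡ count n (λ i → does (P? (h i)))
  length-filter P? h zero = refl
  length-filter P? h (suc n) with does (P? (h 0))
  ... | true  = cong suc (length-filter P? (h ∘ suc) n)
  ... | false = length-filter P? (h ∘ suc) n

  -- Two inequalities instead of an absolute difference keep the estimates free of subtraction until
  -- the final rational statement.
  Near : ℕ → ℕ → ℕ → Set
  Near x y B = x ≤ y + B × y ≤ x + B

  near-+ : ∀ {x y x′ y′ B B′} → Near x y B → Near x′ y′ B′ → Near (x + x′) (y + y′) (B + B′)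
  near-+ {x} {y} {x′} {y′} {B} {B′} (a , b) (a′ , b′) =
    ≤-trans (+-mono-≤ a a′) (≤-reflexive (+-interchange y B y′ B′)) ,
    ≤-trans (+-mono-≤ b b′) (≤-reflexive (+-interchange x B x′ B′))

  near-* : ∀ c {x y B} → Near x y B → Near (c * x) (c * y) (c * B)
  near-* c {x} {y} {B} (a , b) =
    ≤-trans (*-monoʳ-≤ c a) (≤-reflexive (*-distribˡ-+ c y B)) ,
    ≤-trans (*-monoʳ-≤ c b) (≤-reflexive (*-distribˡ-+ c x B))

  near-trans : ∀ {x y z B B′} → Near x y B → Near y z B′ → Near x z (B + B′)
  near-trans {x} {y} {z} {B} {B′} (a , b) (a′ , b′) =
    ≤-trans a (≤-trans (+-monoˡ-≤ B a′) (≤-reflexive (trans (+-assoc z B′ B) (cong (z +_) (+-comm B′ B))))) ,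
    ≤-trans b′ (≤-trans (+-monoˡ-≤ B′ b) (≤-reflexive (+-assoc x B B′)))

  near-sym : ∀ {x y B} → Near x y B → Near y x B
  near-sym (a , b) = b , a

  near-≡ : ∀ {x y} → x ≡ y → Near x y 0
  near-≡ {x} refl = m≤m+n x 0 , m≤m+n x 0

  near-weaken : ∀ {x y B B′} → B ≤ B′ → Near x y B → Near x y B′
  near-weaken {x} {y} le (a , b) = ≤-trans a (+-monoʳ-≤ y le) , ≤-trans b (+-monoʳ-≤ x le)

  near-Σ : ∀ n {h k B} → (∀ i → i < n → Near (h i) (k i) B) → Near (Σ< n h) (Σ< n k) (n * B)
  near-Σ zero    e = z≤n , z≤n
  near-Σ (suc n) e = near-+ (e 0 z<s) (near-Σ n (λ i i<n → e (suc i) (s<s i<n)))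

  near-cancel-* : ∀ c {x y B} → 0 < c → Near (c * x) (c * y) (c * B) → Near x y B
  near-cancel-* (suc c) {x} {y} {B} _ (a , b) =
    *-cancelˡ-≤ (suc c) (≤-trans a (≤-reflexive (sym (*-distribˡ-+ (suc c) y B)))) ,
    *-cancelˡ-≤ (suc c) (≤-trans b (≤-reflexive (sym (*-distribˡ-+ (suc c) x B))))

  ⟦⟧-cover : ∀ {a b c} {A : Set a} {B : Set b} {C : Set c} (A? : Dec A) (B? : Dec B) (C? : Dec C) →
             (A → ¬ C → B) → ⟦ does A? ⟧ ≤ ⟦ does B? ⟧ + ⟦ does C? ⟧
  ⟦⟧-cover (no _)  B?       C?       h = z≤n
  ⟦⟧-cover (yes x) (yes _)  C?       h = s≤s z≤n
  ⟦⟧-cover (yes x) (no ¬b)  (yes _)  h = s≤s z≤n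
  ⟦⟧-cover (yes x) (no ¬b)  (no ¬c)  h = contradiction (h x ¬c) ¬b

  count-split : ∀ n {b : ℕ → Bool} (c d : ℕ → Bool) → (∀ t → ⟦ b t ⟧ ≡ ⟦ c t ⟧ + ⟦ d t ⟧) →
                count n b ≡ count n c + count n d
  count-split n c d e = trans (Σ-cong n (λ t _ → e t)) (Σ-+ n (λ t → ⟦ c t ⟧) (λ t → ⟦ d t ⟧))

  -- Every element of X blocks the D - 1 places after it. The parameter `r` counts the leading
  -- places already known to be empty, which is what the induction on `M` has to carry along after
  -- passing an element.
  spaced-count : ∀ D M (X : ℕ → Bool) r → r ≤ D → 1 ≤ D →
                 (∀ i → i < r → i < M → X i ≡ false) →
                 (∀ i j → i < j → j < M → X i ≡ true → X j ≡ true → D ≤ j ∸ i) →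
                 D * count M X + r ≤ M + D
  spaced-count D zero X r r≤D 1≤D low sp = ≤-trans (≤-reflexive (cong (_+ r) (*-zeroʳ D))) r≤D
  spaced-count D (suc M) X (suc r) r≤D 1≤D low sp = begin
    D * (⟦ X 0 ⟧ + count M (X ∘ suc)) + suc r  ≡⟨ cong (λ b → D * (⟦ b ⟧ + count M (X ∘ suc)) + suc r) (low 0 z<s z<s) ⟩
    D * count M (X ∘ suc) + suc r              ≡⟨ +-suc _ r ⟩
    suc (D * count M (X ∘ suc) + r)            ≤⟨ s≤s (spaced-count D M (X ∘ suc) r (≤-trans (n≤1+n r) r≤D) 1≤D
                                                    (λ i i<r i<M → low (suc i) (s<s i<r) (s<s i<M))
                                                    (λ i j i<j j<M → sp (suc i) (suc j) (s<s i<j) (s<s j<M))) ⟩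
    suc (M + D)                                ∎
    where open ≤-Reasoning
  spaced-count D (suc M) X zero r≤D 1≤D low sp = byHead (X 0) refl
    where
    open ≤-Reasoning
    sp′ : ∀ i j → i < j → j < M → X (suc i) ≡ true → X (suc j) ≡ true → D ≤ j ∸ i
    sp′ i j i<j j<M = sp (suc i) (suc j) (s<s i<j) (s<s j<M)
    byHead : ∀ b → X 0 ≡ b → D * (⟦ X 0 ⟧ + count M (X ∘ suc)) + 0 ≤ suc M + D
    byHead false e = begin
      D * (⟦ X 0 ⟧ + count M (X ∘ suc)) + 0  ≡⟨ cong (λ b → D * (⟦ b ⟧ + count M (X ∘ suc)) + 0) e ⟩
      D * count M (X ∘ suc) + 0              ≤⟨ spaced-count D M (X ∘ suc) 0 z≤n 1≤D (λ _ ()) sp′ ⟩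
      M + D                                  ≤⟨ n≤1+n _ ⟩
      suc M + D                              ∎
    byHead true e = begin
      D * (⟦ X 0 ⟧ + count M (X ∘ suc)) + 0  ≡⟨ cong (λ b → D * (⟦ b ⟧ + count M (X ∘ suc)) + 0) e ⟩
      D * suc (count M (X ∘ suc)) + 0        ≡⟨ trans (+-identityʳ _) (*-suc D _) ⟩
      D + D * count M (X ∘ suc)              ≡⟨ cong (_+ D * count M (X ∘ suc)) (sym D≡) ⟩
      suc (pred D) + D * count M (X ∘ suc)   ≡⟨ cong suc (+-comm (pred D) _) ⟩
      suc (D * count M (X ∘ suc) + pred D)   ≤⟨ s≤s (spaced-count D M (X ∘ suc) (pred D) pred[n]≤n 1≤D low′ sp′) ⟩
      suc M + D                              ∎
      where
      D≡ : suc (pred D) ≡ D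
      D≡ = suc-pred D {{>-nonZero 1≤D}}
      low′ : ∀ i → i < pred D → i < M → X (suc i) ≡ false
      low′ i i<D i<M with X (suc i) in eq
      ... | false = refl
      ... | true  = contradiction (sp 0 (suc i) z<s (s<s i<M) e eq) (<⇒≱ (≤-trans (s<s i<D) (≤-reflexive D≡)))

  Σ-kronecker : ∀ n r (h : ℕ → ℕ) → r < n → Σ< n (λ t → ⟦ t ≡ᵇ r ⟧ * h t) ≡ h r
  Σ-kronecker (suc n) zero    h _         = trans (cong (h 0 + 0 +_) (Σ-zero n (λ _ _ → refl))) (trans (+-identityʳ _) (+-identityʳ _))
  Σ-kronecker (suc n) (suc r) h (s<s r<n) = Σ-kronecker n r (h ∘ suc) r<n

  -- The substitution m = π t. Once g (π t) is written as a sum over m against the Kronecker delta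
  -- of m and π t, the sums are exchanged and the delta becomes that of t and ρ m.
  Σ-bijection : ∀ n (π ρ : ℕ → ℕ) (h g : ℕ → ℕ) →
                (∀ t → t < n → π t < n) → (∀ m → m < n → ρ m < n) →
                (∀ t → t < n → ρ (π t) ≡ t) → (∀ m → m < n → π (ρ m) ≡ m) →
                Σ< n (λ t → h t * g (π t)) ≡ Σ< n (λ m → h (ρ m) * g m)
  Σ-bijection n π ρ h g π< ρ< ρπ πρ = begin
    Σ< n (λ t → h t * g (π t))
      ≡⟨ Σ-cong n (λ t t<n → trans (cong (h t *_) (sym (Σ-kronecker n (π t) g (π< t t<n)))) (sym (Σ-* n (h t) (λ m → ⟦ m ≡ᵇ π t ⟧ * g m)))) ⟩
    Σ< n (λ t → Σ< n (λ m → h t * (⟦ m ≡ᵇ π t ⟧ * g m)))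
      ≡⟨ Σ-swap n n (λ t m → h t * (⟦ m ≡ᵇ π t ⟧ * g m)) ⟩
    Σ< n (λ m → Σ< n (λ t → h t * (⟦ m ≡ᵇ π t ⟧ * g m)))
      ≡⟨ Σ-cong n (λ m m<n → Σ-cong n (λ t t<n → trans (cong (λ b → h t * (⟦ b ⟧ * g m)) (flip t m t<n m<n)) (rearrange (h t) ⟦ t ≡ᵇ ρ m ⟧ (g m)))) ⟩
    Σ< n (λ m → Σ< n (λ t → ⟦ t ≡ᵇ ρ m ⟧ * (h t * g m)))
      ≡⟨ Σ-cong n (λ m m<n → Σ-kronecker n (ρ m) (λ t → h t * g m) (ρ< m m<n)) ⟩
    Σ< n (λ m → h (ρ m) * g m) ∎
    where
    open ≡-Reasoning
    rearrange : ∀ x y z → x * (y * z) ≡ y * (x * z)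
    rearrange = solve 3 (λ x y z → x :* (y :* z) := y :* (x :* z)) refl
      where open +-*-Solver using (solve; _:*_; _:=_)
    T-ext : ∀ {a b} → (T a → T b) → (T b → T a) → a ≡ b
    T-ext {true}  {true}  f k = refl
    T-ext {false} {false} f k = refl
    T-ext {true}  {false} f k = contradiction (f tt) (λ ())
    T-ext {false} {true}  f k = contradiction (k tt) (λ ())
    flip : ∀ t m → t < n → m < n → (m ≡ᵇ π t) ≡ (t ≡ᵇ ρ m)
    flip t m t<n m<n = T-ext
      (λ x → ≡⇒≡ᵇ t (ρ m) (trans (sym (ρπ t t<n)) (cong ρ (sym (≡ᵇ⇒≡ m (π t) x)))))
      (λ x → ≡⇒≡ᵇ m (π t) (trans (sym (πρ m m<n)) (cong π (sym (≡ᵇ⇒≡ t (ρ m) x)))))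

  -- If k ≥ 1 of the events occur, then u ≥ 1 and k - 1 is at most the number k (k - 1) / 2 of
  -- pairs. With u an indicator of a union, summation over t bounds the union from below.
  bonferroni : ∀ κ (x : ℕ → Bool) u → (∀ i → i < κ → ⟦ x i ⟧ ≤ u) →
               Σ< κ (λ i → ⟦ x i ⟧) ≤ u + Σ< κ (λ i → Σ< i (λ j → ⟦ x i ∧ x j ⟧))
  bonferroni zero    x u le = z≤n
  bonferroni (suc κ) x u le = begin
    Σ< (suc κ) (λ i → ⟦ x i ⟧)        ≡⟨ Σ-last κ (λ i → ⟦ x i ⟧) ⟩
    S + ⟦ x κ ⟧                       ≤⟨ step (x κ) refl ⟩
    u + (P κ + Σ< κ (λ j → ⟦ x κ ∧ x j ⟧)) ≡⟨ cong (u +_) (Σ-last κ (λ i → Σ< i (λ j → ⟦ x i ∧ x j ⟧))) ⟨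
    u + P (suc κ)                     ∎
    where
    open ≤-Reasoning
    S = Σ< κ (λ i → ⟦ x i ⟧)
    P : ℕ → ℕ
    P m = Σ< m (λ i → Σ< i (λ j → ⟦ x i ∧ x j ⟧))
    ih : S ≤ u + P κ
    ih = bonferroni κ x u (λ i i<κ → le i (m<n⇒m<1+n i<κ))
    step : ∀ b → x κ ≡ b → S + ⟦ x κ ⟧ ≤ u + (P κ + Σ< κ (λ j → ⟦ x κ ∧ x j ⟧))
    step false e rewrite e = ≤-trans (≤-reflexive (+-identityʳ S)) (≤-trans ih (+-monoʳ-≤ u (m≤m+n (P κ) _)))
    -- When the event κ occurs, every earlier event forms a pair with it: these pairs pay for S, and
    -- u ≥ 1 pays for κ itself.
    step true  e = begin
      S + ⟦ x κ ⟧        ≤⟨ +-monoʳ-≤ S (le κ (n<1+n κ)) ⟩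
      S + u              ≡⟨ +-comm S u ⟩
      u + S              ≤⟨ +-monoʳ-≤ u (m≤n+m S (P κ)) ⟩
      u + (P κ + S)      ≡⟨ cong (λ b → u + (P κ + Σ< κ (λ j → ⟦ b ∧ x j ⟧))) e ⟨
      u + (P κ + Σ< κ (λ j → ⟦ x κ ∧ x j ⟧)) ∎

  Σ-restrict : ∀ M k (h : ℕ → ℕ) → Σ< (M + k) (λ m → h m * ⟦ m <ᵇ M ⟧) ≡ Σ< M h
  Σ-restrict zero    k h = Σ-zero k (λ i _ → *-zeroʳ (h i))
  Σ-restrict (suc M) k h = cong₂ _+_ (*-identityʳ (h 0)) (Σ-restrict M k (h ∘ suc))

-- Polynomials as coefficient lists: ring structure, evaluation, derivative

module Polynomials where

  open import Algebra.Bundles using (CommutativeRing)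
  open import Data.Nat as ℕ using (ℕ; zero; suc)
  import Data.Nat.Properties as ℕₚ
  open import Data.List.Properties using (length-map)
  open import Data.List using (List; []; _∷_; length; map; drop)
  open import Data.Product using (_,_)
  open import Relation.Binary.PropositionalEquality as ≡ using (_≡_)
  open import Data.Sum using ([_,_]′)

  module Polynomial {c ℓ} (K : CommutativeRing c ℓ) where

    open CommutativeRing K hiding (_-_)
    import Algebra.Solver.Ring.NaturalCoefficients.Default commutativeSemiring as KS
    open import Algebra.Properties.Ring ring using (-0#≈0#)
    open import Relation.Binary.Reasoning.Setoid setoid

    Poly : Set c
    Poly = List Carrier

    coef : Poly → ℕ → Carrier
    coef []      _       = 0#
    coef (a ∷ P) zero    = a
    coef (a ∷ P) (suc n) = coef P n

    infix 4 _≋_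
    -- Lists that differ by trailing zeros are identified, so a degree cannot be read off; `length`
    -- serves as an upper bound for degree + 1 throughout.
    record _≋_ (P Q : Poly) : Set ℓ where
      constructor mk≋
      field at : ∀ n → coef P n ≈ coef Q n
    open _≋_ public

    infixl 6 _⊕_
    infixl 7 _⊛_

    _⊕_ : Poly → Poly → Poly
    []      ⊕ Q       = Q
    (a ∷ P) ⊕ []      = a ∷ P
    (a ∷ P) ⊕ (b ∷ Q) = (a + b) ∷ (P ⊕ Q)

    scale : Carrier → Poly → Poly
    scale x = map (x *_)

    neg : Poly → Poly
    neg = map -_

    shift : Poly → Poly
    shift P = 0# ∷ P

    _⊛_ : Poly → Poly → Poly
    []      ⊛ Q = []
    (a ∷ P) ⊛ Q = scale a Q ⊕ shift (P ⊛ Q)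

    one : Poly
    one = 1# ∷ []

    coef-⊕ : ∀ P Q n → coef (P ⊕ Q) n ≈ coef P n + coef Q n
    coef-⊕ []      Q       n       = sym (+-identityˡ _)
    coef-⊕ (a ∷ P) []      n       = sym (+-identityʳ _)
    coef-⊕ (a ∷ P) (b ∷ Q) zero    = refl
    coef-⊕ (a ∷ P) (b ∷ Q) (suc n) = coef-⊕ P Q n

    coef-scale : ∀ x P n → coef (scale x P) n ≈ x * coef P n
    coef-scale x []      n       = sym (zeroʳ x)
    coef-scale x (a ∷ P) zero    = refl
    coef-scale x (a ∷ P) (suc n) = coef-scale x P n

    coef-neg : ∀ P n → coef (neg P) n ≈ - coef P n
    coef-neg []      n       = sym -0#≈0#
    coef-neg (a ∷ P) zero    = refl
    coef-neg (a ∷ P) (suc n) = coef-neg P n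

    ≋-refl : ∀ {P} → P ≋ P
    ≋-refl = mk≋ λ _ → refl

    ≋-sym : ∀ {P Q} → P ≋ Q → Q ≋ P
    ≋-sym e = mk≋ λ n → sym (at e n)

    ≋-trans : ∀ {P Q S} → P ≋ Q → Q ≋ S → P ≋ S
    ≋-trans e e′ = mk≋ λ n → trans (at e n) (at e′ n)

    ⊕-cong : ∀ {P P′ Q Q′} → P ≋ P′ → Q ≋ Q′ → P ⊕ Q ≋ P′ ⊕ Q′
    ⊕-cong {P} {P′} {Q} {Q′} e e′ = mk≋ λ n →
      trans (coef-⊕ P Q n) (trans (+-cong (at e n) (at e′ n)) (sym (coef-⊕ P′ Q′ n)))

    ⊕-assoc : ∀ P Q S → (P ⊕ Q) ⊕ S ≋ P ⊕ (Q ⊕ S)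
    ⊕-assoc P Q S = mk≋ λ n → begin
      coef ((P ⊕ Q) ⊕ S) n              ≈⟨ coef-⊕ (P ⊕ Q) S n ⟩
      coef (P ⊕ Q) n + coef S n         ≈⟨ +-congʳ (coef-⊕ P Q n) ⟩
      coef P n + coef Q n + coef S n    ≈⟨ +-assoc _ _ _ ⟩
      coef P n + (coef Q n + coef S n)  ≈⟨ +-congˡ (coef-⊕ Q S n) ⟨
      coef P n + coef (Q ⊕ S) n         ≈⟨ coef-⊕ P (Q ⊕ S) n ⟨
      coef (P ⊕ (Q ⊕ S)) n              ∎

    ⊕-comm : ∀ P Q → P ⊕ Q ≋ Q ⊕ P
    ⊕-comm P Q = mk≋ λ n →
      trans (coef-⊕ P Q n) (trans (+-comm _ _) (sym (coef-⊕ Q P n)))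

    ⊕-identityʳ : ∀ P → P ⊕ [] ≋ P
    ⊕-identityʳ P = mk≋ λ n → trans (coef-⊕ P [] n) (+-identityʳ _)

    neg-inverseʳ : ∀ P → P ⊕ neg P ≋ []
    neg-inverseʳ P = mk≋ λ n →
      trans (coef-⊕ P (neg P) n) (trans (+-congˡ (coef-neg P n)) (-‿inverseʳ _))

    neg-cong : ∀ {P Q} → P ≋ Q → neg P ≋ neg Q
    neg-cong {P} {Q} e = mk≋ λ n →
      trans (coef-neg P n) (trans (-‿cong (at e n)) (sym (coef-neg Q n)))

    shift-cong : ∀ {P Q} → P ≋ Q → shift P ≋ shift Q
    shift-cong e = mk≋ λ { zero → refl ; (suc n) → at e n }

    shift-⊕ : ∀ P Q → shift (P ⊕ Q) ≋ shift P ⊕ shift Q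
    shift-⊕ P Q = mk≋ λ { zero → sym (+-identityˡ 0#) ; (suc n) → refl }

    scale-cong : ∀ {x y P Q} → x ≈ y → P ≋ Q → scale x P ≋ scale y Q
    scale-cong {x} {y} {P} {Q} e e′ = mk≋ λ n →
      trans (coef-scale x P n) (trans (*-cong e (at e′ n)) (sym (coef-scale y Q n)))

    scale-⊕ : ∀ x P Q → scale x (P ⊕ Q) ≋ scale x P ⊕ scale x Q
    scale-⊕ x P Q = mk≋ λ n → begin
      coef (scale x (P ⊕ Q)) n                 ≈⟨ coef-scale x (P ⊕ Q) n ⟩
      x * coef (P ⊕ Q) n                       ≈⟨ *-congˡ (coef-⊕ P Q n) ⟩
      x * (coef P n + coef Q n)                ≈⟨ distribˡ _ _ _ ⟩
      x * coef P n + x * coef Q n              ≈⟨ +-cong (coef-scale x P n) (coef-scale x Q n) ⟨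
      coef (scale x P) n + coef (scale x Q) n  ≈⟨ coef-⊕ (scale x P) (scale x Q) n ⟨
      coef (scale x P ⊕ scale x Q) n           ∎

    scale-+ : ∀ x y P → scale (x + y) P ≋ scale x P ⊕ scale y P
    scale-+ x y P = mk≋ λ n → begin
      coef (scale (x + y) P) n                 ≈⟨ coef-scale (x + y) P n ⟩
      (x + y) * coef P n                       ≈⟨ distribʳ _ _ _ ⟩
      x * coef P n + y * coef P n              ≈⟨ +-cong (coef-scale x P n) (coef-scale y P n) ⟨
      coef (scale x P) n + coef (scale y P) n  ≈⟨ coef-⊕ (scale x P) (scale y P) n ⟨
      coef (scale x P ⊕ scale y P) n           ∎

    scale-* : ∀ x y P → scale x (scale y P) ≋ scale (x * y) P
    scale-* x y P = mk≋ λ n → begin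
      coef (scale x (scale y P)) n  ≈⟨ coef-scale x (scale y P) n ⟩
      x * coef (scale y P) n        ≈⟨ *-congˡ (coef-scale y P n) ⟩
      x * (y * coef P n)            ≈⟨ *-assoc _ _ _ ⟨
      x * y * coef P n              ≈⟨ coef-scale (x * y) P n ⟨
      coef (scale (x * y) P) n      ∎

    scale-0 : ∀ P → scale 0# P ≋ []
    scale-0 P = mk≋ λ n → trans (coef-scale 0# P n) (zeroˡ _)

    scale-1 : ∀ P → scale 1# P ≋ P
    scale-1 P = mk≋ λ n → trans (coef-scale 1# P n) (*-identityˡ _)

    scale-shift : ∀ x P → scale x (shift P) ≋ shift (scale x P)
    scale-shift x P = mk≋ λ { zero → zeroʳ x ; (suc n) → refl }

    shift-[] : shift [] ≋ []
    shift-[] = mk≋ λ { zero → refl ; (suc n) → refl }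

    ⊕-interchange : ∀ P Q S T → (P ⊕ Q) ⊕ (S ⊕ T) ≋ (P ⊕ S) ⊕ (Q ⊕ T)
    ⊕-interchange P Q S T = mk≋ λ n → begin
      coef ((P ⊕ Q) ⊕ (S ⊕ T)) n                           ≈⟨ coef-⊕ (P ⊕ Q) (S ⊕ T) n ⟩
      coef (P ⊕ Q) n + coef (S ⊕ T) n                      ≈⟨ +-cong (coef-⊕ P Q n) (coef-⊕ S T n) ⟩
      (coef P n + coef Q n) + (coef S n + coef T n)
        ≈⟨ KS.solve 4 (λ a b s t → (a KS.:+ b) KS.:+ (s KS.:+ t) KS.:= (a KS.:+ s) KS.:+ (b KS.:+ t)) refl _ _ _ _ ⟩
      (coef P n + coef S n) + (coef Q n + coef T n)        ≈⟨ +-cong (coef-⊕ P S n) (coef-⊕ Q T n) ⟨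
      coef (P ⊕ S) n + coef (Q ⊕ T) n                      ≈⟨ coef-⊕ (P ⊕ S) (Q ⊕ T) n ⟨
      coef ((P ⊕ S) ⊕ (Q ⊕ T)) n                           ∎

    ⊛-congˡ : ∀ P {Q Q′} → Q ≋ Q′ → P ⊛ Q ≋ P ⊛ Q′
    ⊛-congˡ []      e = ≋-refl
    ⊛-congˡ (a ∷ P) e = ⊕-cong (scale-cong refl e) (shift-cong (⊛-congˡ P e))

    ⊛-[] : ∀ P → P ⊛ [] ≋ []
    ⊛-[] []      = ≋-refl
    ⊛-[] (a ∷ P) = ≋-trans (shift-cong (⊛-[] P)) shift-[]

    -- Multiplication recurses on its first factor; this is the recursion on the second, from which
    -- commutativity follows by induction.
    ⊛-∷ : ∀ P b Q → P ⊛ (b ∷ Q) ≋ scale b P ⊕ shift (P ⊛ Q)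
    ⊛-∷ []      b Q = ≋-sym shift-[]
    ⊛-∷ (a ∷ P) b Q = mk≋ λ
      { zero    → +-congʳ (*-comm a b)
      ; (suc n) → begin
          coef (scale a Q ⊕ P ⊛ (b ∷ Q)) n
            ≈⟨ at (⊕-cong (≋-refl {scale a Q}) (⊛-∷ P b Q)) n ⟩
          coef (scale a Q ⊕ (scale b P ⊕ shift (P ⊛ Q))) n
            ≈⟨ at (⊕-interchange [] (scale a Q) (scale b P) (shift (P ⊛ Q))) n ⟩
          coef (scale b P ⊕ (scale a Q ⊕ shift (P ⊛ Q))) n ∎ }

    ⊛-comm : ∀ P Q → P ⊛ Q ≋ Q ⊛ P
    ⊛-comm []      Q = ≋-sym (⊛-[] Q)
    ⊛-comm (a ∷ P) Q = ≋-trans (⊕-cong ≋-refl (shift-cong (⊛-comm P Q))) (≋-sym (⊛-∷ Q a P))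

    ⊛-cong : ∀ {P P′ Q Q′} → P ≋ P′ → Q ≋ Q′ → P ⊛ Q ≋ P′ ⊛ Q′
    ⊛-cong {P} {P′} {Q} {Q′} e e′ =
      ≋-trans (⊛-congˡ P e′) (≋-trans (⊛-comm P Q′) (≋-trans (⊛-congˡ Q′ e) (⊛-comm Q′ P′)))

    ⊛-distribˡ : ∀ P Q S → P ⊛ (Q ⊕ S) ≋ P ⊛ Q ⊕ P ⊛ S
    ⊛-distribˡ []      Q S = ≋-refl
    ⊛-distribˡ (a ∷ P) Q S =
      ≋-trans (⊕-cong (scale-⊕ a Q S) (≋-trans (shift-cong (⊛-distribˡ P Q S)) (shift-⊕ (P ⊛ Q) (P ⊛ S))))
              (⊕-interchange (scale a Q) (scale a S) (shift (P ⊛ Q)) (shift (P ⊛ S)))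

    ⊛-distribʳ : ∀ S P Q → (P ⊕ Q) ⊛ S ≋ P ⊛ S ⊕ Q ⊛ S
    ⊛-distribʳ S P Q = ≋-trans (⊛-comm (P ⊕ Q) S)
      (≋-trans (⊛-distribˡ S P Q) (⊕-cong (⊛-comm S P) (⊛-comm S Q)))

    scale-⊛ : ∀ x P Q → scale x P ⊛ Q ≋ scale x (P ⊛ Q)
    scale-⊛ x []      Q = ≋-refl
    scale-⊛ x (a ∷ P) Q =
      ≋-trans (⊕-cong (≋-sym (scale-* x a Q))
                      (≋-trans (shift-cong (scale-⊛ x P Q)) (≋-sym (scale-shift x (P ⊛ Q)))))
              (≋-sym (scale-⊕ x (scale a Q) (shift (P ⊛ Q))))

    shift-⊛ : ∀ P Q → shift P ⊛ Q ≋ shift (P ⊛ Q)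
    shift-⊛ P Q = ⊕-cong (scale-0 Q) ≋-refl

    ⊛-assoc : ∀ P Q S → (P ⊛ Q) ⊛ S ≋ P ⊛ (Q ⊛ S)
    ⊛-assoc []      Q S = ≋-refl
    ⊛-assoc (a ∷ P) Q S =
      ≋-trans (⊛-distribʳ S (scale a Q) (shift (P ⊛ Q)))
        (⊕-cong (scale-⊛ a Q S) (≋-trans (shift-⊛ (P ⊛ Q) S) (shift-cong (⊛-assoc P Q S))))

    scale-one : ∀ x P → (x ∷ []) ⊛ P ≋ scale x P
    scale-one x P = ≋-trans (⊕-cong ≋-refl shift-[]) (⊕-identityʳ _)

    ⊛-identityˡ : ∀ P → one ⊛ P ≋ P
    ⊛-identityˡ P = ≋-trans (scale-one 1# P) (scale-1 P)

    polyRing : CommutativeRing c ℓ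
    polyRing = record
      { Carrier = Poly ; _≈_ = _≋_ ; _+_ = _⊕_ ; _*_ = _⊛_ ; -_ = neg ; 0# = [] ; 1# = one
      ; isCommutativeRing = record
        { isRing = record
          { +-isAbelianGroup = record
            { isGroup = record
              { isMonoid = record
                { isSemigroup = record
                  { isMagma = record
                    { isEquivalence = record { refl = ≋-refl ; sym = ≋-sym ; trans = ≋-trans }
                    ; ∙-cong = ⊕-cong }
                  ; assoc = ⊕-assoc }
                ; identity = (λ P → ≋-refl) , ⊕-identityʳ }
              ; inverse = (λ P → ≋-trans (⊕-comm (neg P) P) (neg-inverseʳ P)) , neg-inverseʳ
              ; ⁻¹-cong = neg-cong }
            ; comm = ⊕-comm }
          ; *-cong = ⊛-cong
          ; *-assoc = ⊛-assoc
          ; *-identity = ⊛-identityˡ , λ P → ≋-trans (⊛-comm P one) (⊛-identityˡ P)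
          ; distrib = ⊛-distribˡ , ⊛-distribʳ }
        ; *-comm = ⊛-comm } }

    eval : Poly → Carrier → Carrier
    eval []      x = 0#
    eval (a ∷ P) x = a + x * eval P x

    eval-[] : ∀ P → P ≋ [] → ∀ x → eval P x ≈ 0#
    eval-[] []      e x = refl
    eval-[] (a ∷ P) e x = begin
      a + x * eval P x  ≈⟨ +-cong (at e 0) (*-congˡ (eval-[] P (mk≋ λ n → at e (suc n)) x)) ⟩
      0# + x * 0#       ≈⟨ +-identityˡ _ ⟩
      x * 0#            ≈⟨ zeroʳ x ⟩
      0#                ∎

    eval-cong : ∀ {P Q} → P ≋ Q → ∀ x → eval P x ≈ eval Q x
    eval-cong {P}     {[]}    e x = eval-[] P e x
    eval-cong {[]}    {b ∷ Q} e x = sym (eval-[] (b ∷ Q) (≋-sym e) x)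
    eval-cong {a ∷ P} {b ∷ Q} e x =
      +-cong (at e 0) (*-congˡ (eval-cong {P} {Q} (mk≋ λ n → at e (suc n)) x))

    eval-⊕ : ∀ P Q x → eval (P ⊕ Q) x ≈ eval P x + eval Q x
    eval-⊕ []      Q       x = sym (+-identityˡ _)
    eval-⊕ (a ∷ P) []      x = sym (+-identityʳ _)
    eval-⊕ (a ∷ P) (b ∷ Q) x = begin
      a + b + x * eval (P ⊕ Q) x           ≈⟨ +-congˡ (*-congˡ (eval-⊕ P Q x)) ⟩
      a + b + x * (eval P x + eval Q x)
        ≈⟨ KS.solve 5 (λ a b x p q → (a KS.:+ b) KS.:+ x KS.:* (p KS.:+ q) KS.:= (a KS.:+ x KS.:* p) KS.:+ (b KS.:+ x KS.:* q)) refl _ _ _ _ _ ⟩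
      (a + x * eval P x) + (b + x * eval Q x) ∎

    eval-scale : ∀ y P x → eval (scale y P) x ≈ y * eval P x
    eval-scale y []      x = sym (zeroʳ y)
    eval-scale y (a ∷ P) x = begin
      y * a + x * eval (scale y P) x  ≈⟨ +-congˡ (*-congˡ (eval-scale y P x)) ⟩
      y * a + x * (y * eval P x)
        ≈⟨ KS.solve 4 (λ y a x p → y KS.:* a KS.:+ x KS.:* (y KS.:* p) KS.:= y KS.:* (a KS.:+ x KS.:* p)) refl _ _ _ _ ⟩
      y * (a + x * eval P x)          ∎

    eval-shift : ∀ P x → eval (shift P) x ≈ x * eval P x
    eval-shift P x = +-identityˡ _

    eval-⊛ : ∀ P Q x → eval (P ⊛ Q) x ≈ eval P x * eval Q x
    eval-⊛ []      Q x = sym (zeroˡ _)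
    eval-⊛ (a ∷ P) Q x = begin
      eval (scale a Q ⊕ shift (P ⊛ Q)) x           ≈⟨ eval-⊕ (scale a Q) (shift (P ⊛ Q)) x ⟩
      eval (scale a Q) x + eval (shift (P ⊛ Q)) x
        ≈⟨ +-cong (eval-scale a Q x) (trans (eval-shift (P ⊛ Q) x) (*-congˡ (eval-⊛ P Q x))) ⟩
      a * eval Q x + x * (eval P x * eval Q x)
        ≈⟨ KS.solve 4 (λ a x p q → a KS.:* q KS.:+ x KS.:* (p KS.:* q) KS.:= (a KS.:+ x KS.:* p) KS.:* q) refl _ _ _ _ ⟩
      (a + x * eval P x) * eval Q x                ∎

    eval-one : ∀ x → eval one x ≈ 1#
    eval-one x = trans (+-congˡ (zeroʳ x)) (+-identityʳ 1#)

    -- (a + X P)′ = P + X P′: in this form no integer multiples appear, and `coef-D` recovers the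
    -- usual coefficients.
    D : Poly → Poly
    D []      = []
    D (a ∷ P) = P ⊕ shift (D P)

    fromℕ : ℕ → Carrier
    fromℕ zero    = 0#
    fromℕ (suc n) = 1# + fromℕ n

    fromℕ-step : ∀ n x → x + fromℕ n * x ≈ fromℕ (suc n) * x
    fromℕ-step n x = KS.solve 2 (λ n x → x KS.:+ n KS.:* x KS.:= (KS.con 1 KS.:+ n) KS.:* x) refl (fromℕ n) x

    coef-D : ∀ P n → coef (D P) n ≈ fromℕ (suc n) * coef P (suc n)
    coef-D []      n       = sym (zeroʳ _)
    coef-D (a ∷ P) zero    = begin
      coef (P ⊕ shift (D P)) 0   ≈⟨ coef-⊕ P (shift (D P)) 0 ⟩
      coef P 0 + 0#              ≈⟨ +-congˡ (zeroˡ _) ⟨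
      coef P 0 + 0# * coef P 0   ≈⟨ fromℕ-step 0 _ ⟩
      fromℕ 1 * coef P 0         ∎
    coef-D (a ∷ P) (suc n) = begin
      coef (P ⊕ shift (D P)) (suc n)                  ≈⟨ coef-⊕ P (shift (D P)) (suc n) ⟩
      coef P (suc n) + coef (D P) n                   ≈⟨ +-congˡ (coef-D P n) ⟩
      coef P (suc n) + fromℕ (suc n) * coef P (suc n) ≈⟨ fromℕ-step (suc n) _ ⟩
      fromℕ (suc (suc n)) * coef P (suc n)            ∎

    D-cong : ∀ {P Q} → P ≋ Q → D P ≋ D Q
    D-cong {P} {Q} e = mk≋ λ n →
      trans (coef-D P n) (trans (*-congˡ (at e (suc n))) (sym (coef-D Q n)))

    D-⊕ : ∀ P Q → D (P ⊕ Q) ≋ D P ⊕ D Q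
    D-⊕ P Q = mk≋ λ n → begin
      coef (D (P ⊕ Q)) n                                 ≈⟨ coef-D (P ⊕ Q) n ⟩
      fromℕ (suc n) * coef (P ⊕ Q) (suc n)               ≈⟨ *-congˡ (coef-⊕ P Q (suc n)) ⟩
      fromℕ (suc n) * (coef P (suc n) + coef Q (suc n))  ≈⟨ distribˡ _ _ _ ⟩
      fromℕ (suc n) * coef P (suc n) + fromℕ (suc n) * coef Q (suc n)
        ≈⟨ +-cong (coef-D P n) (coef-D Q n) ⟨
      coef (D P) n + coef (D Q) n                        ≈⟨ coef-⊕ (D P) (D Q) n ⟨
      coef (D P ⊕ D Q) n                                 ∎

    D-scale : ∀ x P → D (scale x P) ≋ scale x (D P)
    D-scale x P = mk≋ λ n → begin
      coef (D (scale x P)) n                ≈⟨ coef-D (scale x P) n ⟩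
      fromℕ (suc n) * coef (scale x P) (suc n) ≈⟨ *-congˡ (coef-scale x P (suc n)) ⟩
      fromℕ (suc n) * (x * coef P (suc n))
        ≈⟨ KS.solve 3 (λ m x p → m KS.:* (x KS.:* p) KS.:= x KS.:* (m KS.:* p)) refl (fromℕ (suc n)) _ _ ⟩
      x * (fromℕ (suc n) * coef P (suc n))  ≈⟨ *-congˡ (coef-D P n) ⟨
      x * coef (D P) n                      ≈⟨ coef-scale x (D P) n ⟨
      coef (scale x (D P)) n                ∎

    module PR = CommutativeRing polyRing
    import Algebra.Solver.Ring.NaturalCoefficients.Default PR.commutativeSemiring as PS

    D-⊛ : ∀ P Q → D (P ⊛ Q) ≋ D P ⊛ Q ⊕ P ⊛ D Q
    D-⊛ []      Q = ≋-refl
    D-⊛ (a ∷ P) Q =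
      ≋-trans (D-⊕ (scale a Q) (shift (P ⊛ Q)))
      (≋-trans (⊕-cong (D-scale a Q) (⊕-cong (≋-refl {P ⊛ Q}) (≋-trans (shift-cong (D-⊛ P Q)) (shift-⊕ (D P ⊛ Q) (P ⊛ D Q)))))
      (≋-trans (PS.solve 4 (λ x y z w → x PS.:+ (y PS.:+ (z PS.:+ w)) PS.:= (y PS.:+ z) PS.:+ (x PS.:+ w)) ≋-refl
                  (scale a (D Q)) (P ⊛ Q) (shift (D P ⊛ Q)) (shift (P ⊛ D Q)))
        (⊕-cong (≋-sym (≋-trans (⊛-distribʳ Q P (shift (D P))) (⊕-cong (≋-refl {P ⊛ Q}) (shift-⊛ (D P) Q)))) ≋-refl)))

    length-⊕ : ∀ P Q {n} → length P ℕ.≤ n → length Q ℕ.≤ n → length (P ⊕ Q) ℕ.≤ n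
    length-⊕ []      Q       p       q       = q
    length-⊕ (a ∷ P) []      p       q       = p
    length-⊕ (a ∷ P) (b ∷ Q) (ℕ.s≤s p) (ℕ.s≤s q) = ℕ.s≤s (length-⊕ P Q p q)

    length-⊛ : ∀ P Q → length (P ⊛ Q) ℕ.≤ length P ℕ.+ length Q
    length-⊛ []      Q = ℕ.z≤n
    length-⊛ (a ∷ P) Q = length-⊕ (scale a Q) (shift (P ⊛ Q))
      (≡.subst (ℕ._≤ suc (length P ℕ.+ length Q)) (≡.sym (length-map (a *_) Q)) (ℕₚ.m≤n+m _ (suc (length P))))
      (ℕ.s≤s (length-⊛ P Q))

    -- Sharper by one than `length-⊛`: degrees add, with length at most degree + 1. In powers the
    -- loss of one would recur with every factor.
    length-⊛′ : ∀ P Q {m n} → length P ℕ.≤ suc m → length Q ℕ.≤ suc n → length (P ⊛ Q) ℕ.≤ suc (m ℕ.+ n)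
    length-⊛′ []       Q             p q = ℕ.z≤n
    length-⊛′ (a ∷ []) Q {m} {n}     p q = length-⊕ (scale a Q) (shift [])
      (≡.subst (ℕ._≤ suc (m ℕ.+ n)) (≡.sym (length-map (a *_) Q)) (ℕₚ.≤-trans q (ℕ.s≤s (ℕₚ.m≤n+m n m))))
      (ℕ.s≤s ℕ.z≤n)
    length-⊛′ (a ∷ P@(_ ∷ _)) Q {suc m} {n} (ℕ.s≤s p) q = length-⊕ (scale a Q) (shift (P ⊛ Q))
      (≡.subst (ℕ._≤ suc (suc m ℕ.+ n)) (≡.sym (length-map (a *_) Q)) (ℕₚ.≤-trans q (ℕ.s≤s (ℕₚ.m≤n+m n (suc m)))))
      (ℕ.s≤s (length-⊛′ P Q p q))

    length-D : ∀ P → length (D P) ℕ.≤ length P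
    length-D []      = ℕ.z≤n
    length-D (a ∷ P) = length-⊕ P (shift (D P)) (ℕₚ.n≤1+n _) (ℕ.s≤s (length-D P))

    coef-length : ∀ P n → length P ℕ.≤ n → coef P n ≡ 0#
    coef-length []      n       le         = ≡.refl
    coef-length (a ∷ P) (suc n) (ℕ.s≤s le) = coef-length P n le

    open import Algebra.Properties.Semiring.Exp semiring using (_^_)
    open import Algebra.Properties.Semiring.Exp PR.semiring using () renaming (_^_ to _⊛^_)

    eval-^ : ∀ P n x → eval (P ⊛^ n) x ≈ eval P x ^ n
    eval-^ P zero    x = eval-one x
    eval-^ P (suc n) x = trans (eval-⊛ P (P ⊛^ n) x) (*-congˡ (eval-^ P n x))

    D-one : D one ≋ []
    D-one = shift-[]

    D-^ : ∀ P n → D (P ⊛^ suc n) ≋ scale (fromℕ (suc n)) (P ⊛^ n ⊛ D P)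
    D-^ P zero = ≋-trans (D-⊛ P one)
      (≋-trans (⊕-cong (⊛-comm (D P) one) (≋-trans (⊛-congˡ P D-one) (⊛-[] P)))
      (≋-trans (⊕-identityʳ _) (≋-sym (≋-trans (scale-cong (+-identityʳ 1#) ≋-refl) (scale-1 _)))))
    D-^ P (suc n) =
      ≋-trans (D-⊛ P Q)
      (≋-trans (⊕-cong (⊛-comm (D P) Q) step)
      (≋-trans (⊕-cong (≋-sym (scale-1 (Q ⊛ D P))) ≋-refl) (≋-sym (scale-+ 1# (fromℕ (suc n)) (Q ⊛ D P)))))
      where
      Q = P ⊛^ suc n
      step : P ⊛ D Q ≋ scale (fromℕ (suc n)) (Q ⊛ D P)
      step = ≋-trans (⊛-congˡ P (D-^ P n))
        (≋-trans (⊛-comm P (scale (fromℕ (suc n)) (P ⊛^ n ⊛ D P)))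
        (≋-trans (scale-⊛ (fromℕ (suc n)) (P ⊛^ n ⊛ D P) P)
          (scale-cong refl (≋-trans (⊛-comm (P ⊛^ n ⊛ D P) P) (≋-sym (⊛-assoc P (P ⊛^ n) (D P)))))))

    length-^ : ∀ P m n → length P ℕ.≤ suc m → length (P ⊛^ n) ℕ.≤ suc (n ℕ.* m)
    length-^ P m zero    le = ℕₚ.≤-refl
    length-^ P m (suc n) le = length-⊛′ P (P ⊛^ n) le (length-^ P m n le)

    shiftN : ℕ → Poly → Poly
    shiftN zero    P = P
    shiftN (suc k) P = shift (shiftN k P)

    shiftN-cong : ∀ k {P Q} → P ≋ Q → shiftN k P ≋ shiftN k Q
    shiftN-cong zero    e = e
    shiftN-cong (suc k) e = shift-cong (shiftN-cong k e)

    shiftN-[] : ∀ k → shiftN k [] ≋ []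
    shiftN-[] zero    = ≋-refl
    shiftN-[] (suc k) = ≋-trans (shift-cong (shiftN-[] k)) shift-[]

    ⊛-shiftN : ∀ k Q P → Q ⊛ shiftN k P ≋ shiftN k (Q ⊛ P)
    ⊛-shiftN zero    Q P = ≋-refl
    ⊛-shiftN (suc k) Q P = ≋-trans (⊛-comm Q (shift (shiftN k P)))
      (≋-trans (shift-⊛ (shiftN k P) Q) (shift-cong (≋-trans (⊛-comm (shiftN k P) Q) (⊛-shiftN k Q P))))

    coef-shiftN-low : ∀ k P i → i ℕ.< k → coef (shiftN k P) i ≡ 0#
    coef-shiftN-low (suc k) P zero    _          = ≡.refl
    coef-shiftN-low (suc k) P (suc i) (ℕ.s≤s lt) = coef-shiftN-low k P i lt

    coef-shiftN : ∀ k P i → coef (shiftN k P) (k ℕ.+ i) ≡ coef P i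
    coef-shiftN zero    P i = ≡.refl
    coef-shiftN (suc k) P i = coef-shiftN k P i

    eval-shiftN : ∀ k P x → eval (shiftN k P) x ≈ x ^ k * eval P x
    eval-shiftN zero    P x = sym (*-identityˡ _)
    eval-shiftN (suc k) P x =
      trans (eval-shift (shiftN k P) x) (trans (*-congˡ (eval-shiftN k P x)) (sym (*-assoc _ _ _)))

    D-shiftN : ∀ k P → D (shiftN (suc k) P) ≋ scale (fromℕ (suc k)) (shiftN k P) ⊕ shiftN (suc k) (D P)
    D-shiftN zero P = ⊕-cong (≋-sym (≋-trans (scale-cong (+-identityʳ 1#) ≋-refl) (scale-1 P))) ≋-refl
    D-shiftN (suc k) P =
      ≋-trans (⊕-cong (≋-sym (scale-1 Q)) (≋-trans (shift-cong (D-shiftN k P)) (shift-⊕ A B)))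
      (≋-trans (≋-sym (⊕-assoc (scale 1# Q) (shift A) (shift B)))
        (⊕-cong (≋-trans (⊕-cong (≋-refl {scale 1# Q}) (≋-sym (scale-shift (fromℕ (suc k)) (shiftN k P))))
                         (≋-sym (scale-+ 1# (fromℕ (suc k)) Q))) (≋-refl {shift B})))
      where
      Q = shiftN (suc k) P
      A = scale (fromℕ (suc k)) (shiftN k P)
      B = shiftN (suc k) (D P)

    length-shiftN : ∀ k P → length (shiftN k P) ≡ k ℕ.+ length P
    length-shiftN zero    P = ≡.refl
    length-shiftN (suc k) P = ≡.cong suc (length-shiftN k P)

    -- Divisibility by X^k, read off the coefficients; `low-split` produces the quotient.
    Low : ℕ → Poly → Set ℓ
    Low k P = ∀ i → i ℕ.< k → coef P i ≈ 0#

    low-split : ∀ k P → Low k P → P ≋ shiftN k (drop k P)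
    low-split zero    P       l = ≋-refl
    low-split (suc k) []      l = ≋-sym (shiftN-[] (suc k))
    low-split (suc k) (a ∷ P) l = mk≋ λ
      { zero → l 0 (ℕ.s≤s ℕ.z≤n) ; (suc n) → at (low-split k P (λ i lt → l (suc i) (ℕ.s≤s lt))) n }

    low-cong : ∀ {k P Q} → P ≋ Q → Low k P → Low k Q
    low-cong e l i lt = trans (sym (at e i)) (l i lt)

    low-⊕ : ∀ {k} P Q → Low k P → Low k Q → Low k (P ⊕ Q)
    low-⊕ P Q l m i lt = trans (coef-⊕ P Q i) (trans (+-cong (l i lt) (m i lt)) (+-identityˡ 0#))

    low-⊛ : ∀ {k} Q P → Low k P → Low k (Q ⊛ P)
    low-⊛ {k} Q P l = low-cong
      (≋-sym (≋-trans (⊛-congˡ Q (low-split k P l)) (⊛-shiftN k Q (drop k P))))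
      (λ i lt → reflexive (coef-shiftN-low k (Q ⊛ drop k P) i lt))

    low-length : ∀ k P → Low k P → length P ℕ.≤ k → P ≋ []
    low-length k P l le = mk≋ λ n → [ l n , (λ k≤n → reflexive (coef-length P n (ℕₚ.≤-trans le k≤n))) ]′ (ℕₚ.<-≤-connex n k)

    eval-0 : ∀ P → eval P 0# ≈ coef P 0
    eval-0 []      = refl
    eval-0 (a ∷ P) = trans (+-congˡ (zeroˡ _)) (+-identityʳ a)

-- Orders of vanishing and the number of multiple zeros

module Multiplicities where

  open import Algebra.Bundles using (CommutativeRing)
  open import Data.Nat as ℕ using (ℕ; zero; suc)
  import Data.Nat.Properties as ℕₚ
  open import Data.List using ([]; _∷_; length)
  open import Data.List.Relation.Unary.All as All using (All; []; _∷_)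
  open import Data.List.Relation.Unary.AllPairs using (AllPairs; []; _∷_)
  open import Data.Product using (_×_; _,_; ∃)
  open import Relation.Binary.PropositionalEquality as ≡ using (_≡_)
  open import Relation.Nullary using (¬_)
  open import Level using (_⊔_)
  open Polynomials

  NoZeroDivisors : ∀ {c ℓ} → CommutativeRing c ℓ → Set (c ⊔ ℓ)
  NoZeroDivisors K = ∀ {x y} → ¬ (x ≈ 0#) → x * y ≈ 0# → y ≈ 0#
    where open CommutativeRing K

  module Vanishing {c ℓ} (K : CommutativeRing c ℓ) (cancel : NoZeroDivisors K) where

    open CommutativeRing K hiding (_-_)
    open Polynomial K
    import Algebra.Solver.Ring.NaturalCoefficients.Default commutativeSemiring as KS
    import Algebra.Properties.Ring PR.ring as PRₚ
    import Relation.Binary.Reasoning.Setoid setoid as R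
    import Relation.Binary.Reasoning.Setoid PR.setoid as R≋

    lin : Carrier → Poly
    lin a = - a ∷ 1# ∷ []

    eval-lin : ∀ a x → eval (lin a) x ≈ - a + x
    eval-lin a x = +-congˡ (trans (*-congˡ (eval-one x)) (*-identityʳ x))

    eval-lin-self : ∀ a → eval (lin a) a ≈ 0#
    eval-lin-self a = trans (eval-lin a a) (-‿inverseˡ a)

    -a+x≈0⇒x≈a : ∀ a x → - a + x ≈ 0# → x ≈ a
    -a+x≈0⇒x≈a a x e = begin
      x              ≈⟨ +-identityˡ x ⟨
      0# + x         ≈⟨ +-congʳ (-‿inverseʳ a) ⟨
      a + - a + x    ≈⟨ +-assoc a (- a) x ⟩
      a + (- a + x)  ≈⟨ +-congˡ e ⟩
      a + 0#         ≈⟨ +-identityʳ a ⟩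
      a              ∎
      where open R

    D-lin : ∀ a → D (lin a) ≋ one
    D-lin a = ≋-trans (⊕-cong (≋-refl {one}) (≋-trans (shift-cong shift-[]) shift-[])) (⊕-identityʳ one)

    -- While the positive integers below n are nonzero in K, this is a zero of order n. Derivatives
    -- are used because Stepanov's auxiliary polynomial is controlled through a differential
    -- operator.
    data Van (a : Carrier) : ℕ → Poly → Set (c ⊔ ℓ) where
      []  : ∀ {P} → Van a 0 P
      _∷_ : ∀ {n P} → eval P a ≈ 0# → Van a n (D P) → Van a (suc n) P

    van-cong : ∀ {a n P Q} → P ≋ Q → Van a n P → Van a n Q
    van-cong e []      = []
    van-cong e (x ∷ v) = trans (sym (eval-cong e _)) x ∷ van-cong (D-cong e) v

    van-weaken : ∀ {a n P} → Van a (suc n) P → Van a n P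
    van-weaken {n = zero}  (x ∷ v) = []
    van-weaken {n = suc n} (x ∷ v) = x ∷ van-weaken v

    van-⊕ : ∀ {a n} P Q → Van a n P → Van a n Q → Van a n (P ⊕ Q)
    van-⊕ P Q []      []      = []
    van-⊕ P Q (x ∷ v) (y ∷ w) =
      trans (eval-⊕ P Q _) (trans (+-cong x y) (+-identityˡ 0#)) ∷
      van-cong (≋-sym (D-⊕ P Q)) (van-⊕ (D P) (D Q) v w)

    van-⊛ : ∀ {a n} Q P → Van a n P → Van a n (Q ⊛ P)
    van-⊛ Q P []          = []
    van-⊛ Q P v@(x ∷ v′) =
      trans (eval-⊛ Q P _) (trans (*-congˡ x) (zeroʳ _)) ∷
      van-cong (≋-sym (D-⊛ Q P)) (van-⊕ (D Q ⊛ P) (Q ⊛ D P) (van-⊛ (D Q) P (van-weaken v)) (van-⊛ Q (D P) v′))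

    van-⊕-cancelˡ : ∀ {a n} P Q → Van a n P → Van a n (P ⊕ Q) → Van a n Q
    van-⊕-cancelˡ P Q v w =
      van-cong lemma (van-⊕ (neg one ⊛ P) (P ⊕ Q) (van-⊛ (neg one) P v) w)
      where
      open R≋
      lemma : neg one ⊛ P ⊕ (P ⊕ Q) ≋ Q
      lemma = begin
        neg one ⊛ P ⊕ (P ⊕ Q)  ≈⟨ PR.+-assoc (neg one ⊛ P) P Q ⟨
        neg one ⊛ P ⊕ P ⊕ Q    ≈⟨ PR.+-congʳ {x = Q} (PR.+-congʳ {x = P} (PRₚ.-1*x≈-x P)) ⟩
        neg P ⊕ P ⊕ Q          ≈⟨ PR.+-congʳ {x = Q} (PR.-‿inverseˡ P) ⟩
        Q                      ∎

    -- h P′ = (h P)′ - h′ P, where the first term vanishes to the right order by assumption and the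
    -- second because, inductively, P already does.
    van-unit : ∀ {a n} h P → ¬ (eval h a ≈ 0#) → Van a n (h ⊛ P) → Van a n P
    van-unit h P u []          = []
    van-unit h P u v@(x ∷ v′) =
      cancel u (trans (sym (eval-⊛ h P _)) x) ∷
      van-unit h (D P) u
        (van-⊕-cancelˡ (D h ⊛ P) (h ⊛ D P) (van-⊛ (D h) P (van-unit h P u (van-weaken v)))
          (van-cong (D-⊛ h P) v′))

    -- The k-th derivative of (X - a) P is k P^(k-1) + (X - a) P^(k), and at a only the first term
    -- survives. `D` turns (k + 1) P + (X - a) P′ into the same shape for P′ with k + 2 in place of
    -- k + 1, which makes the induction possible.
    van-lin′ : ∀ a n k P → (∀ i → i ℕ.< n → ¬ (fromℕ (suc (k ℕ.+ i)) ≈ 0#)) →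
               Van a n (scale (fromℕ (suc k)) P ⊕ lin a ⊛ D P) → Van a n P
    van-lin′ a zero    k P nz []      = []
    van-lin′ a (suc n) k P nz (x ∷ v) =
      cancel (λ e → nz 0 (ℕ.s≤s ℕ.z≤n) (trans (reflexive (≡.cong (λ j → fromℕ (suc j)) (ℕₚ.+-identityʳ k))) e)) evalP ∷
      van-lin′ a n (suc k) (D P)
        (λ i i<n → ≡.subst (λ j → ¬ (fromℕ (suc j) ≈ 0#)) (ℕₚ.+-suc k i) (nz (suc i) (ℕ.s≤s i<n)))
        (van-cong D≋ v)
      where
      m = fromℕ (suc k)
      evalP : m * eval P a ≈ 0#
      evalP = begin
        m * eval P a                              ≈⟨ +-identityʳ _ ⟨
        m * eval P a + 0#                         ≈⟨ +-congˡ (zeroˡ _) ⟨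
        m * eval P a + 0# * eval (D P) a          ≈⟨ +-congˡ (*-congʳ (eval-lin-self a)) ⟨
        m * eval P a + eval (lin a) a * eval (D P) a ≈⟨ +-cong (eval-scale m P a) (eval-⊛ (lin a) (D P) a) ⟨
        eval (scale m P) a + eval (lin a ⊛ D P) a ≈⟨ eval-⊕ (scale m P) (lin a ⊛ D P) a ⟨
        eval (scale m P ⊕ lin a ⊛ D P) a          ≈⟨ x ⟩
        0#                                        ∎
        where open R
      D≋ : D (scale m P ⊕ lin a ⊛ D P) ≋ scale (fromℕ (suc (suc k))) (D P) ⊕ lin a ⊛ D (D P)
      D≋ = begin
        D (scale m P ⊕ lin a ⊛ D P)
          ≈⟨ D-⊕ (scale m P) (lin a ⊛ D P) ⟩
        D (scale m P) ⊕ D (lin a ⊛ D P)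
          ≈⟨ PR.+-cong (D-scale m P) (D-⊛ (lin a) (D P)) ⟩
        scale m (D P) ⊕ (D (lin a) ⊛ D P ⊕ lin a ⊛ D (D P))
          ≈⟨ PR.+-congˡ {x = scale m (D P)} (PR.+-congʳ {x = lin a ⊛ D (D P)} (PR.trans (PR.*-congʳ {x = D P} (D-lin a)) (scale-one 1# (D P)))) ⟩
        scale m (D P) ⊕ (scale 1# (D P) ⊕ lin a ⊛ D (D P))
          ≈⟨ PR.+-assoc (scale m (D P)) (scale 1# (D P)) (lin a ⊛ D (D P)) ⟨
        scale m (D P) ⊕ scale 1# (D P) ⊕ lin a ⊛ D (D P)
          ≈⟨ PR.+-congʳ {x = lin a ⊛ D (D P)} (PR.trans (PR.+-comm (scale m (D P)) (scale 1# (D P))) (PR.sym (scale-+ 1# m (D P)))) ⟩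
        scale (fromℕ (suc (suc k))) (D P) ⊕ lin a ⊛ D (D P) ∎
        where open R≋

    van-lin : ∀ a n P → (∀ i → i ℕ.< n → ¬ (fromℕ (suc i) ≈ 0#)) →
              Van a (suc n) (lin a ⊛ P) → Van a n P
    van-lin a n P nz (x ∷ v) = van-lin′ a n 0 P nz (van-cong e v)
      where
      open R≋
      e : D (lin a ⊛ P) ≋ scale (fromℕ 1) P ⊕ lin a ⊛ D P
      e = begin
        D (lin a ⊛ P)                 ≈⟨ D-⊛ (lin a) P ⟩
        D (lin a) ⊛ P ⊕ lin a ⊛ D P
          ≈⟨ PR.+-congʳ {x = lin a ⊛ D P} (PR.trans (PR.*-congʳ {x = P} (D-lin a))
               (PR.trans (scale-one 1# P) (scale-cong (sym (+-identityʳ 1#)) PR.refl))) ⟩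
        scale (fromℕ 1) P ⊕ lin a ⊛ D P ∎

    -- Synthetic division: the coefficients of the quotient by X - a are the values at a of the
    -- successive tails of P.
    quot : Carrier → Poly → Poly
    quot a []            = []
    quot a (x ∷ [])      = []
    quot a (x ∷ P@(_ ∷ _)) = eval P a ∷ quot a P

    quot-step : ∀ a x P Q e → P ≋ lin a ⊛ Q ⊕ (e ∷ []) → x ∷ P ≋ lin a ⊛ (e ∷ Q) ⊕ ((x + a * e) ∷ [])
    quot-step a x P Q e IH = ≋-sym (mk≋ λ
      { zero → begin
          (- a * e + 0#) + (x + a * e)
            ≈⟨ KS.solve 4 (λ na a e x → (na KS.:* e KS.:+ KS.con 0) KS.:+ (x KS.:+ a KS.:* e) KS.:= x KS.:+ (na KS.:+ a) KS.:* e) refl (- a) a e x ⟩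
          x + (- a + a) * e  ≈⟨ +-congˡ (trans (*-congʳ (-‿inverseˡ a)) (zeroˡ e)) ⟩
          x + 0#             ≈⟨ +-identityʳ x ⟩
          x                  ∎
      ; (suc n) → trans (at step n) (sym (at IH n)) })
      where
      open R
      e∷Q : scale 1# (e ∷ Q) ⊕ shift [] ≋ (e ∷ []) ⊕ shift Q
      e∷Q = ≋-trans (⊕-cong (scale-1 (e ∷ Q)) shift-[])
             (≋-trans (⊕-identityʳ (e ∷ Q)) (mk≋ λ { zero → sym (+-identityʳ e) ; (suc n) → refl }))
      step : (scale (- a) Q ⊕ (scale 1# (e ∷ Q) ⊕ shift [])) ⊕ [] ≋ lin a ⊛ Q ⊕ (e ∷ [])
      step = ≋-trans (⊕-identityʳ _) (≋-trans (⊕-cong (≋-refl {scale (- a) Q}) e∷Q)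
        (≋-trans (≋-trans (⊕-cong (≋-refl {scale (- a) Q}) (⊕-comm (e ∷ []) (shift Q))) (≋-sym (⊕-assoc (scale (- a) Q) (shift Q) (e ∷ []))))
          (⊕-cong (⊕-cong (≋-refl {scale (- a) Q}) (shift-cong (≋-sym (≋-trans (⊕-cong (scale-1 Q) shift-[]) (⊕-identityʳ Q)))))
                  (≋-refl {e ∷ []}))))

    quot-correct : ∀ a P → P ≋ lin a ⊛ quot a P ⊕ (eval P a ∷ [])
    quot-correct a []       = ≋-sym (≋-trans (⊕-cong (⊛-[] (lin a)) ≋-refl) shift-[])
    quot-correct a (x ∷ []) = ≋-sym (≋-trans (⊕-cong (⊛-[] (lin a)) (≋-refl {eval (x ∷ []) a ∷ []}))
      (mk≋ λ { zero → trans (+-congˡ (zeroʳ a)) (+-identityʳ x) ; (suc n) → refl }))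
    quot-correct a (x ∷ y ∷ P) =
      quot-step a x (y ∷ P) (quot a (y ∷ P)) (eval (y ∷ P) a) (quot-correct a (y ∷ P))

    root-factor : ∀ a P → eval P a ≈ 0# → P ≋ lin a ⊛ quot a P
    root-factor a P e = ≋-trans (quot-correct a P)
      (≋-trans (⊕-cong (≋-refl {lin a ⊛ quot a P}) (mk≋ λ { zero → e ; (suc n) → refl })) (⊕-identityʳ _))

    length-quot : ∀ a P n → length P ℕ.≤ suc n → length (quot a P) ℕ.≤ n
    length-quot a []                n       le         = ℕ.z≤n
    length-quot a (x ∷ [])          n       le         = ℕ.z≤n
    length-quot a (x ∷ P@(_ ∷ _)) (suc n) (ℕ.s≤s le) = ℕ.s≤s (length-quot a P n le)

    -- What survives of P once (X - a)^n is divided out, in the three respects that matter for the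
    -- next root: length, being nonzero, and vanishing elsewhere.
    Stripped : Carrier → ℕ → Poly → Set (c ⊔ ℓ)
    Stripped a N P = ∃ λ Q → length Q ℕ.≤ N × (Q ≋ [] → P ≋ []) × (∀ b m → ¬ (b ≈ a) → Van b m P → Van b m Q)

    strip : ∀ a n {N} P → (∀ i → i ℕ.< n → ¬ (fromℕ (suc i) ≈ 0#)) → Van a n P → length P ℕ.≤ n ℕ.+ N →
            Stripped a N P
    strip a zero    P nz v le = P , le , (λ e → e) , λ _ _ _ w → w
    strip a (suc n) {N} P nz v@(x ∷ _) le = lift (strip a n P′ nz′ (van-lin a n P′ nz′ (van-cong P≋ v)) (length-quot a P _ le))
      where
      P′ = quot a P
      P≋ = root-factor a P x
      nz′ : ∀ i → i ℕ.< n → ¬ (fromℕ (suc i) ≈ 0#)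
      nz′ i i<n = nz i (ℕₚ.m≤n⇒m≤1+n i<n)
      lift : Stripped a N P′ → Stripped a N P
      lift (Q , lQ , back , others) = Q , lQ
        , (λ e → ≋-trans P≋ (≋-trans (⊛-congˡ (lin a) (back e)) (⊛-[] (lin a))))
        , λ b m b≉a w → others b m b≉a
            (van-unit (lin a) P′ (λ e → b≉a (-a+x≈0⇒x≈a a b (trans (sym (eval-lin a b)) e))) (van-cong P≋ w))

    -- Each `strip` takes n off the length and keeps the vanishing at the remaining points, so after
    -- the last point nothing is left.
    zero-bound : ∀ n → (∀ i → i ℕ.< n → ¬ (fromℕ (suc i) ≈ 0#)) → ∀ ts P →
                 AllPairs (λ s t → ¬ (t ≈ s)) ts → All (λ t → Van t n P) ts →
                 length P ℕ.≤ length ts ℕ.* n → P ≋ []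
    zero-bound n nz []       []      _ _ _  = ≋-refl
    zero-bound n nz (t ∷ ts) P (d ∷ ds) (v ∷ vs) le = finish (strip t n P nz v le)
      where
      finish : Stripped t (length ts ℕ.* n) P → P ≋ []
      finish (Q , lQ , back , others) =
        back (zero-bound n nz ts Q ds (All.zipWith (λ (t≉ , w) → others _ n t≉ w) (d , vs)) lQ)

-- Stepanov's auxiliary polynomial

module StepanovMethod where

  open import Algebra.Bundles using (CommutativeRing)
  open import Data.Nat as ℕ using (ℕ; zero; suc)
  import Data.Nat.Properties as ℕₚ
  open import Data.Fin as Fin using (Fin; toℕ; fromℕ<; funToFin; finToFun)
  import Data.Fin.Properties as Finₚ
  open import Data.List using (List; []; _∷_; length; map; applyUpTo)
  open import Data.List.Properties using (length-map; length-applyUpTo)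
  open import Data.List.Relation.Unary.All as All using (All; []; _∷_)
  open import Data.List.Relation.Unary.AllPairs using (AllPairs; []; _∷_)
  open import Data.Product using (_×_; _,_; proj₁; proj₂; ∃)
  open import Data.Sum using (_⊎_; inj₁; inj₂; [_,_]′)
  open import Function using (_∘_)
  open import Relation.Binary.PropositionalEquality as ≡ using (_≡_)
  open import Relation.Binary.Definitions using (tri<; tri≈; tri>)
  open import Relation.Nullary using (¬_; yes; no; contradiction)
  open import Level using (_⊔_)
  open Polynomials
  open Multiplicities

  IsZero : ∀ {c ℓ} → CommutativeRing c ℓ → ℕ → Set ℓ
  IsZero K i = Polynomial.fromℕ K i ≈ 0#
    where open CommutativeRing K

  module Stepanov {c ℓ} (K : CommutativeRing c ℓ) (cancel : NoZeroDivisors K)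
    (n : ℕ) (1≤n : 1 ℕ.≤ n)
    (char : IsZero K (suc (n ℕ.+ n)))
    (unit : ∀ i → 0 ℕ.< i → i ℕ.< suc (n ℕ.+ n) → ¬ IsZero K i)
    (2≉0 : ¬ IsZero K 2)
    where

    open CommutativeRing K hiding (_-_)
    open Polynomial K
    open Vanishing K cancel

    private
      p : ℕ
      p = suc (n ℕ.+ n)

    import Algebra.Solver.Ring.NaturalCoefficients.Default commutativeSemiring as KS
    import Algebra.Solver.Ring.NaturalCoefficients.Default PR.commutativeSemiring as PS
    open import Algebra.Properties.Ring PR.ring using (-‿distribˡ-*; x∙y⁻¹≈ε⇒x≈y)
    open import Algebra.Properties.Semiring.Exp semiring using (_^_; ^-congˡ)
    open import Algebra.Properties.Semiring.Exp PR.semiring using (^-homo-*) renaming (_^_ to _⊛^_)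
    import Relation.Binary.Reasoning.Setoid setoid as R
    import Relation.Binary.Reasoning.Setoid PR.setoid as R≋

    fromℕ-+ : ∀ i j → fromℕ (i ℕ.+ j) ≈ fromℕ i + fromℕ j
    fromℕ-+ zero    j = sym (+-identityˡ _)
    fromℕ-+ (suc i) j = trans (+-congˡ (fromℕ-+ i j)) (sym (+-assoc _ _ _))

    -- X^p has derivative zero and so behaves like a constant. This is why the powers X^(j p) can
    -- multiply the number of free coefficients at no cost to the differential operator.
    D-shiftN-p : ∀ P → D (shiftN p P) ≋ shiftN p (D P)
    D-shiftN-p P = ≋-trans (D-shiftN (n ℕ.+ n) P)
      (⊕-cong (≋-trans (scale-cong char (≋-refl {shiftN (n ℕ.+ n) P})) (scale-0 _)) ≋-refl)

    -- The derivative of P^p vanishes, which kills the coefficients of X, …, X^(p-1).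
    coef-^p : ∀ P i → suc i ℕ.< p → coef (P ⊛^ p) (suc i) ≈ 0#
    coef-^p P i lt = cancel (unit (suc i) (ℕ.s≤s ℕ.z≤n) lt) (begin
      fromℕ (suc i) * coef (P ⊛^ p) (suc i)     ≈⟨ coef-D (P ⊛^ p) i ⟨
      coef (D (P ⊛^ p)) i                       ≈⟨ at (D-^ P (n ℕ.+ n)) i ⟩
      coef (scale (fromℕ p) (P ⊛^ (n ℕ.+ n) ⊛ D P)) i ≈⟨ coef-scale (fromℕ p) (P ⊛^ (n ℕ.+ n) ⊛ D P) i ⟩
      fromℕ p * coef (P ⊛^ (n ℕ.+ n) ⊛ D P) i   ≈⟨ *-congʳ char ⟩
      0# * coef (P ⊛^ (n ℕ.+ n) ⊛ D P) i        ≈⟨ zeroˡ _ ⟩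
      0#                                        ∎)
      where open R

    -- By `coef-^p` none of X, ..., X^(p-1) occurs in P^p, and the constant term is P(0)^p = P(0).
    -- Fermat's theorem is an argument because it is itself derived from `freshman`.
    frobenius : (∀ x → x ^ p ≈ x) → ∀ P → Low p (P ⊛^ p ⊕ neg (eval P 0# ∷ []))
    frobenius fermat P zero    lt = begin
      coef (P ⊛^ p ⊕ neg (eval P 0# ∷ [])) 0   ≈⟨ coef-⊕ (P ⊛^ p) (neg (eval P 0# ∷ [])) 0 ⟩
      coef (P ⊛^ p) 0 + - eval P 0#            ≈⟨ +-congʳ (eval-0 (P ⊛^ p)) ⟨
      eval (P ⊛^ p) 0# + - eval P 0#           ≈⟨ +-congʳ (trans (eval-^ P p 0#) (fermat (eval P 0#))) ⟩
      eval P 0# + - eval P 0#                  ≈⟨ -‿inverseʳ _ ⟩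
      0#                                       ∎
      where open R
    frobenius fermat P (suc i) lt = begin
      coef (P ⊛^ p ⊕ neg (eval P 0# ∷ [])) (suc i) ≈⟨ coef-⊕ (P ⊛^ p) (neg (eval P 0# ∷ [])) (suc i) ⟩
      coef (P ⊛^ p) (suc i) + 0#                   ≈⟨ +-identityʳ _ ⟩
      coef (P ⊛^ p) (suc i)                        ≈⟨ coef-^p P i lt ⟩
      0#                                           ∎
      where open R

    1^ : ∀ k → 1# ^ k ≈ 1#
    1^ zero    = refl
    1^ (suc k) = trans (*-identityˡ _) (1^ k)

    -- `coef-^p` removes the middle coefficients of (1 + X)^p, in place of the divisibility of
    -- binomial coefficients by p; the two outer ones are 1.
    freshman : ∀ x → (1# + x) ^ p ≈ 1# + x ^ p
    freshman x = begin
      (1# + x) ^ p                       ≈⟨ ^-congˡ p (+-congˡ (trans (*-congˡ (eval-one x)) (*-identityʳ x))) ⟨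
      eval L x ^ p                       ≈⟨ eval-^ L p x ⟨
      eval (L ⊛^ p) x                    ≈⟨ eval-cong {L ⊛^ p} {one ⊕ shiftN p one} (mk≋ coefs) x ⟩
      eval (one ⊕ shiftN p one) x        ≈⟨ eval-⊕ one (shiftN p one) x ⟩
      eval one x + eval (shiftN p one) x ≈⟨ +-cong (eval-one x) (trans (eval-shiftN p one x) (trans (*-congˡ (eval-one x)) (*-identityʳ _))) ⟩
      1# + x ^ p                         ∎
      where
      open R
      L = 1# ∷ 1# ∷ []
      L-length : ∀ k → length (L ⊛^ k) ℕ.≤ suc k
      L-length k = ≡.subst (λ j → length (L ⊛^ k) ℕ.≤ suc j) (ℕₚ.*-identityʳ k) (length-^ L 1 k ℕₚ.≤-refl)
      top : ∀ k → coef (L ⊛^ k) k ≈ 1#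
      top zero    = refl
      top (suc k) = begin
        coef (L ⊛ L ⊛^ k) (suc k)
          ≈⟨ coef-⊕ (scale 1# (L ⊛^ k)) (shift (one ⊛ L ⊛^ k)) (suc k) ⟩
        coef (scale 1# (L ⊛^ k)) (suc k) + coef (one ⊛ L ⊛^ k) k
          ≈⟨ +-cong (at (scale-1 (L ⊛^ k)) (suc k)) (at (⊛-identityˡ (L ⊛^ k)) k) ⟩
        coef (L ⊛^ k) (suc k) + coef (L ⊛^ k) k
          ≈⟨ +-cong (reflexive (coef-length (L ⊛^ k) (suc k) (L-length k))) (top k) ⟩
        0# + 1#
          ≈⟨ +-identityˡ 1# ⟩
        1# ∎
      coefs : ∀ i → coef (L ⊛^ p) i ≈ coef (one ⊕ shiftN p one) i
      coefs zero = begin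
        coef (L ⊛^ p) 0    ≈⟨ eval-0 (L ⊛^ p) ⟨
        eval (L ⊛^ p) 0#   ≈⟨ eval-^ L p 0# ⟩
        eval L 0# ^ p      ≈⟨ ^-congˡ p (eval-0 L) ⟩
        1# ^ p             ≈⟨ 1^ p ⟩
        1#                 ≈⟨ +-identityʳ 1# ⟨
        1# + 0#            ∎
      coefs (suc i) with ℕₚ.<-cmp (suc i) p
      ... | tri< i<p _ _ = trans (coef-^p L i i<p) (reflexive (≡.sym (coef-shiftN-low p one (suc i) i<p)))
      ... | tri≈ _ ≡.refl _ = trans (top p)
              (reflexive (≡.sym (≡.trans (≡.cong (coef (shiftN p one)) (≡.sym (ℕₚ.+-identityʳ p))) (coef-shiftN p one 0))))
      ... | tri> _ _ p<i = reflexive (≡.trans (coef-length (L ⊛^ p) (suc i) (ℕₚ.≤-trans (L-length p) p<i))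
              (≡.sym (coef-length (shiftN p one) (suc i)
                (ℕₚ.≤-trans (ℕₚ.≤-reflexive (≡.trans (length-shiftN p one) (ℕₚ.+-comm p 1))) p<i))))

    -- For a ≠ 0 the factor X - a is invertible as a power series, so the coefficients of P vanish
    -- one after another from the constant term upwards.
    lin-cancel : ∀ a P → ¬ (a ≈ 0#) → lin a ⊛ P ≋ [] → P ≋ []
    lin-cancel a P a≉0 e = mk≋ go
      where
      open R
      cancel-a : ∀ i → - a * coef P i ≈ 0# → coef P i ≈ 0#
      cancel-a i h = cancel (λ -a≈0 → a≉0 (begin
        a          ≈⟨ +-identityʳ a ⟨
        a + 0#     ≈⟨ +-congˡ -a≈0 ⟨
        a + - a    ≈⟨ -‿inverseʳ a ⟩
        0#         ∎)) h
      coef-lin : ∀ i → coef (lin a ⊛ P) (suc i) ≈ - a * coef P (suc i) + coef P i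
      coef-lin i = begin
        coef (lin a ⊛ P) (suc i)
          ≈⟨ coef-⊕ (scale (- a) P) (shift (one ⊛ P)) (suc i) ⟩
        coef (scale (- a) P) (suc i) + coef (one ⊛ P) i
          ≈⟨ +-cong (coef-scale (- a) P (suc i)) (at (⊛-identityˡ P) i) ⟩
        - a * coef P (suc i) + coef P i ∎
      go : ∀ i → coef P i ≈ 0#
      go zero    = cancel-a 0 (begin
        - a * coef P 0             ≈⟨ coef-scale (- a) P 0 ⟨
        coef (scale (- a) P) 0     ≈⟨ +-identityʳ _ ⟨
        coef (scale (- a) P) 0 + 0# ≈⟨ coef-⊕ (scale (- a) P) (shift (one ⊛ P)) 0 ⟨
        coef (lin a ⊛ P) 0         ≈⟨ at e 0 ⟩
        0#                         ∎)
      go (suc i) = cancel-a (suc i) (begin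
        - a * coef P (suc i)             ≈⟨ +-identityʳ _ ⟨
        - a * coef P (suc i) + 0#        ≈⟨ +-congˡ (go i) ⟨
        - a * coef P (suc i) + coef P i  ≈⟨ coef-lin i ⟨
        coef (lin a ⊛ P) (suc i)         ≈⟨ at e (suc i) ⟩
        0#                               ∎)

    lin-cancel-≋ : ∀ a P Q → ¬ (a ≈ 0#) → lin a ⊛ P ≋ lin a ⊛ Q → P ≋ Q
    lin-cancel-≋ a P Q a≉0 e = x∙y⁻¹≈ε⇒x≈y P Q (lin-cancel a (P ⊕ neg Q) a≉0 (begin
      lin a ⊛ (P ⊕ neg Q)            ≈⟨ PR.distribˡ (lin a) P (neg Q) ⟩
      lin a ⊛ P ⊕ lin a ⊛ neg Q      ≈⟨ PR.+-congʳ {x = lin a ⊛ neg Q} e ⟩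
      lin a ⊛ Q ⊕ lin a ⊛ neg Q      ≈⟨ PR.distribˡ (lin a) Q (neg Q) ⟨
      lin a ⊛ (Q ⊕ neg Q)            ≈⟨ PR.*-congˡ {x = lin a} (PR.-‿inverseʳ Q) ⟩
      lin a ⊛ []                     ≈⟨ ⊛-[] (lin a) ⟩
      []                             ∎))
      where open R≋

    square-zero : (∀ x → (x ≈ 0#) ⊎ ¬ (x ≈ 0#)) → ∀ x → x * x ≈ 0# → x ≈ 0#
    square-zero dec x e = [ (λ h → h) , (λ h → cancel h e) ]′ (dec x)

    module Auxiliary
      (fermat : ∀ x → x ^ p ≈ x)
      (dec0 : ∀ x → (x ≈ 0#) ⊎ ¬ (x ≈ 0#))
      (f f₁ : Poly) (a : Carrier)
      (f≋ : f ≋ lin a ⊛ f₁)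
      (a≉0 : ¬ (a ≈ 0#))
      (f₁a≉0 : ¬ (eval f₁ a ≈ 0#))
      (f0≉0 : ¬ (eval f 0# ≈ 0#))
      where

      -- The odd multiplicity of the root a of f excludes f r² = const · s².
      non-square : ∀ d r s → length r ℕ.≤ d → length s ℕ.≤ d →
                   f ⊛ (r ⊛ r) ≋ (eval f 0# ∷ []) ⊛ (s ⊛ s) → (r ≋ []) × (s ≋ [])
      non-square zero    []      []      _  _  e = ≋-refl , ≋-refl
      non-square zero    []      (_ ∷ _) _  () e
      non-square zero    (_ ∷ _) s       () _  e
      non-square (suc d) r s lr ls e =
        -- Descent: a is a root of s, therefore of r, and dividing both by X - a gives the same
        -- equation in smaller length.
        back r r≋ (proj₁ ih) , back s s≋ (proj₂ ih)
        where
        c₀ = eval f 0# ∷ []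
        s-root : eval s a ≈ 0#
        s-root = square-zero dec0 _ (cancel f0≉0 (begin
          eval f 0# * (eval s a * eval s a) ≈⟨ *-cong (trans (+-congˡ (zeroʳ a)) (+-identityʳ _)) (eval-⊛ s s a) ⟨
          eval c₀ a * eval (s ⊛ s) a        ≈⟨ eval-⊛ c₀ (s ⊛ s) a ⟨
          eval (c₀ ⊛ (s ⊛ s)) a             ≈⟨ eval-cong e a ⟨
          eval (f ⊛ (r ⊛ r)) a              ≈⟨ eval-⊛ f (r ⊛ r) a ⟩
          eval f a * eval (r ⊛ r) a         ≈⟨ *-congʳ (trans (eval-cong f≋ a) (trans (eval-⊛ (lin a) f₁ a) (trans (*-congʳ (eval-lin-self a)) (zeroˡ _)))) ⟩
          0# * eval (r ⊛ r) a               ≈⟨ zeroˡ _ ⟩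
          0#                                ∎))
          where open R
        s₁ = quot a s
        s≋ : s ≋ lin a ⊛ s₁
        s≋ = root-factor a s s-root
        e₁ : f₁ ⊛ (r ⊛ r) ≋ lin a ⊛ (c₀ ⊛ (s₁ ⊛ s₁))
        e₁ = lin-cancel-≋ a _ _ a≉0 (begin
          lin a ⊛ (f₁ ⊛ (r ⊛ r))              ≈⟨ PR.*-assoc (lin a) f₁ (r ⊛ r) ⟨
          lin a ⊛ f₁ ⊛ (r ⊛ r)                ≈⟨ PR.*-congʳ {x = r ⊛ r} f≋ ⟨
          f ⊛ (r ⊛ r)                         ≈⟨ e ⟩
          c₀ ⊛ (s ⊛ s)                        ≈⟨ PR.*-congˡ {x = c₀} (PR.*-cong s≋ s≋) ⟩
          c₀ ⊛ (lin a ⊛ s₁ ⊛ (lin a ⊛ s₁))    ≈⟨ shuffle c₀ (lin a) s₁ ⟩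
          lin a ⊛ (lin a ⊛ (c₀ ⊛ (s₁ ⊛ s₁)))  ∎)
          where
          open R≋
          shuffle : ∀ x y z → x ⊛ (y ⊛ z ⊛ (y ⊛ z)) ≋ y ⊛ (y ⊛ (x ⊛ (z ⊛ z)))
          shuffle = PS.solve 3 (λ x y z → x PS.:* (y PS.:* z PS.:* (y PS.:* z)) PS.:= y PS.:* (y PS.:* (x PS.:* (z PS.:* z)))) ≋-refl
        r-root : eval r a ≈ 0#
        r-root = square-zero dec0 _ (cancel f₁a≉0 (begin
          eval f₁ a * (eval r a * eval r a)   ≈⟨ *-congˡ (eval-⊛ r r a) ⟨
          eval f₁ a * eval (r ⊛ r) a          ≈⟨ eval-⊛ f₁ (r ⊛ r) a ⟨
          eval (f₁ ⊛ (r ⊛ r)) a               ≈⟨ eval-cong e₁ a ⟩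
          eval (lin a ⊛ (c₀ ⊛ (s₁ ⊛ s₁))) a   ≈⟨ eval-⊛ (lin a) (c₀ ⊛ (s₁ ⊛ s₁)) a ⟩
          eval (lin a) a * _                  ≈⟨ *-congʳ (eval-lin-self a) ⟩
          0# * _                              ≈⟨ zeroˡ _ ⟩
          0#                                  ∎))
          where open R
        r₁ = quot a r
        r≋ : r ≋ lin a ⊛ r₁
        r≋ = root-factor a r r-root
        e₂ : f ⊛ (r₁ ⊛ r₁) ≋ c₀ ⊛ (s₁ ⊛ s₁)
        e₂ = lin-cancel-≋ a _ _ a≉0 (begin
          lin a ⊛ (f ⊛ (r₁ ⊛ r₁))             ≈⟨ PR.*-congˡ {x = lin a} (PR.*-congʳ {x = r₁ ⊛ r₁} f≋) ⟩
          lin a ⊛ (lin a ⊛ f₁ ⊛ (r₁ ⊛ r₁))    ≈⟨ shuffle (lin a) f₁ r₁ ⟩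
          f₁ ⊛ (lin a ⊛ r₁ ⊛ (lin a ⊛ r₁))    ≈⟨ PR.*-congˡ {x = f₁} (PR.*-cong r≋ r≋) ⟨
          f₁ ⊛ (r ⊛ r)                        ≈⟨ e₁ ⟩
          lin a ⊛ (c₀ ⊛ (s₁ ⊛ s₁))            ∎)
          where
          open R≋
          shuffle : ∀ y x z → y ⊛ (y ⊛ x ⊛ (z ⊛ z)) ≋ x ⊛ (y ⊛ z ⊛ (y ⊛ z))
          shuffle = PS.solve 3 (λ y x z → y PS.:* (y PS.:* x PS.:* (z PS.:* z)) PS.:= x PS.:* (y PS.:* z PS.:* (y PS.:* z))) ≋-refl
        ih : (r₁ ≋ []) × (s₁ ≋ [])
        ih = non-square d r₁ s₁ (length-quot a r d lr) (length-quot a s d ls) e₂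
        back : ∀ q → q ≋ lin a ⊛ quot a q → quot a q ≋ [] → q ≋ []
        back q h z = ≋-trans h (≋-trans (⊛-congˡ (lin a) z) (⊛-[] (lin a)))

      g : Poly
      g = f ⊛^ n

      -- Multiplication by f (r - s g) gives f r² - s² f^p, because f g² = f^p, and f^p is f(0)
      -- modulo X^p by `frobenius`. So X^p divides f r² - f(0) s², whose length is at most p; hence
      -- this is zero and `non-square` applies.
      independent : ∀ d r s → length f ℕ.+ (d ℕ.+ d) ℕ.≤ p → length r ℕ.≤ d → length s ℕ.≤ d →
                    Low p (r ⊕ s ⊛ g) → (r ≋ []) × (s ≋ [])
      independent d r s le lr ls low =
        non-square d r s lr ls (x∙y⁻¹≈ε⇒x≈y (f ⊛ (r ⊛ r)) (c₀ ⊛ (s ⊛ s)) (low-length p E E-low E-length))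
        where
        c₀ = eval f 0# ∷ []
        E = f ⊛ (r ⊛ r) ⊕ neg (c₀ ⊛ (s ⊛ s))
        E≋ : f ⊛ (r ⊕ neg s ⊛ g) ⊛ (r ⊕ s ⊛ g) ⊕ s ⊛ s ⊛ (f ⊛^ p ⊕ neg c₀) ≋ E
        E≋ = begin
          f ⊛ (r ⊕ neg s ⊛ g) ⊛ (r ⊕ s ⊛ g) ⊕ s ⊛ s ⊛ (f ⊛^ p ⊕ neg c₀)
            ≈⟨ PR.+-congˡ {x = f ⊛ (r ⊕ neg s ⊛ g) ⊛ (r ⊕ s ⊛ g)} (PR.*-congˡ {x = s ⊛ s} (PR.+-congʳ {x = neg c₀} (PR.*-congˡ {x = f} (^-homo-* f n n)))) ⟩
          f ⊛ (r ⊕ neg s ⊛ g) ⊛ (r ⊕ s ⊛ g) ⊕ s ⊛ s ⊛ (f ⊛ (g ⊛ g) ⊕ neg c₀)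
            ≈⟨ expand f r s (neg s) g (neg c₀) ⟩
          f ⊛ (r ⊛ r) ⊕ (s ⊕ neg s) ⊛ (f ⊛ r ⊛ g ⊕ f ⊛ s ⊛ g ⊛ g) ⊕ neg c₀ ⊛ (s ⊛ s)
            ≈⟨ PR.+-cong (PR.+-congˡ {x = f ⊛ (r ⊛ r)} (PR.*-congʳ {x = f ⊛ r ⊛ g ⊕ f ⊛ s ⊛ g ⊛ g} (PR.-‿inverseʳ s))) (≋-sym (-‿distribˡ-* c₀ (s ⊛ s))) ⟩
          f ⊛ (r ⊛ r) ⊕ [] ⊕ neg (c₀ ⊛ (s ⊛ s))
            ≈⟨ PR.+-congʳ {x = neg (c₀ ⊛ (s ⊛ s))} (⊕-identityʳ (f ⊛ (r ⊛ r))) ⟩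
          E ∎
          where
          open R≋
          expand : ∀ f r s ns g nc → f ⊛ (r ⊕ ns ⊛ g) ⊛ (r ⊕ s ⊛ g) ⊕ s ⊛ s ⊛ (f ⊛ (g ⊛ g) ⊕ nc)
                   ≋ f ⊛ (r ⊛ r) ⊕ (s ⊕ ns) ⊛ (f ⊛ r ⊛ g ⊕ f ⊛ s ⊛ g ⊛ g) ⊕ nc ⊛ (s ⊛ s)
          expand = PS.solve 6 (λ f r s ns g nc →
            f PS.:* (r PS.:+ ns PS.:* g) PS.:* (r PS.:+ s PS.:* g) PS.:+ s PS.:* s PS.:* (f PS.:* (g PS.:* g) PS.:+ nc)
            PS.:= f PS.:* (r PS.:* r) PS.:+ (s PS.:+ ns) PS.:* (f PS.:* r PS.:* g PS.:+ f PS.:* s PS.:* g PS.:* g) PS.:+ nc PS.:* (s PS.:* s)) ≋-refl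
        E-low : Low p E
        E-low = low-cong E≋ (low-⊕ (f ⊛ (r ⊕ neg s ⊛ g) ⊛ (r ⊕ s ⊛ g)) (s ⊛ s ⊛ (f ⊛^ p ⊕ neg c₀))
          (low-⊛ (f ⊛ (r ⊕ neg s ⊛ g)) (r ⊕ s ⊛ g) low) (low-⊛ (s ⊛ s) (f ⊛^ p ⊕ neg c₀) (frobenius fermat f)))
        E-length : length E ℕ.≤ p
        E-length = length-⊕ (f ⊛ (r ⊛ r)) (neg (c₀ ⊛ (s ⊛ s)))
          (ℕₚ.≤-trans (length-⊛ f (r ⊛ r)) (ℕₚ.≤-trans (ℕₚ.+-monoʳ-≤ (length f) (ℕₚ.≤-trans (length-⊛ r r) (ℕₚ.+-mono-≤ lr lr))) le))
          (ℕₚ.≤-trans (ℕₚ.≤-reflexive (length-map (-_) (c₀ ⊛ (s ⊛ s))))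
            (ℕₚ.≤-trans (length-⊛ c₀ (s ⊛ s)) (ℕₚ.≤-trans (ℕₚ.+-mono-≤ 1≤f (ℕₚ.≤-trans (length-⊛ s s) (ℕₚ.+-mono-≤ ls ls))) le)))
          where
          1≤f : 1 ℕ.≤ length f
          1≤f = nonempty f f0≉0
            where
            nonempty : ∀ P → ¬ (eval P 0# ≈ 0#) → 1 ℕ.≤ length P
            nonempty []      h = contradiction refl h
            nonempty (_ ∷ _) h = ℕ.s≤s ℕ.z≤n

      F₂ : Poly
      F₂ = scale (fromℕ 2) f

      -- g = f^n satisfies 2 f g′ = 2 n f′ g = - f′ g.
      F₂-Dg : F₂ ⊛ D g ≋ neg (D f) ⊛ g
      F₂-Dg = x∙y⁻¹≈ε⇒x≈y (F₂ ⊛ D g) (neg (D f) ⊛ g) (begin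
        F₂ ⊛ D g ⊕ neg (neg (D f) ⊛ g)
          ≈⟨ PR.+-cong (scale-⊛ (fromℕ 2) f (D g)) (≋-sym (≋-trans (⊛-comm g (D f)) (≋-trans (≋-sym (neg-neg (D f ⊛ g))) (neg-cong (-‿distribˡ-* (D f) g))))) ⟩
        scale (fromℕ 2) (f ⊛ D g) ⊕ g ⊛ D f
          ≈⟨ PR.+-cong (≋-trans (scale-cong refl (f-Dg n 1≤n)) (scale-* (fromℕ 2) (fromℕ n) (g ⊛ D f))) (≋-sym (scale-1 (g ⊛ D f))) ⟩
        scale (fromℕ 2 * fromℕ n) (g ⊛ D f) ⊕ scale 1# (g ⊛ D f)
          ≈⟨ scale-+ (fromℕ 2 * fromℕ n) 1# (g ⊛ D f) ⟨
        scale (fromℕ 2 * fromℕ n + 1#) (g ⊛ D f)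
          ≈⟨ scale-cong 2n+1 (≋-refl {g ⊛ D f}) ⟩
        scale 0# (g ⊛ D f)
          ≈⟨ scale-0 (g ⊛ D f) ⟩
        [] ∎)
        where
        open R≋
        open import Algebra.Properties.Ring PR.ring using () renaming (-‿involutive to neg-neg)
        f-Dg : ∀ m → 1 ℕ.≤ m → f ⊛ D (f ⊛^ m) ≋ scale (fromℕ m) (f ⊛^ m ⊛ D f)
        f-Dg (suc m) _ = begin
          f ⊛ D (f ⊛^ suc m)                          ≈⟨ PR.*-congˡ {x = f} (D-^ f m) ⟩
          f ⊛ scale (fromℕ (suc m)) (f ⊛^ m ⊛ D f)    ≈⟨ ⊛-comm f (scale (fromℕ (suc m)) (f ⊛^ m ⊛ D f)) ⟩
          scale (fromℕ (suc m)) (f ⊛^ m ⊛ D f) ⊛ f    ≈⟨ scale-⊛ (fromℕ (suc m)) (f ⊛^ m ⊛ D f) f ⟩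
          scale (fromℕ (suc m)) (f ⊛^ m ⊛ D f ⊛ f)    ≈⟨ scale-cong refl (≋-trans (⊛-comm (f ⊛^ m ⊛ D f) f) (≋-sym (⊛-assoc f (f ⊛^ m) (D f)))) ⟩
          scale (fromℕ (suc m)) (f ⊛^ suc m ⊛ D f)    ∎
        2n+1 : fromℕ 2 * fromℕ n + 1# ≈ 0#
        2n+1 = trans (KS.solve 1 (λ x → (KS.con 1 KS.:+ (KS.con 1 KS.:+ KS.con 0)) KS.:* x KS.:+ KS.con 1 KS.:= KS.con 1 KS.:+ (x KS.:+ x)) refl (fromℕ n))
               (trans (+-congˡ (sym (fromℕ-+ n n))) char)

      -- θ = 2 f d/dX acts on r + s g through ∇, and Φ [(r₀ , s₀) , …] = Σ (r_j + s_j g) X^(j p).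
      θ : Poly → Poly
      θ P = F₂ ⊛ D P

      Pair : Set c
      Pair = Poly × Poly

      ∇ : Pair → Pair
      ∇ (r , s) = F₂ ⊛ D r , F₂ ⊛ D s ⊕ neg (D f) ⊛ s

      Φ : List Pair → Poly
      Φ []             = []
      Φ ((r , s) ∷ rs) = (r ⊕ s ⊛ g) ⊕ shiftN p (Φ rs)

      θ-⊕ : ∀ P Q → θ (P ⊕ Q) ≋ θ P ⊕ θ Q
      θ-⊕ P Q = ≋-trans (⊛-congˡ F₂ (D-⊕ P Q)) (⊛-distribˡ F₂ (D P) (D Q))

      θ-g : ∀ s → θ (s ⊛ g) ≋ (F₂ ⊛ D s ⊕ neg (D f) ⊛ s) ⊛ g
      θ-g s = begin
        F₂ ⊛ D (s ⊛ g)                       ≈⟨ PR.*-congˡ {x = F₂} (D-⊛ s g) ⟩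
        F₂ ⊛ (D s ⊛ g ⊕ s ⊛ D g)             ≈⟨ e₁ F₂ (D s) g s (D g) ⟩
        F₂ ⊛ D s ⊛ g ⊕ s ⊛ (F₂ ⊛ D g)        ≈⟨ PR.+-congˡ {x = F₂ ⊛ D s ⊛ g} (PR.*-congˡ {x = s} F₂-Dg) ⟩
        F₂ ⊛ D s ⊛ g ⊕ s ⊛ (neg (D f) ⊛ g)   ≈⟨ e₂ (F₂ ⊛ D s) g s (neg (D f)) ⟩
        (F₂ ⊛ D s ⊕ neg (D f) ⊛ s) ⊛ g       ∎
        where
        open R≋
        e₁ : ∀ a b c d e → a ⊛ (b ⊛ c ⊕ d ⊛ e) ≋ a ⊛ b ⊛ c ⊕ d ⊛ (a ⊛ e)
        e₁ = PS.solve 5 (λ a b c d e → a PS.:* (b PS.:* c PS.:+ d PS.:* e) PS.:= a PS.:* b PS.:* c PS.:+ d PS.:* (a PS.:* e)) ≋-refl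
        e₂ : ∀ a c d e → a ⊛ c ⊕ d ⊛ (e ⊛ c) ≋ (a ⊕ e ⊛ d) ⊛ c
        e₂ = PS.solve 4 (λ a c d e → a PS.:* c PS.:+ d PS.:* (e PS.:* c) PS.:= (a PS.:+ e PS.:* d) PS.:* c) ≋-refl

      -- θ passes through the powers X^(j p) and maps multiples of g to multiples of g, so its
      -- iterates never leave the family Φ; only the degrees of the pairs grow.
      θ-Φ : ∀ rs → θ (Φ rs) ≋ Φ (map ∇ rs)
      θ-Φ []             = ⊛-[] F₂
      θ-Φ ((r , s) ∷ rs) = begin
        θ ((r ⊕ s ⊛ g) ⊕ shiftN p (Φ rs))                     ≈⟨ θ-⊕ (r ⊕ s ⊛ g) (shiftN p (Φ rs)) ⟩
        θ (r ⊕ s ⊛ g) ⊕ θ (shiftN p (Φ rs))                   ≈⟨ PR.+-cong (≋-trans (θ-⊕ r (s ⊛ g)) (PR.+-congˡ {x = θ r} (θ-g s))) tail≋ ⟩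
        (θ r ⊕ (F₂ ⊛ D s ⊕ neg (D f) ⊛ s) ⊛ g) ⊕ shiftN p (Φ (map ∇ rs)) ∎
        where
        open R≋
        tail≋ : θ (shiftN p (Φ rs)) ≋ shiftN p (Φ (map ∇ rs))
        tail≋ = ≋-trans (⊛-congˡ F₂ (D-shiftN-p (Φ rs)))
          (≋-trans (⊛-shiftN p F₂ (D (Φ rs))) (shiftN-cong p (θ-Φ rs)))

      -- The coefficients of Φ below X^p come from its first pair only. So `independent` annihilates
      -- that pair, X^p is divided out and the argument repeats.
      Φ-independent : ∀ d rs → length f ℕ.+ (d ℕ.+ d) ℕ.≤ p →
                      All (λ (r , s) → length r ℕ.≤ d × length s ℕ.≤ d) rs →
                      Φ rs ≋ [] → All (λ (r , s) → (r ≋ []) × (s ≋ [])) rs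
      Φ-independent d []             le []              e = []
      Φ-independent d ((r , s) ∷ rs) le ((lr , ls) ∷ l) e = rs≋ ∷ Φ-independent d rs le l Φ≋
        where
        open R
        low : Low p (r ⊕ s ⊛ g)
        low i lt = begin
          coef (r ⊕ s ⊛ g) i                               ≈⟨ +-identityʳ _ ⟨
          coef (r ⊕ s ⊛ g) i + 0#                          ≈⟨ +-congˡ (reflexive (coef-shiftN-low p (Φ rs) i lt)) ⟨
          coef (r ⊕ s ⊛ g) i + coef (shiftN p (Φ rs)) i    ≈⟨ coef-⊕ (r ⊕ s ⊛ g) (shiftN p (Φ rs)) i ⟨
          coef (Φ ((r , s) ∷ rs)) i                        ≈⟨ at e i ⟩
          0#                                               ∎
        rs≋ : (r ≋ []) × (s ≋ [])
        rs≋ = independent d r s le lr ls low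
        r⊕sg≋ : r ⊕ s ⊛ g ≋ []
        r⊕sg≋ = ⊕-cong (proj₁ rs≋) (⊛-cong (proj₂ rs≋) (≋-refl {g}))
        Φ≋ : Φ rs ≋ []
        Φ≋ = mk≋ λ i → begin
          coef (Φ rs) i                            ≡⟨ coef-shiftN p (Φ rs) i ⟨
          coef (shiftN p (Φ rs)) (p ℕ.+ i)         ≈⟨ at (⊕-cong r⊕sg≋ (≋-refl {shiftN p (Φ rs)})) (p ℕ.+ i) ⟨
          coef (Φ ((r , s) ∷ rs)) (p ℕ.+ i)        ≈⟨ at e (p ℕ.+ i) ⟩
          0#                                       ∎

      length-F₂⊛D : ∀ {d} r → length r ℕ.≤ d → length (F₂ ⊛ D r) ℕ.≤ length f ℕ.+ d
      length-F₂⊛D r lr = ℕₚ.≤-trans (length-⊛ F₂ (D r))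
        (ℕₚ.+-mono-≤ (ℕₚ.≤-reflexive (length-map (fromℕ 2 *_) f)) (ℕₚ.≤-trans (length-D r) lr))

      ∇-length : ∀ {d} rs → All (λ (r , s) → length r ℕ.≤ d × length s ℕ.≤ d) rs →
                 All (λ (r , s) → length r ℕ.≤ length f ℕ.+ d × length s ℕ.≤ length f ℕ.+ d) (map ∇ rs)
      ∇-length []             []              = []
      ∇-length ((r , s) ∷ rs) ((lr , ls) ∷ l) =
        (length-F₂⊛D r lr , length-⊕ (F₂ ⊛ D s) (neg (D f) ⊛ s) (length-F₂⊛D s ls)
          (ℕₚ.≤-trans (length-⊛ (neg (D f)) s)
            (ℕₚ.+-mono-≤ (ℕₚ.≤-trans (ℕₚ.≤-reflexive (length-map (-_) (D f))) (length-D f)) ls)))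
        ∷ ∇-length rs l

      ∇^ : ℕ → List Pair → List Pair
      ∇^ zero    rs = rs
      ∇^ (suc k) rs = ∇^ k (map ∇ rs)

      ∇^-length : ∀ k {d} rs → All (λ (r , s) → length r ℕ.≤ d × length s ℕ.≤ d) rs →
                  All (λ (r , s) → length r ℕ.≤ k ℕ.* length f ℕ.+ d × length s ℕ.≤ k ℕ.* length f ℕ.+ d) (∇^ k rs)
      ∇^-length zero    rs l = l
      ∇^-length (suc k) {d} rs l =
        ≡.subst (λ N → All (λ (r , s) → length r ℕ.≤ N × length s ℕ.≤ N) (∇^ k (map ∇ rs)))
          (≡.trans (≡.sym (ℕₚ.+-assoc (k ℕ.* length f) (length f) d)) (≡.cong (ℕ._+ d) (ℕₚ.+-comm (k ℕ.* length f) (length f))))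
          (∇^-length k (map ∇ rs) (∇-length rs l))

      ∇^-count : ∀ k rs → length (∇^ k rs) ≡ length rs
      ∇^-count zero    rs = ≡.refl
      ∇^-count (suc k) rs = ≡.trans (∇^-count k (map ∇ rs)) (length-map ∇ rs)

      length-Φ : ∀ d rs → All (λ (r , s) → length r ℕ.≤ d × length s ℕ.≤ d) rs →
                 length (Φ rs) ℕ.≤ d ℕ.+ length g ℕ.+ length rs ℕ.* p
      length-Φ d []             []              = ℕ.z≤n
      length-Φ d ((r , s) ∷ rs) ((lr , ls) ∷ l) = length-⊕ (r ⊕ s ⊛ g) (shiftN p (Φ rs))
        (ℕₚ.≤-trans
          (length-⊕ r (s ⊛ g) (ℕₚ.≤-trans lr (ℕₚ.m≤m+n d (length g)))
            (ℕₚ.≤-trans (length-⊛ s g) (ℕₚ.+-monoˡ-≤ (length g) ls)))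
          (ℕₚ.m≤m+n _ _))
        (ℕₚ.≤-trans (ℕₚ.≤-reflexive (length-shiftN p (Φ rs)))
          (ℕₚ.≤-trans (ℕₚ.+-monoʳ-≤ p (length-Φ d rs l))
            (ℕₚ.≤-reflexive (x+[y+z]≡y+[x+z] p (d ℕ.+ length g) (length rs ℕ.* p)))))
        where
        x+[y+z]≡y+[x+z] : ∀ x y z → x ℕ.+ (y ℕ.+ z) ≡ y ℕ.+ (x ℕ.+ z)
        x+[y+z]≡y+[x+z] x y z = ≡.trans (≡.sym (ℕₚ.+-assoc x y z)) (≡.trans (≡.cong (ℕ._+ z) (ℕₚ.+-comm x y)) (ℕₚ.+-assoc y x z))

      module Points (ε : Carrier) where

        -- Φ rs agrees with Ψ rs at the points where g = ε, since X^p = X there.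
        Ψ : List Pair → Poly
        Ψ []             = []
        Ψ ((r , s) ∷ rs) = (r ⊕ scale ε s) ⊕ shift (Ψ rs)

        eval-Φ : ∀ t → eval g t ≈ ε → ∀ rs → eval (Φ rs) t ≈ eval (Ψ rs) t
        eval-Φ t gt []             = refl
        eval-Φ t gt ((r , s) ∷ rs) = begin
          eval ((r ⊕ s ⊛ g) ⊕ shiftN p (Φ rs)) t             ≈⟨ eval-⊕ (r ⊕ s ⊛ g) (shiftN p (Φ rs)) t ⟩
          eval (r ⊕ s ⊛ g) t + eval (shiftN p (Φ rs)) t      ≈⟨ +-cong head≈ tail≈ ⟩
          eval (r ⊕ scale ε s) t + eval (shift (Ψ rs)) t     ≈⟨ eval-⊕ (r ⊕ scale ε s) (shift (Ψ rs)) t ⟨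
          eval ((r ⊕ scale ε s) ⊕ shift (Ψ rs)) t            ∎
          where
          open R
          head≈ : eval (r ⊕ s ⊛ g) t ≈ eval (r ⊕ scale ε s) t
          head≈ = begin
            eval (r ⊕ s ⊛ g) t             ≈⟨ eval-⊕ r (s ⊛ g) t ⟩
            eval r t + eval (s ⊛ g) t      ≈⟨ +-congˡ (trans (eval-⊛ s g t) (trans (*-comm _ _) (*-congʳ gt))) ⟩
            eval r t + ε * eval s t        ≈⟨ +-congˡ (eval-scale ε s t) ⟨
            eval r t + eval (scale ε s) t  ≈⟨ eval-⊕ r (scale ε s) t ⟨
            eval (r ⊕ scale ε s) t         ∎
          tail≈ : eval (shiftN p (Φ rs)) t ≈ eval (shift (Ψ rs)) t
          tail≈ = begin
            eval (shiftN p (Φ rs)) t  ≈⟨ eval-shiftN p (Φ rs) t ⟩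
            t ^ p * eval (Φ rs) t     ≈⟨ *-cong (fermat t) (eval-Φ t gt rs) ⟩
            t * eval (Ψ rs) t         ≈⟨ eval-shift (Ψ rs) t ⟨
            eval (shift (Ψ rs)) t     ∎

        -- The iterates of θ send Φ rs to Φ (∇^k rs), which at t equals Ψ (∇^k rs) = 0. Since 2 f
        -- does not vanish at t, `van-unit` turns vanishing under θ into vanishing under D.
        vanish : ∀ t → eval g t ≈ ε → ¬ (eval f t ≈ 0#) → ∀ m rs →
                 (∀ k → k ℕ.< m → Ψ (∇^ k rs) ≋ []) → Van t m (Φ rs)
        vanish t gt ft zero    rs z = []
        vanish t gt ft (suc m) rs z =
          trans (eval-Φ t gt rs) (eval-[] (Ψ rs) (z 0 (ℕ.s≤s ℕ.z≤n)) t) ∷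
          van-unit F₂ (D (Φ rs)) (λ e → ft (cancel 2≉0 (trans (sym (eval-scale (fromℕ 2) f t)) e)))
            (van-cong (≋-sym (θ-Φ rs)) (vanish t gt ft m (map ∇ rs) (λ k k<m → z (suc k) (ℕ.s≤s k<m))))

        length-Ψ : ∀ d rs → All (λ (r , s) → length r ℕ.≤ d × length s ℕ.≤ d) rs →
                   length (Ψ rs) ℕ.≤ d ℕ.+ length rs
        length-Ψ d []             []              = ℕ.z≤n
        length-Ψ d ((r , s) ∷ rs) ((lr , ls) ∷ l) = length-⊕ (r ⊕ scale ε s) (shift (Ψ rs))
          (ℕₚ.≤-trans (length-⊕ r (scale ε s) lr (ℕₚ.≤-trans (ℕₚ.≤-reflexive (length-map (ε *_) s)) ls)) (ℕₚ.m≤m+n d _))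
          (ℕₚ.≤-trans (ℕ.s≤s (length-Ψ d rs l)) (ℕₚ.≤-reflexive (≡.sym (ℕₚ.+-suc d (length rs)))))

        -- Addition of families as a relation, hence up to `≋`. It expresses that Ψ (∇^k rs) is
        -- additive in rs, as the difference of two colliding families requires.
        data Sum : List Pair → List Pair → List Pair → Set (c ⊔ ℓ) where
          []  : Sum [] [] []
          _∷_ : ∀ {r s r′ s′ r″ s″ rs rs′ rs″} → (r ≋ r′ ⊕ r″) × (s ≋ s′ ⊕ s″) → Sum rs rs′ rs″ →
                Sum ((r , s) ∷ rs) ((r′ , s′) ∷ rs′) ((r″ , s″) ∷ rs″)

        Sum-∇ : ∀ {rs rs′ rs″} → Sum rs rs′ rs″ → Sum (map ∇ rs) (map ∇ rs′) (map ∇ rs″)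
        Sum-∇ []                                            = []
        Sum-∇ (_∷_ {r} {s} {r′} {s′} {r″} {s″} (e , e′) S) =
          (≋-trans (⊛-congˡ F₂ (D-cong e)) (θ-⊕ r′ r″) ,
           ≋-trans (⊕-cong (≋-trans (⊛-congˡ F₂ (D-cong e′)) (θ-⊕ s′ s″))
                           (≋-trans (⊛-congˡ (neg (D f)) e′) (⊛-distribˡ (neg (D f)) s′ s″)))
                   (⊕-interchange (θ s′) (θ s″) (neg (D f) ⊛ s′) (neg (D f) ⊛ s″)))
          ∷ Sum-∇ S

        Sum-∇^ : ∀ k {rs rs′ rs″} → Sum rs rs′ rs″ → Sum (∇^ k rs) (∇^ k rs′) (∇^ k rs″)
        Sum-∇^ zero    S = S
        Sum-∇^ (suc k) S = Sum-∇^ k (Sum-∇ S)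

        Sum-Ψ : ∀ {rs rs′ rs″} → Sum rs rs′ rs″ → Ψ rs ≋ Ψ rs′ ⊕ Ψ rs″
        Sum-Ψ []                                                          = ≋-refl
        Sum-Ψ (_∷_ {r} {s} {r′} {s′} {r″} {s″} {rs} {rs′} {rs″} (e , e′) S) =
          ≋-trans (⊕-cong (≋-trans (⊕-cong e (≋-trans (scale-cong refl e′) (scale-⊕ ε s′ s″)))
                                   (⊕-interchange r′ r″ (scale ε s′) (scale ε s″)))
                          (≋-trans (shift-cong (Sum-Ψ S)) (shift-⊕ (Ψ rs′) (Ψ rs″))))
                  (⊕-interchange (r′ ⊕ scale ε s′) (r″ ⊕ scale ε s″) (shift (Ψ rs′)) (shift (Ψ rs″)))

        build : ℕ → ℕ → (ℕ → Carrier) → List Pair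
        build d zero    v = []
        build d (suc J) v = (applyUpTo v d , applyUpTo (λ i → v (d ℕ.+ i)) d) ∷ build d J (λ i → v (d ℕ.+ d ℕ.+ i))

        build-count : ∀ d J v → length (build d J v) ≡ J
        build-count d zero    v = ≡.refl
        build-count d (suc J) v = ≡.cong suc (build-count d J _)

        build-length : ∀ d J v → All (λ (r , s) → length r ℕ.≤ d × length s ℕ.≤ d) (build d J v)
        build-length d zero    v = []
        build-length d (suc J) v =
          (ℕₚ.≤-reflexive (length-applyUpTo v d) , ℕₚ.≤-reflexive (length-applyUpTo (λ i → v (d ℕ.+ i)) d))
          ∷ build-length d J _

        applyUpTo-+ : ∀ d (v v′ v″ : ℕ → Carrier) → (∀ i → v i ≈ v′ i + v″ i) →
                      applyUpTo v d ≋ applyUpTo v′ d ⊕ applyUpTo v″ d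
        applyUpTo-+ zero    v v′ v″ e = ≋-refl
        applyUpTo-+ (suc d) v v′ v″ e = mk≋ λ
          { zero → e 0 ; (suc i) → at (applyUpTo-+ d (v ∘ suc) (v′ ∘ suc) (v″ ∘ suc) (e ∘ suc)) i }

        build-+ : ∀ d J (v v′ v″ : ℕ → Carrier) → (∀ i → v i ≈ v′ i + v″ i) →
                  Sum (build d J v) (build d J v′) (build d J v″)
        build-+ d zero    v v′ v″ e = []
        build-+ d (suc J) v v′ v″ e =
          (applyUpTo-+ d v v′ v″ e , applyUpTo-+ d _ _ _ (λ i → e (d ℕ.+ i)))
          ∷ build-+ d J _ _ _ (λ i → e (d ℕ.+ d ℕ.+ i))

        coef-applyUpTo : ∀ d (v : ℕ → Carrier) i → i ℕ.< d → coef (applyUpTo v d) i ≡ v i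
        coef-applyUpTo (suc d) v zero    _          = ≡.refl
        coef-applyUpTo (suc d) v (suc i) (ℕ.s≤s lt) = coef-applyUpTo d (v ∘ suc) i lt

        build-zero : ∀ d J (v : ℕ → Carrier) → All (λ (r , s) → (r ≋ []) × (s ≋ [])) (build d J v) →
                     ∀ i → i ℕ.< J ℕ.* (d ℕ.+ d) → v i ≈ 0#
        build-zero d (suc J) v ((r0 , s0) ∷ z) i lt with ℕₚ.<-≤-connex i d
        ... | inj₁ i<d = trans (reflexive (≡.sym (coef-applyUpTo d v i i<d))) (at r0 i)
        ... | inj₂ d≤i with ℕₚ.<-≤-connex i (d ℕ.+ d)
        ...   | inj₁ i<2d = ≡.subst (λ j → v j ≈ 0#) (ℕₚ.m+[n∸m]≡n d≤i)
                  (trans (reflexive (≡.sym (coef-applyUpTo d (λ j → v (d ℕ.+ j)) (i ℕ.∸ d)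
                    (ℕₚ.+-cancelˡ-< d _ _ (≡.subst (ℕ._< d ℕ.+ d) (≡.sym (ℕₚ.m+[n∸m]≡n d≤i)) i<2d))))) (at s0 (i ℕ.∸ d)))
        ...   | inj₂ 2d≤i = ≡.subst (λ j → v j ≈ 0#) (ℕₚ.m+[n∸m]≡n 2d≤i)
                  (build-zero d J (λ j → v (d ℕ.+ d ℕ.+ j)) z (i ℕ.∸ (d ℕ.+ d))
                    (ℕₚ.+-cancelˡ-< (d ℕ.+ d) _ _ (≡.subst (ℕ._< d ℕ.+ d ℕ.+ J ℕ.* (d ℕ.+ d)) (≡.sym (ℕₚ.m+[n∸m]≡n 2d≤i)) lt)))

        module Finite (q : ℕ) (1<q : 1 ℕ.< q)
          (enc : Carrier → Fin q) (enc-injective : ∀ {x y} → enc x ≡ enc y → x ≈ y)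
          (dec : Fin q → Carrier) (dec-injective : ∀ {i j} → dec i ≈ dec j → i ≡ j)
          where

          extend : ∀ N → (Fin N → Fin q) → ℕ → Carrier
          extend N φ i with i ℕ.<? N
          ... | yes i<N = dec (φ (fromℕ< i<N))
          ... | no _    = 0#

          extend-toℕ : ∀ N φ (i : Fin N) → extend N φ (toℕ i) ≡ dec (φ i)
          extend-toℕ N φ i with toℕ i ℕ.<? N
          ... | yes i<N = ≡.cong (dec ∘ φ) (Finₚ.fromℕ<-toℕ i i<N)
          ... | no i≮N  = contradiction (Finₚ.toℕ<n i) i≮N

          -- More unknown coefficients than linear conditions: two of the q^(2dJ) families
          -- give the same values, and their difference solves the homogeneous system.
          solution : ∀ d J m → m ℕ.* (m ℕ.* length f ℕ.+ d ℕ.+ J) ℕ.< J ℕ.* (d ℕ.+ d) →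
                     ∃ λ rs → length rs ≡ J × All (λ (r , s) → length r ℕ.≤ d × length s ℕ.≤ d) rs ×
                              ¬ All (λ (r , s) → (r ≋ []) × (s ≋ [])) rs ×
                              (∀ k → k ℕ.< m → Ψ (∇^ k rs) ≋ [])
          solution d J m lt = build d J v , build-count d J v , build-length d J v , nonzero , vanishing
            where
            N = J ℕ.* (d ℕ.+ d)
            -- e bounds the number of coefficients of Ψ (∇^k rs) for k < m, so at most m e
            -- conditions are imposed on N unknowns.
            e = m ℕ.* length f ℕ.+ d ℕ.+ J
            vec : Fin (q ℕ.^ N) → ℕ → Carrier
            vec x = extend N (finToFun x)
            code : Fin (q ℕ.^ N) → Fin m → Fin e → Fin q
            code x k i = enc (coef (Ψ (∇^ (toℕ k) (build d J (vec x)))) (toℕ i))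
            image : Fin (q ℕ.^ N) → Fin ((q ℕ.^ e) ℕ.^ m)
            image x = funToFin (λ k → funToFin (code x k))
            small : (q ℕ.^ e) ℕ.^ m ℕ.< q ℕ.^ N
            small = ≡.subst (ℕ._< q ℕ.^ N) (≡.sym (ℕₚ.^-*-assoc q e m))
              (ℕₚ.^-monoʳ-< q 1<q (≡.subst (ℕ._< N) (ℕₚ.*-comm m e) lt))
            collision = Finₚ.pigeonhole small image
            x = proj₁ collision
            y = proj₁ (proj₂ collision)
            x<y = proj₁ (proj₂ (proj₂ collision))
            same : ∀ k i → code x k i ≡ code y k i
            same k i =
              ≡.trans (≡.sym (Finₚ.finToFun-funToFin (code x k) i))
              (≡.trans (≡.cong (λ z → finToFun z i)
                (≡.trans (≡.sym (Finₚ.finToFun-funToFin (λ k → funToFin (code x k)) k))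
                (≡.trans (≡.cong (λ z → finToFun z k) (proj₂ (proj₂ (proj₂ collision))))
                  (Finₚ.finToFun-funToFin (λ k → funToFin (code y k)) k))))
                (Finₚ.finToFun-funToFin (code y k) i))
            v : ℕ → Carrier
            v i = vec x i + - vec y i
            vec-x : ∀ i → vec x i ≈ v i + vec y i
            vec-x i = begin
              vec x i                        ≈⟨ +-identityʳ _ ⟨
              vec x i + 0#                   ≈⟨ +-congˡ (-‿inverseˡ (vec y i)) ⟨
              vec x i + (- vec y i + vec y i) ≈⟨ +-assoc _ _ _ ⟨
              v i + vec y i                  ∎
              where open R
            vanishing : ∀ k → k ℕ.< m → Ψ (∇^ k (build d J v)) ≋ []
            vanishing k k<m = mk≋ λ i → begin
              coef A i                       ≈⟨ +-identityʳ _ ⟨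
              coef A i + 0#                  ≈⟨ +-congˡ (-‿inverseʳ (coef B i)) ⟨
              coef A i + (coef B i + - coef B i) ≈⟨ +-assoc _ _ _ ⟨
              coef A i + coef B i + - coef B i   ≈⟨ +-congʳ (trans (sym (coef-⊕ A B i)) (trans (sym (at sum≋ i)) (C≈B i))) ⟩
              coef B i + - coef B i          ≈⟨ -‿inverseʳ _ ⟩
              0#                             ∎
              where
              open R
              A = Ψ (∇^ k (build d J v))
              B = Ψ (∇^ k (build d J (vec y)))
              C = Ψ (∇^ k (build d J (vec x)))
              sum≋ : C ≋ A ⊕ B
              sum≋ = Sum-Ψ (Sum-∇^ k (build-+ d J (vec x) v (vec y) vec-x))
              short : ∀ w → length (Ψ (∇^ k (build d J w))) ℕ.≤ e
              short w = ℕₚ.≤-trans (length-Ψ (k ℕ.* length f ℕ.+ d) _ (∇^-length k (build d J w) (build-length d J w)))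
                (ℕₚ.+-mono-≤ (ℕₚ.+-monoˡ-≤ d (ℕₚ.*-monoˡ-≤ (length f) (ℕₚ.<⇒≤ k<m)))
                  (ℕₚ.≤-reflexive (≡.trans (∇^-count k (build d J w)) (build-count d J w))))
              C≈B : ∀ i → coef C i ≈ coef B i
              C≈B i with ℕₚ.<-≤-connex i e
              ... | inj₂ e≤i = reflexive (≡.trans (coef-length C i (ℕₚ.≤-trans (short (vec x)) e≤i))
                                          (≡.sym (coef-length B i (ℕₚ.≤-trans (short (vec y)) e≤i))))
              ... | inj₁ i<e = enc-injective
                  (≡.subst (λ k → enc (coef (Ψ (∇^ k (build d J (vec x)))) i) ≡ enc (coef (Ψ (∇^ k (build d J (vec y)))) i))
                    (Finₚ.toℕ-fromℕ< k<m)
                    (≡.subst (λ i → enc (coef (Ψ (∇^ (toℕ (fromℕ< k<m)) (build d J (vec x)))) i)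
                                  ≡ enc (coef (Ψ (∇^ (toℕ (fromℕ< k<m)) (build d J (vec y)))) i))
                      (Finₚ.toℕ-fromℕ< i<e) (same (fromℕ< k<m) (fromℕ< i<e))))
            funToFin-cong : ∀ {M} (φ ψ : Fin M → Fin q) → (∀ i → φ i ≡ ψ i) → funToFin φ ≡ funToFin ψ
            funToFin-cong {zero}  φ ψ h = ≡.refl
            funToFin-cong {suc M} φ ψ h = ≡.cong₂ Fin.combine (h Fin.zero) (funToFin-cong (φ ∘ Fin.suc) (ψ ∘ Fin.suc) (h ∘ Fin.suc))
            nonzero : ¬ All (λ (r , s) → (r ≋ []) × (s ≋ [])) (build d J v)
            nonzero z = Finₚ.<-irrefl x≡y x<y
              where
              open R
              eq : ∀ i → finToFun {q} {N} x i ≡ finToFun y i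
              eq i = dec-injective (begin
                dec (finToFun x i)           ≡⟨ extend-toℕ N (finToFun x) i ⟨
                vec x (toℕ i)                ≈⟨ vec-x (toℕ i) ⟩
                v (toℕ i) + vec y (toℕ i)    ≈⟨ +-congʳ (build-zero d J v z (toℕ i) (Finₚ.toℕ<n i)) ⟩
                0# + vec y (toℕ i)           ≈⟨ +-identityˡ _ ⟩
                vec y (toℕ i)                ≡⟨ extend-toℕ N (finToFun y) i ⟩
                dec (finToFun y i)           ∎)
              x≡y : x ≡ y
              x≡y = ≡.trans (≡.sym (Finₚ.funToFin-finToFin {N} {q} x))
                (≡.trans (funToFin-cong (finToFun x) (finToFun y) eq) (Finₚ.funToFin-finToFin {N} {q} y))

          -- The auxiliary polynomial is nonzero by `Φ-independent` and vanishes to order m at each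
          -- point of `ts`. Were the claim false, `zero-bound` would force it to be zero; m < p
          -- keeps the integers occurring there invertible.
          stepanov-bound : ∀ d J m ts → length f ℕ.+ (d ℕ.+ d) ℕ.≤ p → m ℕ.< p →
                           m ℕ.* (m ℕ.* length f ℕ.+ d ℕ.+ J) ℕ.< J ℕ.* (d ℕ.+ d) →
                           AllPairs (λ s t → ¬ (t ≈ s)) ts →
                           All (λ t → eval g t ≈ ε × ¬ (eval f t ≈ 0#)) ts →
                           length ts ℕ.* m ℕ.< d ℕ.+ length g ℕ.+ J ℕ.* p
          stepanov-bound d J m ts fd m<p lt distinct pts = from (solution d J m lt)
            where
            from : _ → length ts ℕ.* m ℕ.< d ℕ.+ length g ℕ.+ J ℕ.* p
            from (rs , count , lens , nz , van) with ℕₚ.<-≤-connex (length ts ℕ.* m) (d ℕ.+ length g ℕ.+ J ℕ.* p)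
            ... | inj₁ done = done
            ... | inj₂ ge   = contradiction
              (Φ-independent d rs fd lens
                (zero-bound m (λ i i<m → unit (suc i) (ℕ.s≤s ℕ.z≤n) (ℕₚ.≤-<-trans i<m m<p)) ts (Φ rs) distinct
                  (All.map (λ (gt , ft) → vanish _ gt ft m rs van) pts)
                  (ℕₚ.≤-trans (≡.subst (λ j → length (Φ rs) ℕ.≤ d ℕ.+ length g ℕ.+ j ℕ.* p) count (length-Φ d rs lens)) ge)))
              nz

-- The prime field, Fermat's theorem and Euler's criterion

module PrimeFields where

  open import Algebra.Bundles using (CommutativeRing)
  open import Data.Nat as ℕ using (ℕ; zero; suc; _%_; z<s)
  import Data.Nat.Properties as ℕₚ
  open import Data.Nat.DivMod
  open import Data.Nat.Divisibility using (_∣_; m%n≡0⇒n∣m; n∣m⇒m%n≡0)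
  open import Data.Nat.Primality using (Prime; euclidsLemma)
  open import Data.List using ([]; _∷_; length; applyUpTo)
  open import Data.List.Properties using (length-applyUpTo)
  open import Data.List.Relation.Unary.All as All using ([]; _∷_)
  import Data.List.Relation.Unary.All.Properties as Allₚ
  open import Data.List.Relation.Unary.AllPairs using ([]; _∷_)
  import Data.List.Relation.Unary.AllPairs.Properties as AllPairsₚ
  open import Data.Product using (_,_; ∃)
  open import Data.Sum using (_⊎_; inj₁; inj₂; [_,_]′)
  open import Level using (0ℓ)
  open import Relation.Binary.PropositionalEquality as ≡ using (_≡_)
  open import Relation.Nullary using (¬_; Dec; yes; no; contradiction)
  open import Relation.Nullary.Decidable using (map′)
  open Polynomials
  open Multiplicities
  open StepanovMethod

  module PrimeField (n : ℕ) (1≤n : 1 ℕ.≤ n) (pr : Prime (suc (n ℕ.+ n))) where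

    p : ℕ
    p = suc (n ℕ.+ n)

    infix 4 _≈ₚ_
    record _≈ₚ_ (a b : ℕ) : Set where
      constructor mk≈
      field residue : a % p ≡ b % p
    open _≈ₚ_ public

    ≡⇒≈ : ∀ {a b} → a ≡ b → a ≈ₚ b
    ≡⇒≈ e = mk≈ (≡.cong (_% p) e)

    +-congₚ : ∀ {a b c d} → a ≈ₚ b → c ≈ₚ d → a ℕ.+ c ≈ₚ b ℕ.+ d
    +-congₚ {a} {b} {c} {d} (mk≈ e) (mk≈ e′) = mk≈ (≡.trans (%-distribˡ-+ a c p)
      (≡.trans (≡.cong₂ (λ x y → (x ℕ.+ y) % p) e e′) (≡.sym (%-distribˡ-+ b d p))))

    *-congₚ : ∀ {a b c d} → a ≈ₚ b → c ≈ₚ d → a ℕ.* c ≈ₚ b ℕ.* d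
    *-congₚ {a} {b} {c} {d} (mk≈ e) (mk≈ e′) = mk≈ (≡.trans (%-distribˡ-* a c p)
      (≡.trans (≡.cong₂ (λ x y → (x ℕ.* y) % p) e e′) (≡.sym (%-distribˡ-* b d p))))

    neg-inverseₚ : ∀ a → a ℕ.+ (n ℕ.+ n) ℕ.* a ≈ₚ 0
    neg-inverseₚ a = mk≈ (≡.trans (≡.cong (_% p) (ℕₚ.*-comm p a)) (m*n%n≡0 a p))

    -- 𝔽_p as ℕ up to congruence; negation is multiplication by n + n = p - 1.
    K : CommutativeRing 0ℓ 0ℓ
    K = record
      { Carrier = ℕ ; _≈_ = _≈ₚ_ ; _+_ = ℕ._+_ ; _*_ = ℕ._*_ ; -_ = (n ℕ.+ n) ℕ.*_ ; 0# = 0 ; 1# = 1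
      ; isCommutativeRing = record
        { isRing = record
          { +-isAbelianGroup = record
            { isGroup = record
              { isMonoid = record
                { isSemigroup = record
                  { isMagma = record
                    { isEquivalence = record
                      { refl = mk≈ ≡.refl
                      ; sym = λ e → mk≈ (≡.sym (residue e))
                      ; trans = λ e e′ → mk≈ (≡.trans (residue e) (residue e′)) }
                    ; ∙-cong = +-congₚ }
                  ; assoc = λ a b c → ≡⇒≈ (ℕₚ.+-assoc a b c) }
                ; identity = (λ a → ≡⇒≈ ≡.refl) , λ a → ≡⇒≈ (ℕₚ.+-identityʳ a) }
              ; inverse = (λ a → mk≈ (≡.trans (≡.cong (_% p) (ℕₚ.+-comm _ a)) (residue (neg-inverseₚ a)))) , neg-inverseₚ
              ; ⁻¹-cong = *-congₚ {n ℕ.+ n} {n ℕ.+ n} (mk≈ ≡.refl) }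
            ; comm = λ a b → ≡⇒≈ (ℕₚ.+-comm a b) }
          ; *-cong = *-congₚ
          ; *-assoc = λ a b c → ≡⇒≈ (ℕₚ.*-assoc a b c)
          ; *-identity = (λ a → ≡⇒≈ (ℕₚ.*-identityˡ a)) , λ a → ≡⇒≈ (ℕₚ.*-identityʳ a)
          ; distrib = (λ a b c → ≡⇒≈ (ℕₚ.*-distribˡ-+ a b c)) , λ a b c → ≡⇒≈ (ℕₚ.*-distribʳ-+ a b c) }
        ; *-comm = λ a b → ≡⇒≈ (ℕₚ.*-comm a b) } }

    open CommutativeRing K using (_≈_; _+_; _*_; -_; 0#; 1#; refl; sym; trans; reflexive; setoid; semiring;
      +-cong; +-congˡ; +-congʳ; *-cong; *-congˡ; *-congʳ; +-identityˡ; +-identityʳ; *-identityˡ; *-identityʳ;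
      *-assoc; *-comm; +-assoc; +-comm; -‿inverseˡ; -‿inverseʳ; zeroˡ; zeroʳ; distribˡ; distribʳ; ring; commutativeSemiring) public

    abstract
      _≟ₚ_ : ∀ a b → Dec (a ≈ b)
      a ≟ₚ b = map′ mk≈ residue (a % p ℕ.≟ b % p)

    ≈0⇒∣ : ∀ {a} → a ≈ 0 → p ∣ a
    ≈0⇒∣ {a} e = m%n≡0⇒n∣m a p (residue e)

    ∣⇒≈0 : ∀ {a} → p ∣ a → a ≈ 0
    ∣⇒≈0 {a} d = mk≈ (n∣m⇒m%n≡0 a p d)

    cancel : ∀ {x y} → ¬ (x ≈ 0) → x * y ≈ 0 → y ≈ 0
    cancel {x} {y} x≉0 e = [ (λ d → contradiction (∣⇒≈0 d) x≉0) , ∣⇒≈0 ]′ (euclidsLemma x y pr (≈0⇒∣ e))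

    %≈ : ∀ a → a % p ≈ a
    %≈ a = mk≈ (m%n%n≡m%n a p)

    <⇒≡ : ∀ {a b} → a ℕ.< p → b ℕ.< p → a ≈ b → a ≡ b
    <⇒≡ a<p b<p e = ≡.trans (≡.sym (m<n⇒m%n≡m a<p)) (≡.trans (residue e) (m<n⇒m%n≡m b<p))

    <⇒≉0 : ∀ {i} → 0 ℕ.< i → i ℕ.< p → ¬ (i ≈ 0)
    <⇒≉0 0<i i<p e = ℕₚ.<⇒≢ 0<i (≡.sym (<⇒≡ i<p z<s e))

    dec0 : ∀ x → (x ≈ 0) ⊎ ¬ (x ≈ 0)
    dec0 x with x ≟ₚ 0
    ... | yes e = inj₁ e
    ... | no ¬e = inj₂ ¬e

    2<p : 2 ℕ.< p
    2<p = ℕ.s≤s (ℕₚ.+-mono-≤ 1≤n 1≤n)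

    open Polynomial K public
    open Vanishing K cancel public

    fromℕ-id : ∀ k → fromℕ k ≡ k
    fromℕ-id zero    = ≡.refl
    fromℕ-id (suc k) = ≡.cong suc (fromℕ-id k)

    char : fromℕ p ≈ 0
    char = trans (reflexive (fromℕ-id p)) (mk≈ (n%n≡0 p))

    unit : ∀ i → 0 ℕ.< i → i ℕ.< p → ¬ (fromℕ i ≈ 0)
    unit i 0<i i<p e = <⇒≉0 0<i i<p (trans (sym (reflexive (fromℕ-id i))) e)

    open Stepanov K cancel n 1≤n char unit (unit 2 z<s 2<p) public
    open import Algebra.Properties.Semiring.Exp semiring public using (_^_; ^-congˡ; ^-homo-*)
    open import Algebra.Properties.CommutativeSemiring.Exp commutativeSemiring public using (^-distrib-*)
    open import Algebra.Properties.Ring ring public using (-‿involutive; -1*x≈-x)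
    import Algebra.Solver.Ring.NaturalCoefficients.Default commutativeSemiring as KS
    import Relation.Binary.Reasoning.Setoid setoid as R

    -- Induction on the representative x, each step being (1 + x)^p = 1 + x^p.
    fermat : ∀ x → x ^ p ≈ x
    fermat zero    = zeroˡ (0 ^ (n ℕ.+ n))
    fermat (suc x) = trans (freshman x) (+-congˡ (fermat x))

    subtract : ∀ {x y} → ¬ (x ≈ y) → ¬ (x + - y ≈ 0)
    subtract {x} {y} x≉y e = x≉y (begin
      x              ≈⟨ +-identityʳ x ⟨
      x + 0          ≈⟨ +-congˡ (-‿inverseˡ y) ⟨
      x + (- y + y)  ≈⟨ +-assoc x (- y) y ⟨
      x + - y + y    ≈⟨ +-congʳ e ⟩
      0 + y          ≈⟨ +-identityˡ y ⟩
      y              ∎)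
      where open R

    *-cancelₚ : ∀ {x y z} → ¬ (x ≈ 0) → x * y ≈ x * z → y ≈ z
    *-cancelₚ {x} {y} {z} x≉0 e with y ≟ₚ z
    ... | yes h = h
    ... | no ¬h = contradiction (cancel x≉0 (begin
      x * (y + - z)      ≈⟨ distribˡ x y (- z) ⟩
      x * y + x * - z    ≈⟨ +-congʳ e ⟩
      x * z + x * - z    ≈⟨ distribˡ x z (- z) ⟨
      x * (z + - z)      ≈⟨ *-congˡ {x} (-‿inverseʳ z) ⟩
      x * 0              ≈⟨ zeroʳ x ⟩
      0                  ∎)) (subtract ¬h)
      where open R

    fermat-unit : ∀ x → ¬ (x ≈ 0) → x ^ (n ℕ.+ n) ≈ 1
    fermat-unit x x≉0 = *-cancelₚ x≉0 (trans (fermat x) (sym (*-identityʳ x)))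

    1≉0 : ¬ (1 ≈ 0)
    1≉0 = <⇒≉0 z<s (ℕₚ.<-trans ℕₚ.≤-refl 2<p)

    -1ₚ : ℕ
    -1ₚ = - 1

    -1*-1 : -1ₚ * -1ₚ ≈ 1
    -1*-1 = trans (-1*x≈-x -1ₚ) (-‿involutive 1)

    -- (x^n - 1)(x^n + 1) = 0
    half-power : ∀ x → ¬ (x ≈ 0) → x ^ n ≈ 1 ⊎ x ^ n ≈ -1ₚ
    half-power x x≉0 with (x ^ n) ≟ₚ 1
    ... | yes e = inj₁ e
    ... | no ¬e = inj₂ (begin
      y                  ≈⟨ +-identityʳ y ⟨
      y + 0              ≈⟨ +-congˡ (-‿inverseʳ 1) ⟨
      y + (1 + -1ₚ)      ≈⟨ +-assoc y 1 -1ₚ ⟨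
      y + 1 + -1ₚ        ≈⟨ +-congʳ (cancel (subtract ¬e) product) ⟩
      0 + -1ₚ            ≈⟨ +-identityˡ -1ₚ ⟩
      -1ₚ                ∎)
      where
      open R
      y = x ^ n
      product : (y + -1ₚ) * (y + 1) ≈ 0
      product = begin
        (y + -1ₚ) * (y + 1)
          ≈⟨ KS.solve 2 (λ y m → (y KS.:+ m) KS.:* (y KS.:+ KS.con 1) KS.:= y KS.:* y KS.:+ (m KS.:* y KS.:+ y KS.:+ m)) refl y -1ₚ ⟩
        y * y + (-1ₚ * y + y + -1ₚ)
          ≈⟨ +-cong (trans (sym (^-homo-* x n n)) (fermat-unit x x≉0)) (+-congʳ (trans (+-congʳ (-1*x≈-x y)) (-‿inverseˡ y))) ⟩
        1 + (0 + -1ₚ)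
          ≈⟨ +-congˡ (+-identityˡ -1ₚ) ⟩
        1 + -1ₚ
          ≈⟨ -‿inverseʳ 1 ⟩
        0 ∎

    1≉-1 : ¬ (1 ≈ -1ₚ)
    1≉-1 e = <⇒≉0 z<s 2<p (trans (+-congˡ {1} e) (-‿inverseʳ 1))

    0^n : ∀ {x} → x ≈ 0 → x ^ n ≈ 0
    0^n {x} e = trans (^-congˡ n e) (go n 1≤n)
      where
      go : ∀ m → 1 ℕ.≤ m → 0 ^ m ≈ 0
      go (suc m) _ = zeroˡ (0 ^ m)

    IsSquare : ℕ → Set
    IsSquare x = ∃ λ a → a * a ≈ x

    -- A nonzero square a² has n-th power a^(2n) = 1, and 0 has n-th power 0. So the value -1
    -- singles out the nonsquares, with 0 on the side of the squares, as in R_p.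
    square-power : ∀ {x} → IsSquare x → ¬ (x ^ n ≈ -1ₚ)
    square-power {x} (a , e) h = [ (λ z → 1≉0 (sym (trans (sym (trans (*-congʳ {x = -1ₚ} (x^n≈0 z)) (zeroˡ -1ₚ))) (trans (*-congʳ {x = -1ₚ} h) -1*-1)))) , (λ ¬z → 1≉-1 (trans (sym (x^n≈1 ¬z)) h)) ]′ (dec0 a)
      where
      open R
      x^n≈0 : a ≈ 0 → x ^ n ≈ 0
      x^n≈0 z = 0^n (trans (sym e) (trans (*-congʳ z) (zeroˡ a)))
      x^n≈1 : ¬ (a ≈ 0) → x ^ n ≈ 1
      x^n≈1 ¬z = begin
        x ^ n            ≈⟨ ^-congˡ n e ⟨
        (a * a) ^ n      ≈⟨ ^-distrib-* a a n ⟩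
        a ^ n * a ^ n    ≈⟨ ^-homo-* a n n ⟨
        a ^ (n ℕ.+ n)    ≈⟨ fermat-unit a ¬z ⟩
        1                ∎

    -- Otherwise X^n - 1 would have the n + 1 roots x, 1², …, n².
    nonsquare-power : ∀ {x} → ¬ IsSquare x → x ^ n ≈ -1ₚ
    nonsquare-power {x} ¬sq = [ (λ e → contradiction (absurd e) 1≉0) , (λ e → e) ]′ (half-power x x≉0)
      where
      open R
      x≉0 : ¬ (x ≈ 0)
      x≉0 e = ¬sq (0 , sym e)
      P : Poly
      P = shiftN n one ⊕ neg one
      sq : ℕ → ℕ
      sq i = suc i * suc i
      eval-P : ∀ t → t ^ n ≈ 1 → eval P t ≈ 0
      eval-P t h = begin
        eval P t                             ≈⟨ eval-⊕ (shiftN n one) (neg one) t ⟩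
        eval (shiftN n one) t + eval (neg one) t
          ≈⟨ +-cong (trans (eval-shiftN n one t) (trans (*-congˡ {t ^ n} (eval-one t)) (trans (*-identityʳ (t ^ n)) h))) (trans (+-congˡ (zeroʳ t)) (+-identityʳ -1ₚ)) ⟩
        1 + -1ₚ                              ≈⟨ -‿inverseʳ 1 ⟩
        0                                    ∎
      root : ∀ t → t ^ n ≈ 1 → Van t 1 P
      root t h = eval-P t h ∷ []
      sq-root : ∀ i → i ℕ.< n → sq i ^ n ≈ 1
      sq-root i i<n = trans (^-distrib-* (suc i) (suc i) n) (trans (sym (^-homo-* (suc i) n n))
        (fermat-unit (suc i) (<⇒≉0 z<s (ℕ.s≤s (ℕₚ.≤-trans i<n (ℕₚ.m≤m+n n n))))))
      -- (j + 1)² - (i + 1)² = (i + j + 2) (j - i), and both factors lie strictly between 0 and p.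
      sq-distinct : ∀ {i j} → i ℕ.< j → j ℕ.< n → ¬ (sq j ≈ sq i)
      sq-distinct {i} {j} i<j j<n e = <⇒≉0 (ℕₚ.m<n⇒0<n∸m i<j)
          (ℕₚ.≤-<-trans (ℕₚ.m∸n≤m j i) (ℕₚ.<-trans j<n (ℕ.s≤s (ℕₚ.m≤m+n n n)))) k≈0
        where
        k = j ℕ.∸ i
        j≡ : j ≡ i ℕ.+ k
        j≡ = ≡.sym (ℕₚ.m+[n∸m]≡n (ℕₚ.<⇒≤ i<j))
        s = suc i ℕ.+ suc j
        s≉0 : ¬ (s ≈ 0)
        s≉0 = <⇒≉0 z<s (ℕ.s≤s (ℕₚ.+-mono-≤ (ℕₚ.<-trans i<j j<n) j<n))
        expand : sq j ≡ sq i ℕ.+ s ℕ.* k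
        expand = ≡.trans (≡.cong sq j≡) (≡.trans (lemma i k) (≡.cong (λ z → sq i ℕ.+ (suc i ℕ.+ suc z) ℕ.* k) (≡.sym j≡)))
          where
          open import Data.Nat.Solver using (module +-*-Solver)
          open +-*-Solver
          lemma : ∀ i k → suc (i ℕ.+ k) ℕ.* suc (i ℕ.+ k) ≡ suc i ℕ.* suc i ℕ.+ (suc i ℕ.+ suc (i ℕ.+ k)) ℕ.* k
          lemma = solve 2 (λ i k → (con 1 :+ (i :+ k)) :* (con 1 :+ (i :+ k)) := (con 1 :+ i) :* (con 1 :+ i) :+ ((con 1 :+ i) :+ (con 1 :+ (i :+ k))) :* k) ≡.refl
        k≈0 : k ≈ 0
        k≈0 = cancel s≉0 (begin
          s * k                       ≈⟨ +-identityˡ (s * k) ⟨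
          0 + s * k                   ≈⟨ +-congʳ (-‿inverseˡ (sq i)) ⟨
          - sq i + sq i + s * k       ≈⟨ +-assoc (- sq i) (sq i) (s * k) ⟩
          - sq i + (sq i + s * k)     ≡⟨ ≡.cong (λ z → - sq i + z) expand ⟨
          - sq i + sq j               ≈⟨ +-congˡ e ⟩
          - sq i + sq i               ≈⟨ -‿inverseˡ (sq i) ⟩
          0                           ∎)
      absurd : x ^ n ≈ 1 → 1 ≈ 0
      absurd h = begin
        1             ≈⟨ -‿involutive 1 ⟨
        - - 1         ≈⟨ *-congˡ {n ℕ.+ n} -1≈0 ⟩
        - 0           ≈⟨ zeroʳ (n ℕ.+ n) ⟩
        0             ∎
        where
        ts = x ∷ applyUpTo sq n
        P≋0 : P ≋ []
        P≋0 = zero-bound 1 (λ { zero _ → unit 1 z<s (ℕₚ.<-trans ℕₚ.≤-refl 2<p) ; (suc i) (ℕ.s≤s ()) }) ts P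
          (Allₚ.applyUpTo⁺₁ sq n (λ {i} _ e → ¬sq (suc i , e)) ∷ AllPairsₚ.applyUpTo⁺₁ sq n sq-distinct)
          (root x h ∷ Allₚ.applyUpTo⁺₁ sq n (λ {i} i<n → root (sq i) (sq-root i i<n)))
          (length-⊕ (shiftN n one) (neg one)
            (ℕₚ.≤-reflexive (≡.trans (length-shiftN n one) (≡.trans (ℕₚ.+-comm n 1) (≡.sym len))))
            (≡.subst (1 ℕ.≤_) (≡.sym len) (ℕ.s≤s ℕ.z≤n)))
          where
          len : length ts ℕ.* 1 ≡ suc n
          len = ≡.trans (ℕₚ.*-identityʳ _) (≡.cong suc (length-applyUpTo sq n))
        -1≈0 : -1ₚ ≈ 0
        -1≈0 = begin
          -1ₚ                                   ≡⟨⟩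
          0 + -1ₚ                               ≡⟨ ≡.cong (_+ -1ₚ) (coef-shiftN-low n one 0 1≤n) ⟨
          coef (shiftN n one) 0 + -1ₚ           ≈⟨ coef-⊕ (shiftN n one) (neg one) 0 ⟨
          coef P 0                              ≈⟨ at P≋0 0 ⟩
          0                                     ∎

-- Equidistribution of patterns of Legendre symbols

module SignPatterns where

  open import Data.Bool using (Bool; true; false; not; _∧_; if_then_else_)
  import Data.Bool as Bool
  open import Data.Nat as ℕ using (ℕ; zero; suc; z<s)
  import Data.Nat.Properties as ℕₚ
  open import Data.Nat.DivMod using (m%n<n)
  open import Data.Nat.Primality using (Prime)
  open import Data.Nat.Solver using (module +-*-Solver)
  open import Data.Fin as Fin using (Fin; toℕ; fromℕ<)
  import Data.Fin.Properties as Finₚ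
  open import Data.List using (List; []; _∷_; length; upTo; filter)
  open import Data.List.Relation.Unary.All as All using (All; []; _∷_)
  import Data.List.Relation.Unary.All.Properties as Allₚ
  open import Data.List.Relation.Unary.AllPairs using (AllPairs; []; _∷_)
  import Data.List.Relation.Unary.AllPairs.Properties as AllPairsₚ
  open import Data.Product using (_×_; _,_; proj₁; proj₂; ∃)
  open import Data.Sum using (_⊎_; inj₁; inj₂)
  open import Function using (id)
  open import Relation.Binary.PropositionalEquality as ≡ using (_≡_)
  open import Relation.Nullary using (¬_; Dec; does; yes; no; contradiction; ¬?)
  open import Relation.Nullary.Decidable using (_×-dec_)
  open FiniteSums
  open PrimeFields

  halve : ∀ x → ∃ λ d → d ℕ.+ d ℕ.≤ x × x ℕ.≤ suc (d ℕ.+ d)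
  halve zero          = 0 , ℕ.z≤n , ℕ.z≤n
  halve (suc zero)    = 0 , ℕ.z≤n , ℕ.s≤s ℕ.z≤n
  halve (suc (suc x)) with halve x
  ... | d , a , b = suc d , ℕ.s≤s (≡.subst (ℕ._≤ suc x) (≡.sym (ℕₚ.+-suc d d)) (ℕ.s≤s a))
                          , ℕ.s≤s (ℕ.s≤s (≡.subst (x ℕ.≤_) (≡.sym (ℕₚ.+-suc d d)) b))

  -- The parameter choice of Stepanov's method: multiplicity 2l, with l + 7q pairs of unknown polynomials.
  parameters-fit : ∀ p q l d k → l ℕ.* l ℕ.≤ p → 14 ℕ.* l ℕ.+ 7 ℕ.* suc q ℕ.< p → 1 ℕ.≤ q → k ℕ.≤ q →
                   p ℕ.≤ q ℕ.+ suc (d ℕ.+ d) →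
                   (l ℕ.+ l) ℕ.* ((l ℕ.+ l) ℕ.* k ℕ.+ d ℕ.+ (l ℕ.+ 7 ℕ.* q)) ℕ.< (l ℕ.+ 7 ℕ.* q) ℕ.* (d ℕ.+ d)
  parameters-fit p q@(suc _) l d k ll big 1≤q k≤q pd = begin-strict
    (l + l) * ((l + l) * k + d + (l + 7 * q))
      ≤⟨ *-monoʳ-≤ (l + l) (+-monoˡ-≤ (l + 7 * q) (+-monoˡ-≤ d (*-monoʳ-≤ (l + l) k≤q))) ⟩
    (l + l) * ((l + l) * q + d + (l + 7 * q))
      ≡⟨ e₁ l q d ⟩
    (l + l) * d + X
      <⟨ +-monoʳ-< ((l + l) * d) X< ⟩
    (l + l) * d + 14 * (q * d)
      ≡⟨ e₂ l q d ⟩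
    (l + 7 * q) * (d + d) ∎
    where
    open import Data.Nat using (_+_; _*_; _<_)
    open ℕₚ
    open ≤-Reasoning
    open +-*-Solver using (solve; _:+_; _:*_; _:=_; con)
    X : ℕ
    X = 4 * (q * (l * l)) + 2 * (l * l) + 14 * (l * q)
    e₁ : ∀ l q d → (l + l) * ((l + l) * q + d + (l + 7 * q)) ≡ (l + l) * d + (4 * (q * (l * l)) + 2 * (l * l) + 14 * (l * q))
    e₁ = solve 3 (λ l q d → (l :+ l) :* ((l :+ l) :* q :+ d :+ (l :+ con 7 :* q)) := (l :+ l) :* d :+ (con 4 :* (q :* (l :* l)) :+ con 2 :* (l :* l) :+ con 14 :* (l :* q))) ≡.refl
    e₂ : ∀ l q d → (l + l) * d + 14 * (q * d) ≡ (l + 7 * q) * (d + d)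
    e₂ = solve 3 (λ l q d → (l :+ l) :* d :+ con 14 :* (q :* d) := (l :+ con 7 :* q) :* (d :+ d)) ≡.refl
    -- Both sides share 2 l d, and `X` has to be paid for by the extra 7 q pairs. The first two
    -- terms of `X` are at most 6 q p because l² ≤ p; by `big` the third, together with the rounding
    -- loss 7 q (q + 1), stays below q p.
    X< : X < 14 * (q * d)
    X< = +-cancelʳ-< (7 * (q * suc q)) X (14 * (q * d)) (begin-strict
      X + 7 * (q * suc q)
        ≤⟨ +-monoˡ-≤ (7 * (q * suc q)) (+-monoˡ-≤ (14 * (l * q)) (+-monoʳ-≤ (4 * (q * (l * l))) (*-monoʳ-≤ 2 (m≤n*m (l * l) q)))) ⟩
      4 * (q * (l * l)) + 2 * (q * (l * l)) + 14 * (l * q) + 7 * (q * suc q)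
        ≡⟨ solve 3 (λ l q s → con 4 :* (q :* (l :* l)) :+ con 2 :* (q :* (l :* l)) :+ con 14 :* (l :* q) :+ con 7 :* (q :* s) := con 6 :* (q :* (l :* l)) :+ q :* (con 14 :* l :+ con 7 :* s)) ≡.refl l q (suc q) ⟩
      6 * (q * (l * l)) + q * (14 * l + 7 * suc q)
        <⟨ +-mono-≤-< (*-monoʳ-≤ 6 (*-monoʳ-≤ q ll)) (*-monoʳ-< q big) ⟩
      6 * (q * p) + q * p
        ≡⟨ solve 2 (λ q p → con 6 :* (q :* p) :+ q :* p := con 7 :* (q :* p)) ≡.refl q p ⟩
      7 * (q * p)
        ≤⟨ *-monoʳ-≤ 7 (*-monoʳ-≤ q pd) ⟩
      7 * (q * (q + suc (d + d)))
        ≡⟨ solve 2 (λ q d → con 7 :* (q :* (q :+ (con 1 :+ (d :+ d)))) := con 14 :* (q :* d) :+ con 7 :* (q :* (con 1 :+ q))) ≡.refl q d ⟩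
      14 * (q * d) + 7 * (q * suc q) ∎)

  -- With p = x + y the term l p cancels half of 2 l x and leaves l (x - y) on the left. The
  -- remainder 9 q p + 2 l q can be divided by l because p ≤ c₀ l².
  balance : ∀ p q l c₀ x y → 1 ℕ.≤ l → x ℕ.+ y ≡ p → p ℕ.≤ c₀ ℕ.* (l ℕ.* l) →
            (l ℕ.+ l) ℕ.* x ℕ.≤ l ℕ.* p ℕ.+ 9 ℕ.* (q ℕ.* p) ℕ.+ (l ℕ.+ l) ℕ.* q →
            x ℕ.≤ y ℕ.+ (9 ℕ.* c₀ ℕ.+ 2) ℕ.* (q ℕ.* l)
  balance _ q l@(suc _) c₀ x y 1≤l ≡.refl pc h = *-cancelˡ-≤ l (+-cancelˡ-≤ (l * x) _ _ (begin
    l * x + l * x                                       ≡⟨ *-distribʳ-+ x l l ⟨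
    (l + l) * x                                         ≤⟨ h ⟩
    l * (x + y) + 9 * (q * (x + y)) + (l + l) * q       ≤⟨ +-monoˡ-≤ ((l + l) * q) (+-monoʳ-≤ (l * (x + y)) (*-monoʳ-≤ 9 (*-monoʳ-≤ q pc))) ⟩
    l * (x + y) + 9 * (q * (c₀ * (l * l))) + (l + l) * q ≤⟨ +-monoʳ-≤ (l * (x + y) + 9 * (q * (c₀ * (l * l)))) (*-monoʳ-≤ (l + l) (m≤m*n q l)) ⟩
    l * (x + y) + 9 * (q * (c₀ * (l * l))) + (l + l) * (q * l)
      ≡⟨ solve 5 (λ l x y q c → l :* (x :+ y) :+ con 9 :* (q :* (c :* (l :* l))) :+ (l :+ l) :* (q :* l) := l :* x :+ l :* (y :+ (con 9 :* c :+ con 2) :* (q :* l))) ≡.refl l x y q c₀ ⟩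
    l * x + l * (y + (9 * c₀ + 2) * (q * l))            ∎))
    where
    open import Data.Nat using (_+_; _*_)
    open ℕₚ
    open ≤-Reasoning
    open +-*-Solver using (solve; _:+_; _:*_; _:=_; con)

  -- The 9 is the 7 from the extra 7 q pairs plus one each for d and for the length k of g; the last
  -- term allows for at most q zeros of f.
  assemble : ∀ p q l d k x z c → d ℕ.≤ q ℕ.* p → k ℕ.≤ q ℕ.* p → c ℕ.≤ x ℕ.+ z → z ℕ.≤ q →
             x ℕ.* (l ℕ.+ l) ℕ.< d ℕ.+ k ℕ.+ (l ℕ.+ 7 ℕ.* q) ℕ.* p →
             (l ℕ.+ l) ℕ.* c ℕ.≤ l ℕ.* p ℕ.+ 9 ℕ.* (q ℕ.* p) ℕ.+ (l ℕ.+ l) ℕ.* q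
  assemble p q l d k x z c d≤ k≤ c≤ z≤ x< = begin
    (l + l) * c                                      ≤⟨ *-monoʳ-≤ (l + l) (≤-trans c≤ (+-monoʳ-≤ x z≤)) ⟩
    (l + l) * (x + q)                                ≡⟨ *-distribˡ-+ (l + l) x q ⟩
    (l + l) * x + (l + l) * q                        ≤⟨ +-monoˡ-≤ ((l + l) * q) (≤-trans (≤-reflexive (*-comm (l + l) x)) (<⇒≤ x<)) ⟩
    d + k + (l + 7 * q) * p + (l + l) * q            ≤⟨ +-monoˡ-≤ ((l + l) * q) (+-monoˡ-≤ ((l + 7 * q) * p) (+-mono-≤ d≤ k≤)) ⟩
    q * p + q * p + (l + 7 * q) * p + (l + l) * q
      ≡⟨ solve 4 (λ q p l z → q :* p :+ q :* p :+ (l :+ con 7 :* q) :* p :+ z := l :* p :+ con 9 :* (q :* p) :+ z) ≡.refl q p l ((l + l) * q) ⟩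
    l * p + 9 * (q * p) + (l + l) * q                ∎
    where
    open import Data.Nat using (_+_; _*_)
    open ℕₚ
    open ≤-Reasoning
    open +-*-Solver using (solve; _:+_; _:*_; _:=_; con)

  module Patterns (n : ℕ) (1≤n : 1 ℕ.≤ n) (pr : Prime (suc (n ℕ.+ n))) where

    open PrimeField n 1≤n pr
    import Algebra.Solver.Ring.NaturalCoefficients.Default commutativeSemiring as KS
    import Relation.Binary.Reasoning.Setoid setoid as R

    IsSign : ℕ → Set
    IsSign τ = τ ≈ 1 ⊎ τ ≈ -1ₚ

    hit : ℕ → ℕ → ℕ → Bool
    hit τ a t = does (((t + a) ^ n) ≟ₚ τ)

    -- Parity of the number of forms that miss τ, `true` when even. A form that vanishes at t counts
    -- as a miss; such t are few and are estimated separately.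
    sgn : ℕ → List ℕ → ℕ → Bool
    sgn τ []       t = true
    sgn τ (a ∷ as) t = if hit τ a t then sgn τ as t else not (sgn τ as t)

    sval : Bool → ℕ
    sval true  = 1
    sval false = -1ₚ

    sval-* : ∀ b c → sval b * sval c ≈ sval (if b then c else not c)
    sval-* true  c     = *-identityˡ (sval c)
    sval-* false true  = *-identityʳ -1ₚ
    sval-* false false = -1*-1

    factor-sign : ∀ τ a t → IsSign τ → ¬ (t + a ≈ 0) → (t + a) ^ n ≈ sval (hit τ a t) * τ
    factor-sign τ a t sg t+a≉0 with ((t + a) ^ n) ≟ₚ τ
    ... | yes e = trans e (sym (*-identityˡ τ))
    ... | no ¬e = go sg (half-power (t + a) t+a≉0)
      where
      go : IsSign τ → (t + a) ^ n ≈ 1 ⊎ (t + a) ^ n ≈ -1ₚ → (t + a) ^ n ≈ -1ₚ * τ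
      go (inj₁ τ1)  (inj₁ x1)  = contradiction (trans x1 (sym τ1)) ¬e
      go (inj₁ τ1)  (inj₂ x-1) = trans x-1 (trans (sym (*-identityʳ -1ₚ)) (*-congˡ { -1ₚ} (sym τ1)))
      go (inj₂ τ-1) (inj₁ x1)  = trans x1 (trans (sym -1*-1) (*-congˡ { -1ₚ} (sym τ-1)))
      go (inj₂ τ-1) (inj₂ x-1) = contradiction (trans x-1 (sym τ-1)) ¬e

    abstract
      fpoly : List ℕ → Poly
      fpoly []       = one
      fpoly (a ∷ as) = lin (- a) ⊛ fpoly as

      fpoly-[] : fpoly [] ≋ one
      fpoly-[] = ≋-refl

      fpoly-∷ : ∀ a as → fpoly (a ∷ as) ≋ lin (- a) ⊛ fpoly as
      fpoly-∷ a as = ≋-refl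

      length-fpoly : ∀ as → length (fpoly as) ℕ.≤ suc (length as)
      length-fpoly []       = ℕₚ.≤-refl
      length-fpoly (a ∷ as) = length-⊛′ (lin (- a)) (fpoly as) ℕₚ.≤-refl (length-fpoly as)

    eval-lin-neg : ∀ a t → eval (lin (- a)) t ≈ t + a
    eval-lin-neg a t = trans (eval-lin (- a) t) (trans (+-congʳ (-‿involutive a)) (+-comm a t))

    eval-fpoly : ∀ a as t → eval (fpoly (a ∷ as)) t ≈ (t + a) * eval (fpoly as) t
    eval-fpoly a as t = trans (eval-cong (fpoly-∷ a as) t) (trans (eval-⊛ (lin (- a)) (fpoly as) t) (*-congʳ {eval (fpoly as) t} (eval-lin-neg a t)))

    eval-fpoly-≉0 : ∀ as t → All (λ a → ¬ (t + a ≈ 0)) as → ¬ (eval (fpoly as) t ≈ 0)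
    eval-fpoly-≉0 []       t []       e = 1≉0 (trans (sym (trans (eval-cong fpoly-[] t) (eval-one t))) e)
    eval-fpoly-≉0 (a ∷ as) t (h ∷ hs) e =
      eval-fpoly-≉0 as t hs (cancel h (trans (sym (eval-fpoly a as t)) e))

    -- Links signs to Stepanov's method: away from its zeros, prescribing `sgn` prescribes the n-th
    -- power of the product of the forms.
    sign-product : ∀ τ as t → IsSign τ → ¬ (eval (fpoly as) t ≈ 0) →
                   eval (fpoly as) t ^ n ≈ sval (sgn τ as t) * τ ^ length as
    sign-product τ []       t sg _ = trans (trans (^-congˡ n (trans (eval-cong fpoly-[] t) (eval-one t))) (1^ n)) (sym (*-identityˡ 1))
    sign-product τ (a ∷ as) t sg h = begin
      eval (fpoly (a ∷ as)) t ^ n                        ≈⟨ ^-congˡ n (eval-fpoly a as t) ⟩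
      ((t + a) * y) ^ n                                  ≈⟨ ^-distrib-* (t + a) y n ⟩
      (t + a) ^ n * y ^ n                                ≈⟨ *-cong (factor-sign τ a t sg t+a≉0) (sign-product τ as t sg y≉0) ⟩
      (sval u * τ) * (sval v * τ ^ m)                    ≈⟨ KS.solve 4 (λ u τ v w → (u KS.:* τ) KS.:* (v KS.:* w) KS.:= (u KS.:* v) KS.:* (τ KS.:* w)) refl (sval u) τ (sval v) (τ ^ m) ⟩
      (sval u * sval v) * (τ * τ ^ m)                    ≈⟨ *-congʳ {τ * τ ^ m} (sval-* u v) ⟩
      sval (if u then v else not v) * (τ * τ ^ m)        ∎
      where
      open R
      m = length as
      y = eval (fpoly as) t
      u = hit τ a t
      v = sgn τ as t
      t+a≉0 : ¬ (t + a ≈ 0)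
      t+a≉0 e = h (trans (eval-fpoly a as t) (trans (*-congʳ {y} e) (zeroˡ y)))
      y≉0 : ¬ (y ≈ 0)
      y≉0 e = h (trans (eval-fpoly a as t) (trans (*-congˡ {t + a} e) (zeroʳ (t + a))))

    -- Distinct shifts make the roots of `fpoly` simple, and nonzero shifts keep 0 from being a
    -- root; `Auxiliary` asks for both.
    Shifts : List ℕ → Set
    Shifts as = AllPairs (λ a b → ¬ (b ≈ a)) as × All (λ a → ¬ (a ≈ 0)) as

    enc : ℕ → Fin p
    enc x = fromℕ< (m%n<n x p)

    enc-injective : ∀ {x y} → enc x ≡ enc y → x ≈ y
    enc-injective {x} {y} e = mk≈ (≡.trans (≡.sym (Finₚ.toℕ-fromℕ< (m%n<n x p)))
      (≡.trans (≡.cong toℕ e) (Finₚ.toℕ-fromℕ< (m%n<n y p))))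

    dec-injective : ∀ {i j : Fin p} → toℕ i ≈ toℕ j → i ≡ j
    dec-injective {i} {j} e = Finₚ.toℕ-injective (<⇒≡ (Finₚ.toℕ<n i) (Finₚ.toℕ<n j) e)

    upTo-distinct : AllPairs (λ s t → ¬ (t ≈ s)) (upTo p)
    upTo-distinct = AllPairsₚ.applyUpTo⁺₁ id p
      (λ i<j j<p e → ℕₚ.<⇒≢ i<j (≡.sym (<⇒≡ j<p (ℕₚ.<-trans i<j j<p) e)))

    sgnCount : ℕ → List ℕ → Bool → ℕ
    sgnCount τ as b = count p (λ t → does (sgn τ as t Bool.≟ b))

    sgnCount-bound : ∀ τ a as b l → IsSign τ → Shifts (a ∷ as) →
      let q = suc (suc (length as)) in
      l ℕ.* l ℕ.≤ p → 14 ℕ.* l ℕ.+ 7 ℕ.* suc q ℕ.< p →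
      (l ℕ.+ l) ℕ.* sgnCount τ (a ∷ as) b ℕ.≤ l ℕ.* p ℕ.+ 9 ℕ.* (q ℕ.* p) ℕ.+ (l ℕ.+ l) ℕ.* q
    sgnCount-bound τ a as b l sg (a# ∷ as# , a≉0 ∷ as≉0) ll big = result
      where
      m = suc (length as)
      q = suc m
      f = fpoly (a ∷ as)
      f₁ = fpoly as
      f₁-root : ¬ (eval f₁ (- a) ≈ 0)
      f₁-root = eval-fpoly-≉0 as (- a) (All.map (λ {x} h e → h (-a+x≈0⇒x≈a a x e)) a#)
      f-0 : ¬ (eval f 0 ≈ 0)
      f-0 = eval-fpoly-≉0 (a ∷ as) 0 (a≉0 ∷ as≉0)
      -a≉0 : ¬ (- a ≈ 0)
      -a≉0 e = a≉0 (trans (sym (-‿involutive a)) (trans (*-congˡ {n ℕ.+ n} e) (zeroʳ (n ℕ.+ n))))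
      open Auxiliary fermat dec0 f f₁ (- a) (fpoly-∷ a as) -a≉0 f₁-root f-0
      -- By `sign-product` this is the value of g at every t of sign b that is not a zero of f.
      open Points (sval b * τ ^ m)
      open Finite p (ℕₚ.<-trans ℕₚ.≤-refl 2<p) enc enc-injective toℕ dec-injective
      P? : ∀ t → Dec (eval g t ≈ sval b * τ ^ m × ¬ (eval f t ≈ 0))
      P? t = (eval g t ≟ₚ (sval b * τ ^ m)) ×-dec ¬? (eval f t ≟ₚ 0)
      Z? : ∀ t → Dec (eval f t ≈ 0)
      Z? t = eval f t ≟ₚ 0
      good = filter P? (upTo p)
      zeros = filter Z? (upTo p)
      pointwise : ∀ t → ⟦ does (sgn τ (a ∷ as) t Bool.≟ b) ⟧ ℕ.≤ ⟦ does (P? t) ⟧ ℕ.+ ⟦ does (Z? t) ⟧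
      pointwise t = ⟦⟧-cover (sgn τ (a ∷ as) t Bool.≟ b) (P? t) (Z? t) (λ eq ¬z →
        trans (eval-^ f n t) (trans (sign-product τ (a ∷ as) t sg ¬z) (reflexive (≡.cong (λ c → sval c * τ ^ m) eq))) , ¬z)
      count≤′ : sgnCount τ (a ∷ as) b ℕ.≤ length good ℕ.+ length zeros
      count≤′ = ℕₚ.≤-trans (Σ-mono p (λ t _ → pointwise t))
        (ℕₚ.≤-reflexive (≡.trans (Σ-+ p (λ t → ⟦ does (P? t) ⟧) (λ t → ⟦ does (Z? t) ⟧))
          (≡.sym (≡.cong₂ ℕ._+_ (length-filter P? id p) (length-filter Z? id p)))))
      zeros< : length zeros ℕ.≤ q
      zeros< with ℕₚ.<-≤-connex q (length zeros)
      ... | inj₂ le = le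
      ... | inj₁ gt = contradiction (eval-[] f f≋[] 0) f-0
        where
        f≋[] : f ≋ []
        f≋[] = zero-bound 1 (λ { zero _ → unit 1 z<s (ℕₚ.<-trans ℕₚ.≤-refl 2<p) ; (suc i) (ℕ.s≤s ()) }) zeros f
          (AllPairsₚ.filter⁺ Z? upTo-distinct) (All.map (λ e → e ∷ []) (Allₚ.all-filter Z? (upTo p)))
          (ℕₚ.≤-trans (length-fpoly (a ∷ as)) (ℕₚ.≤-trans (ℕₚ.<⇒≤ gt) (ℕₚ.≤-reflexive (≡.sym (ℕₚ.*-identityʳ _)))))
      q≤p : q ℕ.≤ p
      q≤p = ℕₚ.≤-trans (ℕₚ.n≤1+n q) (ℕₚ.≤-trans (ℕₚ.m≤m+n (suc q) _) (ℕₚ.≤-trans (ℕₚ.m≤n+m (7 ℕ.* suc q) (14 ℕ.* l)) (ℕₚ.<⇒≤ big)))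
      halves = halve (p ℕ.∸ q)
      d = proj₁ halves
      q+2d≤p : q ℕ.+ (d ℕ.+ d) ℕ.≤ p
      q+2d≤p = ℕₚ.≤-trans (ℕₚ.+-monoʳ-≤ q (proj₁ (proj₂ halves))) (ℕₚ.≤-reflexive (ℕₚ.m+[n∸m]≡n q≤p))
      p≤q+2d+1 : p ℕ.≤ q ℕ.+ suc (d ℕ.+ d)
      p≤q+2d+1 = ℕₚ.≤-trans (ℕₚ.≤-reflexive (≡.sym (ℕₚ.m+[n∸m]≡n q≤p))) (ℕₚ.+-monoʳ-≤ q (proj₂ (proj₂ halves)))
      2l<p : l ℕ.+ l ℕ.< p
      2l<p = ℕₚ.≤-<-trans (ℕₚ.≤-trans (ℕₚ.+-monoʳ-≤ l (ℕₚ.m≤m+n l (12 ℕ.* l))) (ℕₚ.m≤m+n (14 ℕ.* l) _)) big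
      good-bound : length good ℕ.* (l ℕ.+ l) ℕ.< d ℕ.+ length g ℕ.+ (l ℕ.+ 7 ℕ.* q) ℕ.* p
      good-bound = stepanov-bound d (l ℕ.+ 7 ℕ.* q) (l ℕ.+ l) good
        (ℕₚ.≤-trans (ℕₚ.+-monoˡ-≤ (d ℕ.+ d) (length-fpoly (a ∷ as))) q+2d≤p) 2l<p
        (parameters-fit p q l d (length f) ll big (ℕ.s≤s ℕ.z≤n) (length-fpoly (a ∷ as)) p≤q+2d+1)
        (AllPairsₚ.filter⁺ P? upTo-distinct) (Allₚ.all-filter P? (upTo p))
      length-g : length g ℕ.≤ q ℕ.* p
      length-g = ℕₚ.≤-trans (length-^ f m n (length-fpoly (a ∷ as)))
        (ℕₚ.+-mono-≤ (ℕ.s≤s ℕ.z≤n) (ℕₚ.≤-trans (ℕₚ.≤-reflexive (ℕₚ.*-comm n m)) (ℕₚ.*-monoʳ-≤ m (ℕₚ.≤-trans (ℕₚ.m≤m+n n n) (ℕₚ.n≤1+n _)))))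
      d≤qp : d ℕ.≤ q ℕ.* p
      d≤qp = ℕₚ.≤-trans (ℕₚ.m≤m+n d d) (ℕₚ.≤-trans (ℕₚ.m≤n+m (d ℕ.+ d) q) (ℕₚ.≤-trans q+2d≤p (ℕₚ.m≤m+n p (m ℕ.* p))))
      result : (l ℕ.+ l) ℕ.* sgnCount τ (a ∷ as) b ℕ.≤ l ℕ.* p ℕ.+ 9 ℕ.* (q ℕ.* p) ℕ.+ (l ℕ.+ l) ℕ.* q
      result = assemble p q l d (length g) (length good) (length zeros) (sgnCount τ (a ∷ as) b)
        d≤qp length-g count≤′ zeros< good-bound

    does-true+false : ∀ s → ⟦ does (s Bool.≟ true) ⟧ ℕ.+ ⟦ does (s Bool.≟ false) ⟧ ≡ 1
    does-true+false true  = ≡.refl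
    does-true+false false = ≡.refl

    sgnCount-total : ∀ τ as → sgnCount τ as true ℕ.+ sgnCount τ as false ≡ p
    sgnCount-total τ as = ≡.trans (≡.sym (Σ-+ p (λ t → ⟦ does (sgn τ as t Bool.≟ true) ⟧) (λ t → ⟦ does (sgn τ as t Bool.≟ false) ⟧)))
      (≡.trans (Σ-cong p (λ t _ → does-true+false (sgn τ as t))) (≡.trans (Σ-const p 1) (ℕₚ.*-identityʳ p)))

    pat : ℕ → List ℕ → ℕ → Bool
    pat τ []       t = true
    pat τ (a ∷ as) t = hit τ a t ∧ pat τ as t

    patCount : ℕ → List ℕ → ℕ
    patCount τ as = count p (pat τ as)

    module Equidistribution (τ : ℕ) (sg : IsSign τ) (k l c₀ : ℕ) (1≤l : 1 ℕ.≤ l)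
      (ll : l ℕ.* l ℕ.≤ p) (pc : p ℕ.≤ c₀ ℕ.* (l ℕ.* l)) (big : 14 ℕ.* l ℕ.+ 7 ℕ.* (2 ℕ.+ k) ℕ.< p) where

      bound : ℕ
      bound = (9 ℕ.* c₀ ℕ.+ 2) ℕ.* (suc k ℕ.* l)

      sgnCount-balanced : ∀ a as → Shifts (a ∷ as) → suc (length as) ℕ.≤ k →
                          Near (sgnCount τ (a ∷ as) true) (sgnCount τ (a ∷ as) false) bound
      sgnCount-balanced a as sh le = side true false (sgnCount-total τ (a ∷ as)) , side false true (≡.trans (ℕₚ.+-comm _ (sgnCount τ (a ∷ as) true)) (sgnCount-total τ (a ∷ as)))
        where
        q = suc (suc (length as))
        side : ∀ b b′ → sgnCount τ (a ∷ as) b ℕ.+ sgnCount τ (a ∷ as) b′ ≡ p →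
               sgnCount τ (a ∷ as) b ℕ.≤ sgnCount τ (a ∷ as) b′ ℕ.+ bound
        side b b′ e = ℕₚ.≤-trans
          (balance p q l c₀ (sgnCount τ (a ∷ as) b) (sgnCount τ (a ∷ as) b′) 1≤l e pc
            (sgnCount-bound τ a as b l sg sh ll
              (ℕₚ.≤-<-trans (ℕₚ.+-monoʳ-≤ (14 ℕ.* l) (ℕₚ.*-monoʳ-≤ 7 (ℕ.s≤s (ℕ.s≤s le)))) big)))
          (ℕₚ.+-monoʳ-≤ (sgnCount τ (a ∷ as) b′) (ℕₚ.*-monoʳ-≤ (9 ℕ.* c₀ ℕ.+ 2) (ℕₚ.*-monoˡ-≤ l (ℕ.s≤s le))))

      -- Interpolates between signs of products (L empty), which Stepanov's bound controls, and
      -- patterns (a single form in `acc`).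
      mixed : List ℕ → List ℕ → Bool → ℕ
      mixed L acc b = count p (λ t → pat τ L t ∧ does (sgn τ acc t Bool.≟ b))

      Compatible : List ℕ → List ℕ → Set
      Compatible L acc = Shifts L × Shifts acc × All (λ a → All (λ b → ¬ (b ≈ a)) acc) L

      -- Averaging over the two values of one sign keeps the imbalance bounded by the same constant.
      average : ∀ B x y z w → x ℕ.+ z ℕ.≤ y ℕ.+ w ℕ.+ B → x ℕ.+ w ℕ.≤ y ℕ.+ z ℕ.+ B → x ℕ.≤ y ℕ.+ B
      average B x y z w h h′ = ℕₚ.*-cancelˡ-≤ 2 (ℕₚ.+-cancelʳ-≤ (z ℕ.+ w) _ _ (begin
        2 ℕ.* x ℕ.+ (z ℕ.+ w)                          ≡⟨ solve 3 (λ x z w → con 2 :* x :+ (z :+ w) := (x :+ z) :+ (x :+ w)) ≡.refl x z w ⟩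
        (x ℕ.+ z) ℕ.+ (x ℕ.+ w)                        ≤⟨ ℕₚ.+-mono-≤ h h′ ⟩
        (y ℕ.+ w ℕ.+ B) ℕ.+ (y ℕ.+ z ℕ.+ B)            ≡⟨ solve 4 (λ y w z b → (y :+ w :+ b) :+ (y :+ z :+ b) := con 2 :* (y :+ b) :+ (z :+ w)) ≡.refl y w z B ⟩
        2 ℕ.* (y ℕ.+ B) ℕ.+ (z ℕ.+ w)                  ∎))
        where
        open ℕₚ.≤-Reasoning
        open +-*-Solver using (solve; _:+_; _:*_; _:=_; con)

      -- Let n′ u v count the t with pattern L, `hit` of x equal to u and product sign v. The
      -- balance of A on L compares n′ true true + n′ false true with n′ true false + n′ false
      -- false, that of x ∷ A compares n′ true true + n′ false false with n′ true false + n′ false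
      -- true. Adding the two isolates n′ true true against n′ true false without a larger error.
      mixed-balanced : ∀ L a acc → Compatible L (a ∷ acc) → length L ℕ.+ suc (length acc) ℕ.≤ k →
                       Near (mixed L (a ∷ acc) true) (mixed L (a ∷ acc) false) bound
      mixed-balanced []      a acc (_ , sh , _) le = sgnCount-balanced a acc sh le
      mixed-balanced (x ∷ L) a acc ((x# ∷ L# , x≉0 ∷ L≉0) , (acc# , acc≉0) , xacc ∷ Lacc) le = near₂
        where
        A = a ∷ acc
        cell : Bool → Bool → ℕ → Bool
        cell u v t = pat τ L t ∧ (does (hit τ x t Bool.≟ u) ∧ does (sgn τ A t Bool.≟ v))
        n′ : Bool → Bool → ℕ
        n′ u v = count p (cell u v)
        split₁ : ∀ v → mixed L A v ≡ n′ true v ℕ.+ n′ false v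
        split₁ v = count-split p (cell true v) (cell false v) (λ t → pointwise (pat τ L t) (hit τ x t) (does (sgn τ A t Bool.≟ v)))
          where
          pointwise : ∀ P h s → ⟦ P ∧ s ⟧ ≡ ⟦ P ∧ (does (h Bool.≟ true) ∧ s) ⟧ ℕ.+ ⟦ P ∧ (does (h Bool.≟ false) ∧ s) ⟧
          pointwise false h     s     = ≡.refl
          pointwise true  true  s     = ≡.sym (ℕₚ.+-identityʳ ⟦ s ⟧)
          pointwise true  false s     = ≡.refl
        split₂ : ∀ v → mixed L (x ∷ A) v ≡ n′ true v ℕ.+ n′ false (not v)
        split₂ v = count-split p (cell true v) (cell false (not v)) (λ t → pointwise v (pat τ L t) (hit τ x t) (sgn τ A t))
          where
          pointwise : ∀ v P h s → ⟦ P ∧ does ((if h then s else not s) Bool.≟ v) ⟧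
            ≡ ⟦ P ∧ (does (h Bool.≟ true) ∧ does (s Bool.≟ v)) ⟧ ℕ.+ ⟦ P ∧ (does (h Bool.≟ false) ∧ does (s Bool.≟ not v)) ⟧
          pointwise v     false h     s     = ≡.refl
          pointwise v     true  true  s     = ≡.sym (ℕₚ.+-identityʳ _)
          pointwise true  true  false true  = ≡.refl
          pointwise true  true  false false = ≡.refl
          pointwise false true  false true  = ≡.refl
          pointwise false true  false false = ≡.refl
        head≡ : ∀ v → mixed (x ∷ L) A v ≡ n′ true v
        head≡ v = Σ-cong p (λ t _ → pointwise (pat τ L t) (hit τ x t) (does (sgn τ A t Bool.≟ v)))
          where
          pointwise : ∀ P h s → ⟦ (h ∧ P) ∧ s ⟧ ≡ ⟦ P ∧ (does (h Bool.≟ true) ∧ s) ⟧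
          pointwise true  true  s = ≡.refl
          pointwise true  false s = ≡.refl
          pointwise false true  s = ≡.refl
          pointwise false false s = ≡.refl
        lenL : length L ℕ.+ suc (length acc) ℕ.≤ k
        lenL = ℕₚ.≤-trans (ℕₚ.n≤1+n _) le
        ih₁ = mixed-balanced L a acc ((L# , L≉0) , (acc# , acc≉0) , Lacc) lenL
        ih₂ = mixed-balanced L x A
          ((L# , L≉0) , (xacc ∷ acc# , x≉0 ∷ acc≉0) , All.zipWith (λ (h , hs) → (λ e → h (sym e)) ∷ hs) (x# , Lacc))
          (≡.subst (ℕ._≤ k) (≡.sym (ℕₚ.+-suc (length L) (suc (length acc)))) le)
        near₁ : Near (n′ true true) (n′ true false) bound
        near₁ =
          average bound (n′ true true) (n′ true false) (n′ false true) (n′ false false)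
            (≡.subst₂ (λ i j → i ℕ.≤ j ℕ.+ bound) (split₁ true) (split₁ false) (proj₁ ih₁))
            (≡.subst₂ (λ i j → i ℕ.≤ j ℕ.+ bound) (split₂ true) (split₂ false) (proj₁ ih₂)) ,
          average bound (n′ true false) (n′ true true) (n′ false false) (n′ false true)
            (≡.subst₂ (λ i j → i ℕ.≤ j ℕ.+ bound) (split₁ false) (split₁ true) (proj₂ ih₁))
            (≡.subst₂ (λ i j → i ℕ.≤ j ℕ.+ bound) (split₂ false) (split₂ true) (proj₂ ih₂))
        near₂ : Near (mixed (x ∷ L) A true) (mixed (x ∷ L) A false) bound
        near₂ = ≡.subst₂ (λ i j → Near i j bound) (≡.sym (head≡ true)) (≡.sym (head≡ false)) near₁

      -- One more form halves both the count and the error inherited so far and adds at most half of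
      -- `bound`. So one `bound` suffices for every pattern of at most k forms.
      patCount-near : ∀ L → Shifts L → length L ℕ.≤ k →
                      Near (2 ℕ.^ length L ℕ.* patCount τ L) p (2 ℕ.^ length L ℕ.* bound)
      patCount-near []      sh le = near-weaken ℕ.z≤n (near-≡ (≡.trans (ℕₚ.+-identityʳ _) (≡.trans (Σ-const p 1) (ℕₚ.*-identityʳ p))))
      patCount-near (x ∷ L) (x# ∷ L# , x≉0 ∷ L≉0) le =
        near-weaken (ℕₚ.≤-reflexive (solve 2 (λ N b → N :* b :+ N :* b := (con 2 :* N) :* b) ≡.refl N bound))
          (near-trans (≡.subst (λ z → Near z (N ℕ.* (u ℕ.+ v)) (N ℕ.* bound)) (solve 2 (λ N u → N :* (u :+ u) := (con 2 :* N) :* u) ≡.refl N u)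
                        (near-* N (near-+u near-uv)))
            (≡.subst (λ z → Near (N ℕ.* z) p (N ℕ.* bound)) total ih))
        where
        open +-*-Solver using (solve; _:+_; _:*_; _:=_; con)
        N = 2 ℕ.^ length L
        u = patCount τ (x ∷ L)
        v = mixed L (x ∷ []) false
        u≡ : mixed L (x ∷ []) true ≡ u
        u≡ = Σ-cong p (λ t _ → pointwise (pat τ L t) (hit τ x t))
          where
          pointwise : ∀ P h → ⟦ P ∧ does ((if h then true else false) Bool.≟ true) ⟧ ≡ ⟦ h ∧ P ⟧
          pointwise true  true  = ≡.refl
          pointwise true  false = ≡.refl
          pointwise false true  = ≡.refl
          pointwise false false = ≡.refl
        total : patCount τ L ≡ u ℕ.+ v
        total = count-split p (pat τ (x ∷ L)) (λ t → pat τ L t ∧ does (sgn τ (x ∷ []) t Bool.≟ false)) (λ t → pointwise (pat τ L t) (hit τ x t))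
          where
          pointwise : ∀ P h → ⟦ P ⟧ ≡ ⟦ h ∧ P ⟧ ℕ.+ ⟦ P ∧ does ((if h then true else false) Bool.≟ false) ⟧
          pointwise true  true  = ≡.refl
          pointwise true  false = ≡.refl
          pointwise false true  = ≡.refl
          pointwise false false = ≡.refl
        near-uv : Near u v bound
        near-uv = ≡.subst (λ z → Near z v bound) u≡
          (mixed-balanced L x [] ((L# , L≉0) , ([] ∷ [] , x≉0 ∷ []) , All.map (λ h → (λ e → h (sym e)) ∷ []) x#)
            (≡.subst (ℕ._≤ k) (ℕₚ.+-comm 1 (length L)) le))
        near-+u : ∀ {B} → Near u v B → Near (u ℕ.+ u) (u ℕ.+ v) B
        near-+u h = near-+ {B = 0} (near-≡ {u} ≡.refl) h
        ih : Near (N ℕ.* patCount τ L) p (N ℕ.* bound)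
        ih = patCount-near L (L# , L≉0) (ℕₚ.≤-trans (ℕₚ.n≤1+n _) le)

-- Runs of consecutive equal Legendre symbols

module LongRuns where

  open import Data.Bool using (Bool; true; false; _∧_)
  open import Data.Bool.Properties using (T-≡)
  open import Data.Nat as ℕ using (ℕ; suc; _<ᵇ_; _%_)
  import Data.Nat.Properties as ℕₚ
  open import Data.Nat.Divisibility using (_∣_; ∣⇒≤; ∣m+n∣m⇒∣n; m∣m*n)
  open import Data.Nat.DivMod using (m%n<n; m/n*n≤m; m*n/n≡m; /-monoˡ-≤)
  open import Data.Nat.Primality using (Prime)
  open import Data.Nat.Solver using (module +-*-Solver)
  open import Data.List using ([]; _∷_; length; applyUpTo)
  open import Data.List.Relation.Unary.All using (All; []; _∷_)
  import Data.List.Relation.Unary.All.Properties as Allₚ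
  open import Data.Product using (_,_; proj₁; proj₂; ∃)
  open import Data.Sum using (inj₁; inj₂)
  open import Function using (_∘_)
  open import Function.Bundles using (Equivalence)
  open import Relation.Binary.Definitions using (tri<; tri≈; tri>)
  open import Relation.Binary.PropositionalEquality as ≡ using (_≡_)
  open import Relation.Nullary using (¬_; contradiction)
  open import Relation.Nullary.Decidable using (dec-true)
  open FiniteSums
  open PrimeFields
  open SignPatterns

  -- From b·m′ + a·μ = b·m + a·μ′ one gets a ∣ (b - a)(m′ - m).
  spacing : ∀ a b κ m m′ μ μ′ → ¬ (a ≡ b) → b ℕ.< a ℕ.+ κ → a ℕ.< b ℕ.+ κ → m ℕ.< m′ →
            b ℕ.* m′ ℕ.+ a ℕ.* μ ≡ b ℕ.* m ℕ.+ a ℕ.* μ′ → a ℕ.≤ κ ℕ.* (m′ ℕ.∸ m)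
  spacing a b κ m m′ μ μ′ a≢b b<a+κ a<b+κ m<m′ e = byCmp (ℕₚ.<-cmp a b)
    where
    open +-*-Solver using (solve; _:+_; _:*_; _:=_)
    δ = m′ ℕ.∸ m
    0<δ : 0 ℕ.< δ
    0<δ = ℕₚ.m<n⇒0<n∸m m<m′
    m′≡ : m′ ≡ m ℕ.+ δ
    m′≡ = ≡.sym (ℕₚ.m+[n∸m]≡n (ℕₚ.<⇒≤ m<m′))
    e′ : b ℕ.* δ ℕ.+ a ℕ.* μ ≡ a ℕ.* μ′
    e′ = ℕₚ.+-cancelˡ-≡ (b ℕ.* m) _ _ (≡.trans (solve 4 (λ b m d z → b :* m :+ (b :* d :+ z) := b :* (m :+ d) :+ z) ≡.refl b m δ (a ℕ.* μ))
           (≡.trans (≡.cong (λ z → b ℕ.* z ℕ.+ a ℕ.* μ) (≡.sym m′≡)) e))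
    a∣bδ : a ∣ b ℕ.* δ
    a∣bδ = ∣m+n∣m⇒∣n (≡.subst (a ∣_) (≡.trans (≡.sym e′) (ℕₚ.+-comm (b ℕ.* δ) (a ℕ.* μ))) (m∣m*n μ′)) (m∣m*n μ)
    finish : ∀ k → 0 ℕ.< k → k ℕ.≤ κ → a ∣ k ℕ.* δ → a ℕ.≤ κ ℕ.* δ
    finish k 0<k k≤κ d = ℕₚ.≤-trans (∣⇒≤ {{ℕ.>-nonZero (ℕₚ.*-mono-≤ 0<k 0<δ)}} d) (ℕₚ.*-monoˡ-≤ δ k≤κ)
    byCmp : _ → a ℕ.≤ κ ℕ.* δ
    byCmp (tri≈ _ a≡b _) = contradiction a≡b a≢b
    byCmp (tri< a<b _ _) = finish (b ℕ.∸ a) (ℕₚ.m<n⇒0<n∸m a<b)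
      (ℕₚ.<⇒≤ (ℕₚ.+-cancelˡ-< a _ _ (≡.subst (ℕ._< a ℕ.+ κ) (≡.sym (ℕₚ.m+[n∸m]≡n (ℕₚ.<⇒≤ a<b))) b<a+κ)))
      (∣m+n∣m⇒∣n (≡.subst (a ∣_) (≡.trans (≡.cong (ℕ._* δ) (≡.sym (ℕₚ.m+[n∸m]≡n (ℕₚ.<⇒≤ a<b)))) (ℕₚ.*-distribʳ-+ δ a (b ℕ.∸ a))) a∣bδ) (m∣m*n δ))
    byCmp (tri> _ _ b<a) = finish (a ℕ.∸ b) (ℕₚ.m<n⇒0<n∸m b<a)
      (ℕₚ.<⇒≤ (ℕₚ.+-cancelˡ-< b _ _ (≡.subst (ℕ._< b ℕ.+ κ) (≡.sym (ℕₚ.m+[n∸m]≡n (ℕₚ.<⇒≤ b<a))) a<b+κ)))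
      (∣m+n∣m⇒∣n (≡.subst (a ∣_) (≡.trans (≡.cong (ℕ._* δ) (≡.sym (ℕₚ.m+[n∸m]≡n (ℕₚ.<⇒≤ b<a)))) (ℕₚ.*-distribʳ-+ δ b (a ℕ.∸ b))) (m∣m*n δ)) a∣bδ)

  -- From 4 κ N ≤ M + 4 κ ≤ 2 M the overlap term κ² N takes away at most half of κ M.
  run-arith : ∀ κ M b N → 1 ℕ.≤ κ → 4 ℕ.* κ ℕ.≤ M → κ ℕ.* M ℕ.≤ 4 ℕ.* b ℕ.+ κ ℕ.* (κ ℕ.* N) →
              4 ℕ.* κ ℕ.* N ℕ.≤ M ℕ.+ 4 ℕ.* κ → κ ℕ.* M ℕ.≤ 8 ℕ.* b
  run-arith κ@(suc _) M b N 1≤κ 4κ≤M h h′ = ℕₚ.*-cancelˡ-≤ 2 (ℕₚ.+-cancelʳ-≤ (2 ℕ.* (κ ℕ.* M)) _ _ (begin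
    2 ℕ.* (κ ℕ.* M) ℕ.+ 2 ℕ.* (κ ℕ.* M)               ≡⟨ solve 1 (λ x → con 2 :* x :+ con 2 :* x := con 4 :* x) ≡.refl (κ ℕ.* M) ⟩
    4 ℕ.* (κ ℕ.* M)                                   ≤⟨ ℕₚ.*-monoʳ-≤ 4 h ⟩
    4 ℕ.* (4 ℕ.* b ℕ.+ κ ℕ.* (κ ℕ.* N))               ≡⟨ solve 3 (λ b k n → con 4 :* (con 4 :* b :+ k :* (k :* n)) := con 2 :* (con 8 :* b) :+ k :* (con 4 :* k :* n)) ≡.refl b κ N ⟩
    2 ℕ.* (8 ℕ.* b) ℕ.+ κ ℕ.* (4 ℕ.* κ ℕ.* N)         ≤⟨ ℕₚ.+-monoʳ-≤ (2 ℕ.* (8 ℕ.* b)) (ℕₚ.*-monoʳ-≤ κ (ℕₚ.≤-trans h′ (ℕₚ.+-monoʳ-≤ M 4κ≤M))) ⟩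
    2 ℕ.* (8 ℕ.* b) ℕ.+ κ ℕ.* (M ℕ.+ M)               ≡⟨ solve 3 (λ b k m → con 2 :* (con 8 :* b) :+ k :* (m :+ m) := con 2 :* (con 8 :* b) :+ con 2 :* (k :* m)) ≡.refl b κ M ⟩
    2 ℕ.* (8 ℕ.* b) ℕ.+ 2 ℕ.* (κ ℕ.* M)               ∎))
    where
    open ℕₚ.≤-Reasoning
    open +-*-Solver using (solve; _:+_; _:*_; _:=_; con)

  module Runs (n : ℕ) (1≤n : 1 ℕ.≤ n) (pr : Prime (suc (n ℕ.+ n))) where

    open PrimeField n 1≤n pr
    open Patterns n 1≤n pr
    import Algebra.Solver.Ring.NaturalCoefficients.Default commutativeSemiring as KS
    import Relation.Binary.Reasoning.Setoid setoid as R

    inverse : ∀ a → ¬ (a ≈ 0) → ∃ λ a′ → a * a′ ≈ 1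
    inverse a a≉0 = a ^ (ℕ.pred (n ℕ.+ n)) , trans (reflexive (≡.cong (a ^_) suc-pred-2n)) (fermat-unit a a≉0)
      where
      suc-pred-2n : suc (ℕ.pred (n ℕ.+ n)) ≡ n ℕ.+ n
      suc-pred-2n = ℕₚ.suc-pred (n ℕ.+ n) {{ℕ.>-nonZero (ℕₚ.≤-trans 1≤n (ℕₚ.m≤m+n n n))}}

    sign-* : ∀ {x y} → IsSign x → IsSign y → IsSign (x * y)
    sign-* (inj₁ x) (inj₁ y) = inj₁ (trans (*-cong x y) (*-identityˡ 1))
    sign-* (inj₁ x) (inj₂ y) = inj₂ (trans (*-cong x y) (*-identityˡ -1ₚ))
    sign-* (inj₂ x) (inj₁ y) = inj₂ (trans (*-cong x y) (*-identityʳ -1ₚ))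
    sign-* (inj₂ x) (inj₂ y) = inj₁ (trans (*-cong x y) -1*-1)

    sign-square : ∀ {x} → IsSign x → x * x ≈ 1
    sign-square (inj₁ x) = trans (*-cong x x) (*-identityˡ 1)
    sign-square (inj₂ x) = trans (*-cong x x) -1*-1

    pat-true : ∀ τ as t → All (λ a → (t + a) ^ n ≈ τ) as → pat τ as t ≡ true
    pat-true τ []       t []       = ≡.refl
    pat-true τ (a ∷ as) t (h ∷ hs) = ≡.cong₂ _∧_ (dec-true (((t + a) ^ n) ≟ₚ τ) h) (pat-true τ as t hs)

    -- π t is the position of a t relative to c: π t < M means that a t is one of the M residues
    -- from c onwards. On residues, ρ is its inverse.
    module Affine (a c : ℕ) (a≉0 : ¬ (a ≈ 0)) where

      a⁻¹ : ℕ
      a⁻¹ = proj₁ (inverse a a≉0)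

      π ρ : ℕ → ℕ
      π t = (a * t + - c) % p
      ρ m = (a⁻¹ * (m + c)) % p

      π-spec : ∀ t → c + π t ≈ a * t
      π-spec t = begin
        c + π t              ≈⟨ +-congˡ {c} (%≈ (a * t + - c)) ⟩
        c + (a * t + - c)    ≈⟨ KS.solve 3 (λ c x d → c KS.:+ (x KS.:+ d) KS.:= x KS.:+ (c KS.:+ d)) refl c (a * t) (- c) ⟩
        a * t + (c + - c)    ≈⟨ +-congˡ {a * t} (-‿inverseʳ c) ⟩
        a * t + 0            ≈⟨ +-identityʳ (a * t) ⟩
        a * t                ∎
        where open R

      a*ρ : ∀ m → a * ρ m ≈ c + m
      a*ρ m = begin
        a * ρ m              ≈⟨ *-congˡ {a} (%≈ (a⁻¹ * (m + c))) ⟩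
        a * (a⁻¹ * (m + c))  ≈⟨ *-assoc a a⁻¹ (m + c) ⟨
        a * a⁻¹ * (m + c)    ≈⟨ *-congʳ {m + c} (proj₂ (inverse a a≉0)) ⟩
        1 * (m + c)          ≈⟨ *-identityˡ (m + c) ⟩
        m + c                ≈⟨ +-comm m c ⟩
        c + m                ∎
        where open R

      +-cancel : ∀ {x y} → c + x ≈ c + y → x ≈ y
      +-cancel {x} {y} e = begin
        x                  ≈⟨ +-identityˡ x ⟨
        0 + x              ≈⟨ +-congʳ {x} (-‿inverseˡ c) ⟨
        - c + c + x        ≈⟨ +-assoc (- c) c x ⟩
        - c + (c + x)      ≈⟨ +-congˡ { - c} e ⟩
        - c + (c + y)      ≈⟨ +-assoc (- c) c y ⟨
        - c + c + y        ≈⟨ +-congʳ {y} (-‿inverseˡ c) ⟩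
        0 + y              ≈⟨ +-identityˡ y ⟩
        y                  ∎
        where open R

      π<p : ∀ t → π t ℕ.< p
      π<p t = m%n<n (a * t + - c) p

      ρ<p : ∀ m → ρ m ℕ.< p
      ρ<p m = m%n<n (a⁻¹ * (m + c)) p

      ρπ : ∀ t → t ℕ.< p → ρ (π t) ≡ t
      ρπ t t<p = <⇒≡ (ρ<p (π t)) t<p (*-cancelₚ a≉0 (trans (a*ρ (π t)) (π-spec t)))

      πρ : ∀ m → m ℕ.< p → π (ρ m) ≡ m
      πρ m m<p = <⇒≡ (π<p (ρ m)) m<p (+-cancel (trans (π-spec (ρ m)) (a*ρ m)))

      window : ∀ M (h : ℕ → ℕ) → M ℕ.≤ p → Σ< p (λ t → h t ℕ.* ⟦ π t <ᵇ M ⟧) ≡ Σ< M (h ∘ ρ)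
      window M h M≤p = ≡.trans (Σ-bijection p π ρ h (λ m → ⟦ m <ᵇ M ⟧) (λ t _ → π<p t) (λ m _ → ρ<p m) ρπ πρ)
        (≡.trans (≡.cong (λ k → Σ< k (λ m → h (ρ m) ℕ.* ⟦ m <ᵇ M ⟧)) (≡.sym (ℕₚ.m+[n∸m]≡n M≤p)))
          (Σ-restrict M (p ℕ.∸ M) (h ∘ ρ)))

    -- Dividing a long run by a = L + i (i < κ) yields runs of length K around κ·M residues t, and
    -- two divisors share few of them.
    run-bound : ∀ κ L M K bnd c σ H → IsSign σ → 1 ℕ.≤ κ → 4 ℕ.* κ ℕ.* κ ℕ.≤ L → 4 ℕ.* κ ℕ.≤ M →
                2 ℕ.* ((L ℕ.+ κ) ℕ.* M) ℕ.< p → M ℕ.+ (L ℕ.+ κ) ℕ.* K ℕ.≤ H →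
                (∀ h → h ℕ.< H → (c + h) ^ n ≈ σ) →
                (∀ τ → IsSign τ → patCount τ (applyUpTo suc K) ℕ.≤ 2 ℕ.* bnd) →
                κ ℕ.* M ℕ.≤ 8 ℕ.* bnd
    run-bound κ L M K bnd c σ H sσ 1≤κ 4κκ≤L 4κ≤M small fits run pats =
      run-arith κ M bnd N 1≤κ 4κ≤M κM≤ N≤
      where
      bs = applyUpTo suc K
      a : ℕ → ℕ
      a i = L ℕ.+ i
      1≤M : 1 ℕ.≤ M
      1≤M = ℕₚ.≤-trans 1≤κ (ℕₚ.≤-trans (ℕₚ.m≤m+n κ _) 4κ≤M)
      1≤L : 1 ℕ.≤ L
      1≤L = ℕₚ.≤-trans (ℕₚ.*-mono-≤ (ℕₚ.≤-trans 1≤κ (ℕₚ.m≤m+n κ _)) 1≤κ) 4κκ≤L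
      LκM<p : (L ℕ.+ κ) ℕ.* M ℕ.< p
      LκM<p = ℕₚ.≤-<-trans (ℕₚ.m≤m+n _ _) small
      M<p : M ℕ.< p
      M<p = ℕₚ.≤-<-trans (ℕₚ.≤-trans (ℕₚ.≤-reflexive (≡.sym (ℕₚ.*-identityˡ M))) (ℕₚ.*-monoˡ-≤ M (ℕₚ.≤-trans 1≤L (ℕₚ.m≤m+n L κ)))) LκM<p
      a<p : ∀ i → i ℕ.< κ → a i ℕ.< p
      a<p i i<κ = ℕₚ.<-trans (ℕₚ.+-monoʳ-< L i<κ) (ℕₚ.≤-<-trans (ℕₚ.≤-trans (ℕₚ.≤-reflexive (≡.sym (ℕₚ.*-identityʳ _))) (ℕₚ.*-monoʳ-≤ (L ℕ.+ κ) 1≤M)) LκM<p)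
      a≉0 : ∀ i → i ℕ.< κ → ¬ (a i ≈ 0)
      a≉0 i i<κ = <⇒≉0 (ℕₚ.≤-trans 1≤L (ℕₚ.m≤m+n L i)) (a<p i i<κ)
      π′ : ℕ → ℕ → ℕ
      π′ i t = (a i * t + - c) % p
      X : ℕ → ℕ → Bool
      X i t = π′ i t <ᵇ M
      X⇒< : ∀ i t → X i t ≡ true → π′ i t ℕ.< M
      X⇒< i t e = ℕₚ.<ᵇ⇒< (π′ i t) M (Equivalence.from T-≡ e)
      module A (i : ℕ) (i<κ : i ℕ.< κ) = Affine (a i) c (a≉0 i i<κ)

      count-X : ∀ i → i ℕ.< κ → count p (X i) ≡ M
      count-X i i<κ = ≡.trans (Σ-cong p (λ t _ → ≡.sym (ℕₚ.*-identityˡ ⟦ X i t ⟧)))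
        (≡.trans (A.window i i<κ M (λ _ → 1) (ℕₚ.<⇒≤ M<p)) (≡.trans (Σ-const M 1) (ℕₚ.*-identityʳ M)))

      U : ℕ → ℕ
      U t = ⟦ pat 1 bs t ⟧ ℕ.+ ⟦ pat -1ₚ bs t ⟧

      -- If a t = c + m with m < M, then a (t + b) = c + m + a b is still in the run for 1 ≤ b ≤ K,
      -- by `fits`. As (a^n)² = 1, all these t + b have sign σ a^n.
      X≤U : ∀ t i → i ℕ.< κ → ⟦ X i t ⟧ ℕ.≤ U t
      X≤U t i i<κ = byX (X i t) ≡.refl
        where
        open R
        τ = σ * a i ^ n
        sa : IsSign (a i ^ n)
        sa = half-power (a i) (a≉0 i i<κ)
        sτ : IsSign τ
        sτ = sign-* sσ sa
        power : X i t ≡ true → ∀ b → b ℕ.< K → (t + suc b) ^ n ≈ τ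
        power e b b<K = begin
          y                            ≈⟨ *-identityˡ y ⟨
          1 * y                        ≈⟨ *-congʳ {y} (sign-square sa) ⟨
          a i ^ n * a i ^ n * y        ≈⟨ *-assoc (a i ^ n) (a i ^ n) y ⟩
          a i ^ n * (a i ^ n * y)      ≈⟨ *-congˡ {a i ^ n} (^-distrib-* (a i) (t + suc b) n) ⟨
          a i ^ n * (a i * (t + suc b)) ^ n ≈⟨ *-congˡ {a i ^ n} (^-congˡ n shifted) ⟩
          a i ^ n * (c + h) ^ n        ≈⟨ *-congˡ {a i ^ n} (run h h<H) ⟩
          a i ^ n * σ                  ≈⟨ *-comm (a i ^ n) σ ⟩
          τ                            ∎
          where
          y = (t + suc b) ^ n
          h = π′ i t ℕ.+ a i ℕ.* suc b
          shifted : a i * (t + suc b) ≈ c + h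
          shifted = begin
            a i * (t + suc b)               ≈⟨ distribˡ (a i) t (suc b) ⟩
            a i * t + a i * suc b           ≈⟨ +-congʳ {a i * suc b} (A.π-spec i i<κ t) ⟨
            c + π′ i t + a i * suc b        ≈⟨ +-assoc c (π′ i t) (a i * suc b) ⟩
            c + h                           ∎
          h<H : h ℕ.< H
          h<H = ℕₚ.≤-trans (ℕₚ.+-mono-<-≤ (X⇒< i t e) (ℕₚ.*-mono-≤ (ℕₚ.+-monoʳ-≤ L (ℕₚ.<⇒≤ i<κ)) b<K)) fits
        byX : ∀ b → X i t ≡ b → ⟦ X i t ⟧ ℕ.≤ U t
        byX false e = ≡.subst (λ b → ⟦ b ⟧ ℕ.≤ U t) (≡.sym e) ℕ.z≤n
        byX true  e = ≡.subst (λ b → ⟦ b ⟧ ℕ.≤ U t) (≡.sym e) (bySign sτ)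
          where
          pats-true : ∀ τ′ → τ ≈ τ′ → pat τ′ bs t ≡ true
          pats-true τ′ eq = pat-true τ′ bs t (Allₚ.applyUpTo⁺₁ suc K (λ {b} b<K → trans (power e b b<K) eq))
          bySign : IsSign τ → 1 ℕ.≤ U t
          bySign (inj₁ eq) = ≡.subst (λ b → 1 ℕ.≤ ⟦ b ⟧ ℕ.+ ⟦ pat -1ₚ bs t ⟧) (≡.sym (pats-true 1 eq)) (ℕ.s≤s ℕ.z≤n)
          bySign (inj₂ eq) = ≡.subst (λ b → 1 ℕ.≤ ⟦ pat 1 bs t ⟧ ℕ.+ ⟦ b ⟧) (≡.sym (pats-true -1ₚ eq)) (ℕₚ.m≤n+m 1 _)

      pair : ℕ → ℕ → ℕ
      pair i j = count p (λ t → X i t ∧ X j t)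

      -- The overlap is indexed by the positions m < M of the multiples of a i. By `spacing` two of
      -- them differ by at least a i / κ ≥ 4 κ, since L ≥ 4 κ².
      pair-bound : ∀ i j → i ℕ.< κ → j ℕ.< κ → ¬ (i ≡ j) → 4 ℕ.* κ ℕ.* pair i j ℕ.≤ M ℕ.+ 4 ℕ.* κ
      pair-bound i j i<κ j<κ i≢j = ℕₚ.≤-trans
        (ℕₚ.≤-reflexive (≡.trans (≡.cong (4 ℕ.* κ ℕ.*_) reindex) (≡.sym (ℕₚ.+-identityʳ _))))
        (spaced-count (4 ℕ.* κ) M (X j ∘ ρ) 0 ℕ.z≤n (ℕₚ.≤-trans 1≤κ (ℕₚ.m≤m+n κ _)) (λ _ ()) spaced)
        where
        open A i i<κ using (ρ; a*ρ; window; +-cancel)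
        ⟦∧⟧ : ∀ x y → ⟦ x ∧ y ⟧ ≡ ⟦ y ⟧ ℕ.* ⟦ x ⟧
        ⟦∧⟧ true  true  = ≡.refl
        ⟦∧⟧ true  false = ≡.refl
        ⟦∧⟧ false true  = ≡.refl
        ⟦∧⟧ false false = ≡.refl
        reindex : pair i j ≡ count M (X j ∘ ρ)
        reindex = ≡.trans (Σ-cong p (λ t _ → ⟦∧⟧ (X i t) (X j t))) (window M (λ t → ⟦ X j t ⟧) (ℕₚ.<⇒≤ M<p))
        spaced : ∀ m m′ → m ℕ.< m′ → m′ ℕ.< M → X j (ρ m) ≡ true → X j (ρ m′) ≡ true → 4 ℕ.* κ ℕ.≤ m′ ℕ.∸ m
        spaced m m′ m<m′ m′<M e e′ = ℕₚ.*-cancelˡ-≤ κ {{ℕ.>-nonZero 1≤κ}} (ℕₚ.≤-trans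
          (ℕₚ.≤-trans (ℕₚ.≤-reflexive (ℕₚ.*-comm κ (4 ℕ.* κ))) (ℕₚ.≤-trans 4κκ≤L (ℕₚ.m≤m+n L i)))
          (spacing (a i) (a j) κ m m′ μ μ′ (λ eq → i≢j (ℕₚ.+-cancelˡ-≡ L i j eq))
            (near j i j<κ) (near i j i<κ) m<m′ exact))
          where
          open R
          t = ρ m
          t′ = ρ m′
          μ = π′ j t
          μ′ = π′ j t′
          near : ∀ x y → x ℕ.< κ → a x ℕ.< a y ℕ.+ κ
          near x y x<κ = ℕₚ.<-≤-trans (ℕₚ.+-monoʳ-< L x<κ) (ℕₚ.+-monoˡ-≤ κ (ℕₚ.m≤m+n L y))
          -- After adding (a j + a i) c each side is a i a j (t + t′), so the unknown starting point
          -- c drops out.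
          cong≈ : a j * m′ + a i * μ ≈ a j * m + a i * μ′
          cong≈ = cancel-both (begin
            a j * c + a i * c + (a j * m′ + a i * μ)     ≈⟨ collect (a j) (a i) c m′ μ ⟩
            a j * (c + m′) + a i * (c + μ)               ≈⟨ +-cong (*-congˡ {a j} (sym (a*ρ m′))) (*-congˡ {a i} (A.π-spec j j<κ t)) ⟩
            a j * (a i * t′) + a i * (a j * t)           ≈⟨ KS.solve 4 (λ x y u v → x KS.:* (y KS.:* u) KS.:+ y KS.:* (x KS.:* v) KS.:= x KS.:* (y KS.:* v) KS.:+ y KS.:* (x KS.:* u)) refl (a j) (a i) t′ t ⟩
            a j * (a i * t) + a i * (a j * t′)           ≈⟨ +-cong (*-congˡ {a j} (sym (a*ρ m))) (*-congˡ {a i} (A.π-spec j j<κ t′)) ⟨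
            a j * (c + m) + a i * (c + μ′)               ≈⟨ collect (a j) (a i) c m μ′ ⟨
            a j * c + a i * c + (a j * m + a i * μ′)     ∎)
            where
            collect : ∀ x y c u v → x * c + y * c + (x * u + y * v) ≈ x * (c + u) + y * (c + v)
            collect x y c u v = KS.solve 5 (λ x y c u v → x KS.:* c KS.:+ y KS.:* c KS.:+ (x KS.:* u KS.:+ y KS.:* v) KS.:= x KS.:* (c KS.:+ u) KS.:+ y KS.:* (c KS.:+ v)) refl x y c u v
            cancel-both : ∀ {x y} → a j * c + a i * c + x ≈ a j * c + a i * c + y → x ≈ y
            cancel-both = Affine.+-cancel 1 (a j * c + a i * c) 1≉0
          below : ∀ x y u v → x ℕ.< κ → y ℕ.< κ → u ℕ.< M → v ℕ.< M → a x ℕ.* u ℕ.+ a y ℕ.* v ℕ.< p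
          below x y u v x<κ y<κ u<M v<M = ℕₚ.≤-<-trans (ℕₚ.≤-trans
            (ℕₚ.+-mono-≤ (ℕₚ.*-mono-≤ (ℕₚ.+-monoʳ-≤ L (ℕₚ.<⇒≤ x<κ)) (ℕₚ.<⇒≤ u<M)) (ℕₚ.*-mono-≤ (ℕₚ.+-monoʳ-≤ L (ℕₚ.<⇒≤ y<κ)) (ℕₚ.<⇒≤ v<M)))
            (ℕₚ.≤-reflexive (≡.cong ((L ℕ.+ κ) ℕ.* M ℕ.+_) (≡.sym (ℕₚ.+-identityʳ _))))) small
          -- `small` keeps both sides below p, so the congruence is an equality of integers and
          -- divisibility arguments apply.
          exact : a j ℕ.* m′ ℕ.+ a i ℕ.* μ ≡ a j ℕ.* m ℕ.+ a i ℕ.* μ′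
          exact = <⇒≡ (below j i m′ μ j<κ i<κ m′<M (X⇒< j t e)) (below j i m μ′ j<κ i<κ (ℕₚ.<-trans m<m′ m′<M) (X⇒< j t′ e′)) cong≈

      N : ℕ
      N = (M ℕ.+ 4 ℕ.* κ) ℕ./ (4 ℕ.* κ)
        where instance _ = ℕ.>-nonZero (ℕₚ.≤-trans 1≤κ (ℕₚ.m≤m+n κ _))

      N≤ : 4 ℕ.* κ ℕ.* N ℕ.≤ M ℕ.+ 4 ℕ.* κ
      N≤ = ℕₚ.≤-trans (ℕₚ.≤-reflexive (ℕₚ.*-comm (4 ℕ.* κ) N)) (m/n*n≤m (M ℕ.+ 4 ℕ.* κ) (4 ℕ.* κ))
        where instance _ = ℕ.>-nonZero (ℕₚ.≤-trans 1≤κ (ℕₚ.m≤m+n κ _))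

      pair≤N : ∀ i j → i ℕ.< κ → j ℕ.< κ → ¬ (i ≡ j) → pair i j ℕ.≤ N
      pair≤N i j i<κ j<κ i≢j = ≡.subst (ℕ._≤ N) (m*n/n≡m (pair i j) (4 ℕ.* κ))
        (/-monoˡ-≤ (4 ℕ.* κ) (ℕₚ.≤-trans (ℕₚ.≤-reflexive (ℕₚ.*-comm (pair i j) (4 ℕ.* κ))) (pair-bound i j i<κ j<κ i≢j)))
        where instance _ = ℕ.>-nonZero (ℕₚ.≤-trans 1≤κ (ℕₚ.m≤m+n κ _))

      -- Counts the pairs (i, t) with `X i t` in both orders, with Bonferroni over i at each t.
      κM≤ : κ ℕ.* M ℕ.≤ 4 ℕ.* bnd ℕ.+ κ ℕ.* (κ ℕ.* N)
      κM≤ = begin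
        κ ℕ.* M                                            ≡⟨ Σ-const κ M ⟨
        Σ< κ (λ _ → M)                                     ≡⟨ Σ-cong κ (λ i i<κ → count-X i i<κ) ⟨
        Σ< κ (λ i → count p (X i))                         ≡⟨ Σ-swap κ p (λ i t → ⟦ X i t ⟧) ⟩
        Σ< p (λ t → Σ< κ (λ i → ⟦ X i t ⟧))                ≤⟨ Σ-mono p (λ t _ → bonferroni κ (λ i → X i t) (U t) (X≤U t)) ⟩
        Σ< p (λ t → U t ℕ.+ Σ< κ (λ i → Σ< i (λ j → ⟦ X i t ∧ X j t ⟧)))
          ≡⟨ Σ-+ p U (λ t → Σ< κ (λ i → Σ< i (λ j → ⟦ X i t ∧ X j t ⟧))) ⟩
        Σ< p U ℕ.+ Σ< p (λ t → Σ< κ (λ i → Σ< i (λ j → ⟦ X i t ∧ X j t ⟧)))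
          ≤⟨ ℕₚ.+-mono-≤ U≤ pairs≤ ⟩
        4 ℕ.* bnd ℕ.+ κ ℕ.* (κ ℕ.* N)                      ∎
        where
        open ℕₚ.≤-Reasoning
        U≤ : Σ< p U ℕ.≤ 4 ℕ.* bnd
        U≤ = ℕₚ.≤-trans (ℕₚ.≤-reflexive (Σ-+ p (λ t → ⟦ pat 1 bs t ⟧) (λ t → ⟦ pat -1ₚ bs t ⟧)))
          (ℕₚ.≤-trans (ℕₚ.+-mono-≤ (pats 1 (inj₁ refl)) (pats -1ₚ (inj₂ refl)))
            (ℕₚ.≤-reflexive (solve 1 (λ b → con 2 :* b :+ con 2 :* b := con 4 :* b) ≡.refl bnd)))
          where open +-*-Solver using (solve; _:+_; _:*_; _:=_; con)
        pairs≤ : Σ< p (λ t → Σ< κ (λ i → Σ< i (λ j → ⟦ X i t ∧ X j t ⟧))) ℕ.≤ κ ℕ.* (κ ℕ.* N)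
        pairs≤ = ℕₚ.≤-trans (ℕₚ.≤-reflexive (Σ-swap p κ (λ t i → Σ< i (λ j → ⟦ X i t ∧ X j t ⟧))))
          (Σ-≤const κ (κ ℕ.* N) (λ i i<κ → ℕₚ.≤-trans (ℕₚ.≤-reflexive (Σ-swap p i (λ t j → ⟦ X i t ∧ X j t ⟧)))
            (ℕₚ.≤-trans (Σ-≤const i N (λ j j<i → pair≤N i j i<κ (ℕₚ.<-trans j<i i<κ) (λ e → ℕₚ.<⇒≢ j<i (≡.sym e))))
              (ℕₚ.*-monoˡ-≤ N (ℕₚ.<⇒≤ i<κ)))))

-- Sums of squared gaps as counts of empty intervals

module GapSums where

  open import Defs
  open import Data.Bool as Bool using (Bool; true; false; not; _∧_)
  open import Data.Nat
  open import Data.Nat.Properties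
  open import Data.Nat.ListAction using (sum)
  open import Data.List using (List; []; _∷_; map; upTo; filter; applyUpTo)
  open import Data.Nat.Solver using (module +-*-Solver)
  open import Data.Sum using (inj₁; inj₂)
  open import Function using (_∘_)
  open import Relation.Binary.PropositionalEquality
  open import Relation.Nullary using (contradiction)
  open FiniteSums

  miss : (ℕ → Bool) → ℕ → ℕ → Bool
  miss h x zero    = true
  miss h x (suc d) = not (h (suc x)) ∧ miss h (suc x) d

  module Gaps (h : ℕ → Bool) where

    -- The length of the stretch without elements right after x, written as a sum over interval
    -- lengths so that the order of summation can be exchanged later. E is a cut-off, harmless when
    -- no gap exceeds it.
    len : ℕ → ℕ → ℕ
    len E x = Σ< E (λ d → ⟦ miss h x (suc d) ⟧)

    len-gap : ∀ g E x → g ≤ E → (∀ j → j < g → h (suc x + j) ≡ false) → h (suc x + g) ≡ true → len E x ≡ g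
    len-gap zero E x _ _ e = Σ-zero E (λ d _ → cong (λ b → ⟦ not b ∧ miss h (suc x) d ⟧) (trans (cong h (sym (+-identityʳ (suc x)))) e))
    len-gap (suc g) (suc E) x (s≤s le) z e =
      trans (Σ-cong (suc E) {k = λ d → ⟦ miss h (suc x) d ⟧}
              (λ d _ → cong (λ b → ⟦ not b ∧ miss h (suc x) d ⟧) (trans (cong h (sym (+-identityʳ (suc x)))) (z 0 z<s))))
        (cong suc (len-gap g E (suc x) le
          (λ j j<g → trans (cong h (sym (+-suc (suc x) j))) (z (suc j) (s<s j<g)))
          (trans (cong h (sym (+-suc (suc x) g))) e)))

    weight : ℕ → ℕ → ℕ
    weight E x = 1 + 2 * len E x

    -- (g + 1)² is the sum 1 + 3 + ... + (2 g + 1) of odd numbers: a position with j nonelements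
    -- before the next element has weight 1 + 2 j.
    block : ∀ g E x → g ≤ E → (∀ j → j < g → h (suc x + j) ≡ false) → h (suc x + g) ≡ true →
            Σ< (suc g) (λ j → weight E (x + j)) ≡ suc g * suc g
    block zero E x le z e = trans (+-identityʳ _) (cong (λ k → 1 + 2 * k) (trans (cong (len E) (+-identityʳ x)) (len-gap zero E x le z e)))
    block (suc g) E x le z e = begin
      weight E (x + 0) + Σ< (suc g) (λ j → weight E (x + suc j))
        ≡⟨ cong₂ (λ y w → (1 + 2 * y) + w) (trans (cong (len E) (+-identityʳ x)) (len-gap (suc g) E x le z e))
             (Σ-cong (suc g) (λ j _ → cong (weight E) (+-suc x j))) ⟩
      1 + 2 * suc g + Σ< (suc g) (λ j → weight E (suc x + j))
        ≡⟨ cong (1 + 2 * suc g +_) (block g E (suc x) (≤-trans (n≤1+n g) le)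
             (λ j j<g → trans (cong h (sym (+-suc (suc x) j))) (z (suc j) (s<s j<g))) (trans (cong h (sym (+-suc (suc x) g))) e)) ⟩
      1 + 2 * suc g + suc g * suc g
        ≡⟨ solve 1 (λ g → con 1 :+ con 2 :* (con 1 :+ g) :+ (con 1 :+ g) :* (con 1 :+ g) := (con 2 :+ g) :* (con 2 :+ g)) refl g ⟩
      suc (suc g) * suc (suc g) ∎
      where
      open ≡-Reasoning
      open +-*-Solver using (solve; _:+_; _:*_; _:=_; con)

    range : ℕ → ℕ → List ℕ
    range z zero    = []
    range z (suc k) = z ∷ range (suc z) k

    applyUpTo≡range : ∀ z k → applyUpTo (z +_) k ≡ range z k
    applyUpTo≡range z zero    = refl
    applyUpTo≡range z (suc k) = cong₂ _∷_ (+-identityʳ z)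
      (trans (applyUpTo-cong k (λ i → +-suc z i)) (applyUpTo≡range (suc z) k))
      where
      applyUpTo-cong : ∀ k {f g : ℕ → ℕ} → (∀ i → f i ≡ g i) → applyUpTo f k ≡ applyUpTo g k
      applyUpTo-cong zero    e = refl
      applyUpTo-cong (suc k) e = cong₂ _∷_ (e 0) (applyUpTo-cong k (e ∘ suc))

    squares : List ℕ → ℕ
    squares ys = sum (map (λ s → s * s) ys)

    -- With 0 in the set the gap that wraps around ends at M. Extending `h` to M by `hM` closes it
    -- like any other gap.
    module Listed (M : ℕ) (b : ℕ → Bool) (b≡h : ∀ x → x < M → b x ≡ h x) (hM : h M ≡ true) where

      select : List ℕ → List ℕ
      select = filter (λ x → b x Bool.≟ true)

      select-true : ∀ x ys → b x ≡ true → select (x ∷ ys) ≡ x ∷ select ys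
      select-true x ys e with b x
      select-true x ys refl | true = refl

      select-false : ∀ x ys → b x ≡ false → select (x ∷ ys) ≡ select ys
      select-false x ys e with b x
      select-false x ys refl | false = refl

      -- Invariant of the scan: x is the last element found, the g places after it contained none,
      -- and k places are still to be read.
      squares-gapsFrom : ∀ E k g x → M ≤ E → x + (suc g + k) ≡ M → (∀ j → j < g → h (suc x + j) ≡ false) →
                         squares (gapsFrom M 0 x (select (range (suc x + g) k))) ≡ Σ< (suc g + k) (λ j → weight E (x + j))
      squares-gapsFrom E zero g x M≤E eq z = begin
        (M ∸ x) * (M ∸ x) + 0      ≡⟨ +-identityʳ _ ⟩
        (M ∸ x) * (M ∸ x)          ≡⟨ cong (λ w → w * w) M∸x ⟩
        suc g * suc g              ≡⟨ block g E x g≤E z (trans (cong h sx+g) hM) ⟨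
        Σ< (suc g) (λ j → weight E (x + j)) ≡⟨ cong (λ w → Σ< w (λ j → weight E (x + j))) (+-identityʳ (suc g)) ⟨
        Σ< (suc g + 0) (λ j → weight E (x + j)) ∎
        where
        open ≡-Reasoning
        eq′ : x + suc g ≡ M
        eq′ = trans (cong (x +_) (sym (+-identityʳ (suc g)))) eq
        sx+g : suc x + g ≡ M
        sx+g = trans (sym (+-suc x g)) eq′
        M∸x : M ∸ x ≡ suc g
        M∸x = trans (cong (_∸ x) (sym eq′)) (m+n∸m≡n x (suc g))
        g≤E : g ≤ E
        g≤E = ≤-trans (m≤n+m g (suc x)) (≤-trans (≤-reflexive sx+g) M≤E)
      squares-gapsFrom E (suc k) g x M≤E eq z = byHit (h y) refl
        where
        open ≡-Reasoning
        y = suc x + g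
        y+k : y + (1 + k) ≡ M
        y+k = trans (cong suc (+-assoc x g (suc k))) (trans (sym (+-suc x (g + suc k))) eq)
        y<M : y < M
        y<M = ≤-trans (≤-reflexive (+-comm 1 y)) (≤-trans (+-monoʳ-≤ y (s≤s z≤n)) (≤-reflexive y+k))
        by : b y ≡ h y
        by = b≡h y y<M
        g≤E : g ≤ E
        g≤E = ≤-trans (m≤n+m g (suc x)) (≤-trans (<⇒≤ y<M) M≤E)
        byHit : ∀ v → h y ≡ v → squares (gapsFrom M 0 x (select (y ∷ range (suc y) k))) ≡ Σ< (suc g + suc k) (λ j → weight E (x + j))
        byHit true e = begin
          squares (gapsFrom M 0 x (select (y ∷ range (suc y) k)))
            ≡⟨ cong (squares ∘ gapsFrom M 0 x) (select-true y (range (suc y) k) (trans by e)) ⟩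
          (y ∸ x) * (y ∸ x) + squares (gapsFrom M 0 y (select (range (suc y) k)))
            ≡⟨ cong₂ (λ u w → u * u + squares (gapsFrom M 0 y (select (range w k)))) y∸x (sym (+-identityʳ (suc y))) ⟩
          suc g * suc g + squares (gapsFrom M 0 y (select (range (suc y + 0) k)))
            ≡⟨ cong₂ _+_ (sym (block g E x g≤E z e)) (squares-gapsFrom E k 0 y M≤E y+k (λ _ ())) ⟩
          Σ< (suc g) (λ j → weight E (x + j)) + Σ< (suc k) (λ j → weight E (y + j))
            ≡⟨ cong (Σ< (suc g) (λ j → weight E (x + j)) +_) (Σ-cong (suc k) (λ j _ → cong (weight E) (trans (cong (_+ j) (sym (+-suc x g))) (+-assoc x (suc g) j)))) ⟩
          Σ< (suc g) (λ j → weight E (x + j)) + Σ< (suc k) (λ j → weight E (x + (suc g + j)))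
            ≡⟨ Σ-split (suc g) (suc k) (λ j → weight E (x + j)) ⟨
          Σ< (suc g + suc k) (λ j → weight E (x + j)) ∎
          where
          y∸x : y ∸ x ≡ suc g
          y∸x = trans (cong (_∸ x) (sym (+-suc x g))) (m+n∸m≡n x (suc g))
        byHit false e = begin
          squares (gapsFrom M 0 x (select (y ∷ range (suc y) k)))
            ≡⟨ cong (squares ∘ gapsFrom M 0 x) (select-false y (range (suc y) k) (trans by e)) ⟩
          squares (gapsFrom M 0 x (select (range (suc y) k)))
            ≡⟨ cong (λ w → squares (gapsFrom M 0 x (select (range w k)))) (sym (+-suc (suc x) g)) ⟩
          squares (gapsFrom M 0 x (select (range (suc x + suc g) k)))
            ≡⟨ squares-gapsFrom E k (suc g) x M≤E (trans (cong (λ w → x + suc w) (sym (+-suc g k))) eq) z′ ⟩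
          Σ< (suc (suc g) + k) (λ j → weight E (x + j))
            ≡⟨ cong (λ w → Σ< (suc w) (λ j → weight E (x + j))) (sym (+-suc g k)) ⟩
          Σ< (suc g + suc k) (λ j → weight E (x + j)) ∎
          where
          z′ : ∀ j → j < suc g → h (suc x + j) ≡ false
          z′ j j<1+g with <-≤-connex j g
          ... | inj₁ j<g = z j j<g
          ... | inj₂ g≤j rewrite ≤-antisym (≤-pred j<1+g) g≤j = e

      S≡ : ∀ E → M ≤ E → 0 < M → h 0 ≡ true → S M (select (upTo M)) ≡ M + 2 * Σ< M (len E)
      S≡ E M≤E 0<M h0 = go M refl
        where
        open ≡-Reasoning
        go : ∀ M′ → M′ ≡ M → S M (select (upTo M′)) ≡ M + 2 * Σ< M (len E)
        go zero    e = contradiction e (<⇒≢ 0<M)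
        go (suc M′) e = begin
          S M (select (0 ∷ applyUpTo suc M′))
            ≡⟨ cong (S M ∘ select ∘ (0 ∷_)) (applyUpTo≡range 1 M′) ⟩
          S M (select (0 ∷ range 1 M′))
            ≡⟨ cong (S M) (select-true 0 (range 1 M′) (trans (b≡h 0 0<M) h0)) ⟩
          squares (gapsFrom M 0 0 (select (range 1 M′)))
            ≡⟨ squares-gapsFrom E M′ 0 0 M≤E e (λ _ ()) ⟩
          Σ< (suc M′) (λ j → weight E j)
            ≡⟨ cong (λ w → Σ< w (weight E)) e ⟩
          Σ< M (weight E)
            ≡⟨ Σ-+ M (λ _ → 1) (λ x → 2 * len E x) ⟩
          Σ< M (λ _ → 1) + Σ< M (λ x → 2 * len E x)
            ≡⟨ cong₂ _+_ (trans (Σ-const M 1) (*-identityʳ M)) (Σ-* M 2 (len E)) ⟩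
          M + 2 * Σ< M (len E) ∎

-- Squares modulo A p by the Chinese remainder theorem

module SquaresModAp where

  open import Defs
  open import Data.Bool as Bool using (Bool; true; false; not; _∧_; if_then_else_)
  open import Data.Bool.Properties using (T-≡)
  open import Data.Nat as ℕ using (ℕ; zero; suc; _%_; NonZero)
  import Data.Nat.Properties as ℕₚ
  open import Data.Nat.DivMod
  open import Data.Nat.Divisibility using (_∣_; divides; m∣m*n; n∣m*n; ∣-refl)
  open import Data.Nat.Primality using (Prime)
  open import Data.Nat.Coprimality as Coprimality using (Coprime)
  open import Data.List using (List; []; _∷_; upTo; map)
  open import Data.List.Relation.Unary.Any.Properties using (any⁺; any⁻)
  open import Data.List.Membership.Propositional using (find; lose)
  open import Data.List.Membership.Propositional.Properties using (∈-upTo⁺)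
  open import Data.Product using (_×_; _,_; proj₁; proj₂; ∃)
  open import Data.Sum using (inj₁; inj₂)
  open import Function.Bundles using (Equivalence)
  open import Relation.Binary.PropositionalEquality as ≡ using (_≡_)
  open import Relation.Nullary using (¬_; Dec; yes; does; contradiction)
  open import Relation.Nullary.Decidable using (⌊_⌋; toWitness; fromWitness; dec-true)
  open FiniteSums
  open PrimeFields
  open SignPatterns
  open LongRuns
  open GapSums

  hitM : ℕ → ℕ → Bool
  hitM M x = isSquareMod M (modr M x)

  SqMod : (M : ℕ) .{{_ : NonZero M}} → ℕ → Set
  SqMod M x = ∃ λ a → (a ℕ.* a) % M ≡ x % M

  modr≡% : ∀ M .{{_ : NonZero M}} x → modr M x ≡ x % M
  modr≡% (suc _) x = ≡.refl

  hitM⇒SqMod : ∀ M .{{_ : NonZero M}} x → hitM M x ≡ true → SqMod M x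
  hitM⇒SqMod M x e with find (any⁻ (λ a → ⌊ modr M (a ℕ.* a) ℕ.≟ modr M x ⌋) (upTo M) (Equivalence.from T-≡ e))
  ... | a , _ , t = a , ≡.trans (≡.sym (modr≡% M (a ℕ.* a))) (≡.trans (toWitness t) (modr≡% M x))

  SqMod⇒hitM : ∀ M .{{_ : NonZero M}} x → SqMod M x → hitM M x ≡ true
  SqMod⇒hitM M x (a , e) = Equivalence.to T-≡ (any⁺ (λ a → ⌊ modr M (a ℕ.* a) ℕ.≟ modr M x ⌋)
    (lose (∈-upTo⁺ (m%n<n a M)) (fromWitness {a? = modr M (a % M ℕ.* (a % M)) ℕ.≟ modr M x}
      (≡.trans (modr≡% M _) (≡.trans (≡.sym (%-distribˡ-* a a M)) (≡.trans e (≡.sym (modr≡% M x))))))))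

  Bool-ext : ∀ {a b : Bool} → (a ≡ true → b ≡ true) → (b ≡ true → a ≡ true) → a ≡ b
  Bool-ext {true}  {true}  f g = ≡.refl
  Bool-ext {false} {false} f g = ≡.refl
  Bool-ext {true}  {false} f g = ≡.sym (f ≡.refl)
  Bool-ext {false} {true}  f g = g ≡.refl

  %≡⇒∣ : ∀ m .{{_ : NonZero m}} u v → u ℕ.≤ v → u % m ≡ v % m → m ∣ v ℕ.∸ u
  %≡⇒∣ m u v u≤v e = divides (v ℕ./ m ℕ.∸ u ℕ./ m) (begin
    v ℕ.∸ u                                              ≡⟨ ≡.cong₂ ℕ._∸_ (m≡m%n+[m/n]*n v m) (≡.trans (m≡m%n+[m/n]*n u m) (≡.cong (ℕ._+ u ℕ./ m ℕ.* m) e)) ⟩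
    (v % m ℕ.+ v ℕ./ m ℕ.* m) ℕ.∸ (v % m ℕ.+ u ℕ./ m ℕ.* m) ≡⟨ ℕₚ.[m+n]∸[m+o]≡n∸o (v % m) _ _ ⟩
    v ℕ./ m ℕ.* m ℕ.∸ u ℕ./ m ℕ.* m                      ≡⟨ ℕₚ.*-distribʳ-∸ m (v ℕ./ m) (u ℕ./ m) ⟨
    (v ℕ./ m ℕ.∸ u ℕ./ m) ℕ.* m                          ∎)
    where open ≡.≡-Reasoning

  crt-ordered : ∀ m k .{{_ : NonZero m}} .{{_ : NonZero k}} .{{_ : NonZero (m ℕ.* k)}} → Coprime m k → ∀ u v → u ℕ.≤ v →
                u % m ≡ v % m → u % k ≡ v % k → u % (m ℕ.* k) ≡ v % (m ℕ.* k)
  crt-ordered m k cop u v u≤v e e′ with %≡⇒∣ m u v u≤v e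
  ... | divides q eq with Coprimality.coprime-divisor (Coprimality.sym cop) (≡.subst (k ∣_) (≡.trans eq (ℕₚ.*-comm q m)) (%≡⇒∣ k u v u≤v e′))
  ...   | divides q′ eq′ = ≡.sym (≡.trans (≡.cong (_% (m ℕ.* k)) v≡) ([m+kn]%n≡m%n u q′ (m ℕ.* k)))
    where
    v≡ : v ≡ u ℕ.+ q′ ℕ.* (m ℕ.* k)
    v≡ = ≡.trans (≡.sym (ℕₚ.m+[n∸m]≡n u≤v)) (≡.cong (u ℕ.+_)
      (≡.trans eq (≡.trans (≡.cong (ℕ._* m) eq′) (≡.trans (ℕₚ.*-assoc q′ k m) (≡.cong (q′ ℕ.*_) (ℕₚ.*-comm k m))))))

  crt-unique : ∀ m k .{{_ : NonZero m}} .{{_ : NonZero k}} .{{_ : NonZero (m ℕ.* k)}} → Coprime m k → ∀ u v →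
               u % m ≡ v % m → u % k ≡ v % k → u % (m ℕ.* k) ≡ v % (m ℕ.* k)
  crt-unique m k cop u v e e′ with ℕₚ.≤-total u v
  ... | inj₁ u≤v = crt-ordered m k cop u v u≤v e e′
  ... | inj₂ v≤u = ≡.sym (crt-ordered m k cop v u v≤u (≡.sym e) (≡.sym e′))

  cands : ℕ → ℕ → ℕ → List ℕ
  cands A i zero    = []
  cands A i (suc d) = if hitM A (suc i) then suc i ∷ cands A (suc i) d else cands A (suc i) d

  Σ-grid : ∀ A k h → Σ< (k ℕ.* A) h ≡ Σ< A (λ i → Σ< k (λ t → h (i ℕ.+ t ℕ.* A)))
  Σ-grid A k h = ≡.trans (rows k h) (Σ-swap k A (λ t i → h (i ℕ.+ t ℕ.* A)))
    where
    rows : ∀ k h → Σ< (k ℕ.* A) h ≡ Σ< k (λ t → Σ< A (λ i → h (i ℕ.+ t ℕ.* A)))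
    rows zero    h = ≡.refl
    rows (suc k) h = ≡.trans (Σ-split A (k ℕ.* A) h) (≡.cong₂ ℕ._+_
      (Σ-cong A (λ i _ → ≡.cong h (≡.sym (ℕₚ.+-identityʳ i))))
      (≡.trans (rows k (λ x → h (A ℕ.+ x))) (Σ-cong k (λ t _ → Σ-cong A (λ i _ → ≡.cong h (shuffle i (t ℕ.* A)))))))
      where
      shuffle : ∀ i z → A ℕ.+ (i ℕ.+ z) ≡ i ℕ.+ (A ℕ.+ z)
      shuffle i z = ≡.trans (≡.sym (ℕₚ.+-assoc A i z)) (≡.trans (≡.cong (ℕ._+ z) (ℕₚ.+-comm A i)) (ℕₚ.+-assoc i A z))

  module Reduction (n : ℕ) (1≤n : 1 ℕ.≤ n) (pr : Prime (suc (n ℕ.+ n)))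
    (A : ℕ) (1≤A : 1 ℕ.≤ A) (cop : Coprime A (suc (n ℕ.+ n))) where

    open PrimeField n 1≤n pr
    open Patterns n 1≤n pr
    open Runs n 1≤n pr
    import Relation.Binary.Reasoning.Setoid setoid as R

    instance
      A≢0 : NonZero A
      A≢0 = ℕ.>-nonZero 1≤A
      Ap≢0 : NonZero (A ℕ.* p)
      Ap≢0 = ℕₚ.m*n≢0 A p

    A≉0 : ¬ (A ≈ 0)
    A≉0 e = ℕₚ.<⇒≢ (ℕₚ.<-trans ℕₚ.≤-refl 2<p) (≡.sym (cop (≈0⇒∣ e , ∣-refl)))

    A⁻¹ : ℕ
    A⁻¹ = proj₁ (inverse A A≉0)

    crt-exists : ∀ a₁ a₂ → ∃ λ a → a % A ≡ a₁ % A × a ≈ a₂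
    crt-exists a₁ a₂ = a₁ ℕ.+ k ℕ.* A , [m+kn]%n≡m%n a₁ k A , (begin
      a₁ + k * A                          ≈⟨ +-congˡ {a₁} (trans (*-comm k A) (trans (sym (*-assoc A A⁻¹ (- a₁ + a₂))) (*-congʳ { - a₁ + a₂} (proj₂ (inverse A A≉0))))) ⟩
      a₁ + 1 * (- a₁ + a₂)                ≈⟨ +-congˡ {a₁} (*-identityˡ (- a₁ + a₂)) ⟩
      a₁ + (- a₁ + a₂)                    ≈⟨ +-assoc a₁ (- a₁) a₂ ⟨
      a₁ + - a₁ + a₂                      ≈⟨ +-congʳ {a₂} (-‿inverseʳ a₁) ⟩
      0 + a₂                              ≈⟨ +-identityˡ a₂ ⟩
      a₂                                  ∎)
      where
      open R
      k = A⁻¹ * (- a₁ + a₂)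

    hit-crt : ∀ x → hitM (A ℕ.* p) x ≡ hitM A x ∧ hitM p x
    hit-crt x = Bool-ext to from
      where
      %A : ∀ z → z % (A ℕ.* p) % A ≡ z % A
      %A z = m∣n⇒o%n%m≡o%m A (A ℕ.* p) z (m∣m*n p)
      %p : ∀ z → z % (A ℕ.* p) % p ≡ z % p
      %p z = m∣n⇒o%n%m≡o%m p (A ℕ.* p) z (n∣m*n A)
      to : hitM (A ℕ.* p) x ≡ true → hitM A x ∧ hitM p x ≡ true
      to e with hitM⇒SqMod (A ℕ.* p) x e
      ... | a , eq = ≡.cong₂ _∧_
        (SqMod⇒hitM A x (a , ≡.trans (≡.sym (%A (a ℕ.* a))) (≡.trans (≡.cong (_% A) eq) (%A x))))
        (SqMod⇒hitM p x (a , ≡.trans (≡.sym (%p (a ℕ.* a))) (≡.trans (≡.cong (_% p) eq) (%p x))))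
      ∧-split : ∀ {u v} → u ∧ v ≡ true → u ≡ true × v ≡ true
      ∧-split {true} {true} _ = ≡.refl , ≡.refl
      from : hitM A x ∧ hitM p x ≡ true → hitM (A ℕ.* p) x ≡ true
      from e = glue (hitM⇒SqMod A x (proj₁ (∧-split e))) (hitM⇒SqMod p x (proj₂ (∧-split {hitM A x} e)))
        where
        glue : SqMod A x → SqMod p x → hitM (A ℕ.* p) x ≡ true
        glue (a₁ , e₁) (a₂ , e₂) with crt-exists a₁ a₂
        ... | a , eA , ep = SqMod⇒hitM (A ℕ.* p) x (a , crt-unique A p cop (a ℕ.* a) x
                (≡.trans (%-distribˡ-* a a A) (≡.trans (≡.cong (λ z → (z ℕ.* z) % A) eA) (≡.trans (≡.sym (%-distribˡ-* a₁ a₁ A)) e₁)))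
                (≡.trans (residue (*-cong ep ep)) e₂))

    hit-shift : ∀ i t → hitM A (i ℕ.+ t ℕ.* A) ≡ hitM A i
    hit-shift i t = ≡.cong (isSquareMod A) (≡.trans (modr≡% A (i ℕ.+ t ℕ.* A)) (≡.trans ([m+kn]%n≡m%n i t A) (≡.sym (modr≡% A i))))

    τ : ℕ
    τ = -1ₚ * A ^ n

    τ-sign : IsSign τ
    τ-sign = sign-* (inj₂ refl) (half-power A A≉0)

    -- b + tA is a nonresidue iff (t + b A⁻¹)^n = -A^n.
    miss-hit : ∀ b t → not (hitM p (b ℕ.+ t ℕ.* A)) ≡ hit τ (b ℕ.* A⁻¹) t
    miss-hit b t = Bool-ext to from
      where
      open R
      A^n = A ^ n
      y = (t + b * A⁻¹) ^ n
      x = b ℕ.+ t ℕ.* A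
      x^n : x ^ n ≈ A^n * y
      x^n = begin
        x ^ n                          ≈⟨ ^-congˡ n (begin
          b + t * A                      ≈⟨ +-cong (sym (*-identityʳ b)) (*-comm t A) ⟩
          b * 1 + A * t                  ≈⟨ +-congʳ {A * t} (*-congˡ {b} (sym (proj₂ (inverse A A≉0)))) ⟩
          b * (A * A⁻¹) + A * t          ≈⟨ reflexive (shuffle b A A⁻¹ t) ⟩
          A * (t + b * A⁻¹)              ∎) ⟩
        (A * (t + b * A⁻¹)) ^ n        ≈⟨ ^-distrib-* A (t + b * A⁻¹) n ⟩
        A^n * y                        ∎
        where
        shuffle : ∀ b a a′ t → b ℕ.* (a ℕ.* a′) ℕ.+ a ℕ.* t ≡ a ℕ.* (t ℕ.+ b ℕ.* a′)
        shuffle = solve 4 (λ b a a′ t → b :* (a :* a′) :+ a :* t := a :* (t :+ b :* a′)) ≡.refl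
          where
          open import Data.Nat.Solver using (module +-*-Solver)
          open +-*-Solver
      sq : A^n * A^n ≈ 1
      sq = sign-square (half-power A A≉0)
      not-true : ∀ {v} → not v ≡ true → ¬ (v ≡ true)
      not-true {false} _ ()
      to : not (hitM p x) ≡ true → hit τ (b ℕ.* A⁻¹) t ≡ true
      to e = dec-true (y ≟ₚ τ) (begin
        y                   ≈⟨ *-identityˡ y ⟨
        1 * y               ≈⟨ *-congʳ {y} sq ⟨
        A^n * A^n * y       ≈⟨ *-assoc A^n A^n y ⟩
        A^n * (A^n * y)     ≈⟨ *-congˡ {A^n} x^n ⟨
        A^n * x ^ n         ≈⟨ *-congˡ {A^n} (nonsquare-power (λ (a , eq) → not-true e (SqMod⇒hitM p x (a , residue eq)))) ⟩
        A^n * -1ₚ           ≈⟨ *-comm A^n -1ₚ ⟩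
        τ                   ∎)
      from : hit τ (b ℕ.* A⁻¹) t ≡ true → not (hitM p x) ≡ true
      from e = byHit (hitM p x) ≡.refl
        where
        y≈τ : y ≈ τ
        y≈τ = byDec (y ≟ₚ τ) e
          where
          byDec : (d : Dec (y ≈ τ)) → does d ≡ true → y ≈ τ
          byDec (yes h) _ = h
        byHit : ∀ v → hitM p x ≡ v → not (hitM p x) ≡ true
        byHit false e′ = ≡.cong not e′
        byHit true  e′ = contradiction (begin
          x ^ n               ≈⟨ x^n ⟩
          A^n * y             ≈⟨ *-congˡ {A^n} y≈τ ⟩
          A^n * (-1ₚ * A^n)   ≈⟨ *-comm A^n (-1ₚ * A^n) ⟩
          -1ₚ * A^n * A^n     ≈⟨ *-assoc -1ₚ A^n A^n ⟩
          -1ₚ * (A^n * A^n)   ≈⟨ *-congˡ { -1ₚ} sq ⟩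
          -1ₚ * 1             ≈⟨ *-identityʳ -1ₚ ⟩
          -1ₚ                 ∎) (square-power (squareOf (hitM⇒SqMod p x e′)))
          where
          squareOf : SqMod p x → IsSquare x
          squareOf (a , eq) = a , mk≈ eq

    -- Modulo p one has b + t A = A (t + b A⁻¹), so division by A makes the linear forms in t monic
    -- with these constant terms.
    shifts : ℕ → ℕ → List ℕ
    shifts i d = map (ℕ._* A⁻¹) (cands A i d)

    -- A place that is no square mod A is no square mod A p, whatever t is, and imposes no
    -- condition; any other place must be a nonsquare mod p.
    miss-pat : ∀ i t d → miss (hitM (A ℕ.* p)) (i ℕ.+ t ℕ.* A) d ≡ pat τ (shifts i d) t
    miss-pat i t zero    = ≡.refl
    miss-pat i t (suc d) = ≡.trans (≡.cong₂ _∧_ (≡.cong not (≡.trans (hit-crt (suc (i ℕ.+ t ℕ.* A))) (≡.cong (_∧ hitM p (suc i ℕ.+ t ℕ.* A)) (hit-shift (suc i) t)))) (miss-pat (suc i) t d))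
      (byCand (hitM A (suc i)))
      where
      byCand : ∀ v → not (v ∧ hitM p (suc i ℕ.+ t ℕ.* A)) ∧ pat τ (shifts (suc i) d) t
               ≡ pat τ (map (ℕ._* A⁻¹) (if v then suc i ∷ cands A (suc i) d else cands A (suc i) d)) t
      byCand true  = ≡.cong (_∧ pat τ (shifts (suc i) d) t) (miss-hit (suc i) t)
      byCand false = ≡.refl

    N : ℕ → ℕ → ℕ
    N i d = patCount τ (shifts i d)

    total-misses : ∀ d → count (A ℕ.* p) (λ x → miss (hitM (A ℕ.* p)) x d) ≡ Σ< A (λ i → N i d)
    total-misses d = ≡.trans (≡.cong (λ k → count k (λ x → miss (hitM (A ℕ.* p)) x d)) (ℕₚ.*-comm A p))
      (≡.trans (Σ-grid A p (λ x → ⟦ miss (hitM (A ℕ.* p)) x d ⟧))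
        (Σ-cong A (λ i _ → Σ-cong p (λ t _ → ≡.cong ⟦_⟧ (miss-pat i t d)))))

-- Uniform estimates of the counts and summation over interval lengths

module GapAsymptotics where

  open import Defs
  open import Data.Bool as Bool using (Bool; true; false; _∧_; if_then_else_)
  open import Data.Nat as ℕ using (ℕ; zero; suc; _%_; NonZero)
  import Data.Nat.Properties as ℕₚ
  open import Data.Nat.DivMod
  open import Data.Nat.Primality using (Prime)
  open import Data.Nat.Coprimality using (Coprime)
  open import Data.Nat.Solver using (module +-*-Solver)
  open import Data.List using ([]; _∷_; length; map; take; _++_)
  open import Data.List.Properties using (length-map; length-++; map-++; length-take)
  open import Data.List.Relation.Unary.All as All using (All; []; _∷_)
  import Data.List.Relation.Unary.All.Properties as Allₚ
  open import Data.List.Relation.Unary.AllPairs using (AllPairs; []; _∷_)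
  import Data.List.Relation.Unary.AllPairs as AllPairs
  import Data.List.Relation.Unary.AllPairs.Properties as AllPairsₚ
  open import Data.Product using (_×_; _,_; proj₁; proj₂)
  open import Data.Sum using (inj₁; inj₂)
  open import Function using (id)
  open import Relation.Binary.PropositionalEquality as ≡ using (_≡_)
  open import Relation.Nullary using (¬_; Dec; yes; does; contradiction)
  open FiniteSums
  open PrimeFields
  open SignPatterns
  open LongRuns
  open GapSums
  open SquaresModAp

  Σ-period : ∀ A h → (∀ x → h (x ℕ.+ A) ≡ h x) → ∀ i → Σ< A (λ j → h (i ℕ.+ j)) ≡ Σ< A h
  Σ-period A h per zero    = ≡.refl
  Σ-period A h per (suc i) = ≡.trans (ℕₚ.+-cancelˡ-≡ (h i) _ _ (begin
    h i ℕ.+ Σ< A (λ j → h (suc i ℕ.+ j))           ≡⟨ ≡.cong₂ ℕ._+_ (≡.cong h (≡.sym (ℕₚ.+-identityʳ i))) (Σ-cong A (λ j _ → ≡.cong h (≡.sym (ℕₚ.+-suc i j)))) ⟩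
    Σ< (suc A) (λ j → h (i ℕ.+ j))                 ≡⟨ Σ-last A (λ j → h (i ℕ.+ j)) ⟩
    Σ< A (λ j → h (i ℕ.+ j)) ℕ.+ h (i ℕ.+ A)       ≡⟨ ≡.cong (Σ< A (λ j → h (i ℕ.+ j)) ℕ.+_) (per i) ⟩
    Σ< A (λ j → h (i ℕ.+ j)) ℕ.+ h i               ≡⟨ ℕₚ.+-comm _ (h i) ⟩
    h i ℕ.+ Σ< A (λ j → h (i ℕ.+ j))               ∎)) (Σ-period A h per i)
    where open ≡.≡-Reasoning

  hitM-0 : ∀ A .{{_ : NonZero A}} j → hitM A (A ℕ.* j) ≡ true
  hitM-0 A j = SqMod⇒hitM A (A ℕ.* j) (0 , ≡.trans (m<n⇒m%n≡m (ℕ.>-nonZero⁻¹ A)) (≡.sym (≡.trans (≡.cong (_% A) (ℕₚ.*-comm A j)) (m*n%n≡0 j A))))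

  hitM-period : ∀ A .{{_ : NonZero A}} x → hitM A (x ℕ.+ A) ≡ hitM A x
  hitM-period A x = ≡.cong (isSquareMod A) (≡.trans (modr≡% A (x ℕ.+ A)) (≡.trans ([m+n]%n≡m%n x A) (≡.sym (modr≡% A x))))

  hitM-< : ∀ A x → x ℕ.< A → hitM A x ≡ isSquareMod A x
  hitM-< A@(suc _) x x<A = ≡.cong (isSquareMod A) (m<n⇒m%n≡m x<A)

  module Candidates (A : ℕ) (1≤A : 1 ℕ.≤ A) where

    private instance
      A≢0 : NonZero A
      A≢0 = ℕ.>-nonZero 1≤A

    w : ℕ → ℕ → ℕ
    w i d = length (cands A i d)

    w≡Σ : ∀ i d → w i d ≡ count d (λ j → hitM A (suc i ℕ.+ j))
    w≡Σ i zero    = ≡.refl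
    w≡Σ i (suc d) = ≡.trans (byHit (hitM A (suc i))) (≡.cong₂ ℕ._+_ (≡.cong (λ z → ⟦ hitM A (suc z) ⟧) (≡.sym (ℕₚ.+-identityʳ i)))
        (≡.trans (w≡Σ (suc i) d) (Σ-cong d (λ j _ → ≡.cong (λ z → ⟦ hitM A (suc z) ⟧) (≡.sym (ℕₚ.+-suc i j))))))
      where
      byHit : ∀ v → length (if v then suc i ∷ cands A (suc i) d else cands A (suc i) d) ≡ ⟦ v ⟧ ℕ.+ w (suc i) d
      byHit true  = ≡.refl
      byHit false = ≡.refl

    r≡count : r A ≡ count A (hitM A)
    r≡count = ≡.trans (length-filter (λ x → isSquareMod A x Bool.≟ true) id A) (Σ-cong A (λ x x<A →
      ≡.cong ⟦_⟧ (≡.trans (does-≟ (isSquareMod A x)) (≡.sym (hitM-< A x x<A)))))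
      where
      does-≟ : ∀ v → does (v Bool.≟ true) ≡ v
      does-≟ true  = ≡.refl
      does-≟ false = ≡.refl

    w-A : ∀ i → w i A ≡ r A
    w-A i = ≡.trans (w≡Σ i A) (≡.trans (Σ-period A (λ x → ⟦ hitM A x ⟧) (λ x → ≡.cong ⟦_⟧ (hitM-period A x)) (suc i)) (≡.sym r≡count))

    cands-++ : ∀ i d d′ → cands A i (d ℕ.+ d′) ≡ cands A i d ++ cands A (i ℕ.+ d) d′
    cands-++ i zero    d′ = ≡.cong (λ z → cands A z d′) (≡.sym (ℕₚ.+-identityʳ i))
    cands-++ i (suc d) d′ = byHit (hitM A (suc i))
      where
      tail≡ : cands A (suc i) (d ℕ.+ d′) ≡ cands A (suc i) d ++ cands A (i ℕ.+ suc d) d′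
      tail≡ = ≡.trans (cands-++ (suc i) d d′) (≡.cong (λ z → cands A (suc i) d ++ cands A z d′) (≡.sym (ℕₚ.+-suc i d)))
      byHit : ∀ v → (if v then suc i ∷ cands A (suc i) (d ℕ.+ d′) else cands A (suc i) (d ℕ.+ d′))
              ≡ (if v then suc i ∷ cands A (suc i) d else cands A (suc i) d) ++ cands A (i ℕ.+ suc d) d′
      byHit true  = ≡.cong (suc i ∷_) tail≡
      byHit false = tail≡

    w-+ : ∀ i d d′ → w i (d ℕ.+ d′) ≡ w i d ℕ.+ w (i ℕ.+ d) d′
    w-+ i d d′ = ≡.trans (≡.cong length (cands-++ i d d′)) (length-++ (cands A i d))

    w-+A : ∀ i d → w i (A ℕ.+ d) ≡ r A ℕ.+ w i d
    w-+A i d = ≡.trans (≡.cong (w i) (ℕₚ.+-comm A d)) (≡.trans (w-+ i d A) (≡.trans (≡.cong (w i d ℕ.+_) (w-A (i ℕ.+ d))) (ℕₚ.+-comm (w i d) (r A))))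

    w-mono : ∀ i {d d′} → d ℕ.≤ d′ → w i d ℕ.≤ w i d′
    w-mono i {d} {d′} le = ≡.subst (λ z → w i d ℕ.≤ w i z) (ℕₚ.m+[n∸m]≡n le)
      (≡.subst (w i d ℕ.≤_) (≡.sym (w-+ i d (d′ ℕ.∸ d))) (ℕₚ.m≤m+n _ _))

    1≤r : 1 ℕ.≤ r A
    1≤r = ≡.subst (1 ℕ.≤_) (≡.sym r≡count) (ℕₚ.≤-trans
      (ℕₚ.≤-reflexive (≡.cong ⟦_⟧ (≡.sym (≡.trans (≡.cong (hitM A) (≡.sym (ℕₚ.*-zeroʳ A))) (hitM-0 A 0)))))
      (term≤Σ A (λ x → ⟦ hitM A x ⟧) 0 1≤A))

    w-Ak : ∀ i k → k ℕ.≤ w i (k ℕ.* A)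
    w-Ak i zero    = ℕ.z≤n
    w-Ak i (suc k) = ≡.subst (suc k ℕ.≤_) (≡.sym (w-+A i (k ℕ.* A))) (ℕₚ.+-mono-≤ 1≤r (w-Ak i k))

    cands-range : ∀ i d → All (λ b → i ℕ.< b × b ℕ.≤ i ℕ.+ d) (cands A i d)
    cands-range i zero    = []
    cands-range i (suc d) = byHit (hitM A (suc i))
      where
      rest : All (λ b → i ℕ.< b × b ℕ.≤ i ℕ.+ suc d) (cands A (suc i) d)
      rest = All.map (λ (lt , le) → ℕₚ.<-trans (ℕₚ.n<1+n i) lt , ℕₚ.≤-trans le (ℕₚ.≤-reflexive (≡.sym (ℕₚ.+-suc i d)))) (cands-range (suc i) d)
      byHit : ∀ v → All (λ b → i ℕ.< b × b ℕ.≤ i ℕ.+ suc d) (if v then suc i ∷ cands A (suc i) d else cands A (suc i) d)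
      byHit true  = (ℕₚ.≤-refl , ℕₚ.≤-trans (ℕ.s≤s (ℕₚ.m≤m+n i d)) (ℕₚ.≤-reflexive (≡.sym (ℕₚ.+-suc i d)))) ∷ rest
      byHit false = rest

    cands-sorted : ∀ i d → AllPairs ℕ._<_ (cands A i d)
    cands-sorted i zero    = []
    cands-sorted i (suc d) = byHit (hitM A (suc i))
      where
      byHit : ∀ v → AllPairs ℕ._<_ (if v then suc i ∷ cands A (suc i) d else cands A (suc i) d)
      byHit true  = All.map proj₁ (cands-range (suc i) d) ∷ cands-sorted (suc i) d
      byHit false = cands-sorted (suc i) d

  module Counting (n : ℕ) (1≤n : 1 ℕ.≤ n) (pr : Prime (suc (n ℕ.+ n)))
    (A : ℕ) (1≤A : 1 ℕ.≤ A) (cop : Coprime A (suc (n ℕ.+ n))) where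

    open PrimeField n 1≤n pr
    open Patterns n 1≤n pr
    open Reduction n 1≤n pr A 1≤A cop
    open Candidates A 1≤A

    pat-++ : ∀ L L′ t → ⟦ pat τ (L ++ L′) t ⟧ ℕ.≤ ⟦ pat τ L t ⟧
    pat-++ []      L′ t = ⟦⟧≤1 (pat τ L′ t)
    pat-++ (a ∷ L) L′ t = byHit (hit τ a t)
      where
      byHit : ∀ v → ⟦ v ∧ pat τ (L ++ L′) t ⟧ ℕ.≤ ⟦ v ∧ pat τ L t ⟧
      byHit true  = pat-++ L L′ t
      byHit false = ℕ.z≤n

    patCount-++ : ∀ L L′ → patCount τ (L ++ L′) ℕ.≤ patCount τ L
    patCount-++ L L′ = Σ-mono p (λ t _ → pat-++ L L′ t)

    N-mono : ∀ i {d d′} → d ℕ.≤ d′ → N i d′ ℕ.≤ N i d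
    N-mono i {d} {d′} le = ≡.subst (λ z → N i z ℕ.≤ N i d) (ℕₚ.m+[n∸m]≡n le)
      (≡.subst (λ L → patCount τ L ℕ.≤ N i d)
        (≡.sym (≡.trans (≡.cong (map (ℕ._* A⁻¹)) (cands-++ i d (d′ ℕ.∸ d))) (map-++ (ℕ._* A⁻¹) (cands A i d) _)))
        (patCount-++ (shifts i d) _))

    A⁻¹≉0 : ¬ (A⁻¹ ≈ 0)
    A⁻¹≉0 e = 1≉0 (trans (sym (proj₂ (inverse A A≉0))) (trans (*-congˡ {A} e) (zeroʳ A)))
      where open Runs n 1≤n pr using (inverse)

    shifts-ok : ∀ i d → i ℕ.+ d ℕ.< p → Shifts (shifts i d)
    shifts-ok i d i+d<p =
      AllPairsₚ.map⁺ (distinct (cands A i d) (cands-sorted i d) (cands-range i d)) ,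
      Allₚ.map⁺ (All.map (λ {b} (lt , le) e → <⇒≉0 (ℕₚ.≤-<-trans ℕ.z≤n lt) (ℕₚ.≤-<-trans le i+d<p)
        (cancel A⁻¹≉0 (trans (*-comm A⁻¹ b) e))) (cands-range i d))
      where
      distinct : ∀ bs → AllPairs ℕ._<_ bs → All (λ b → i ℕ.< b × b ℕ.≤ i ℕ.+ d) bs →
                 AllPairs (λ a b → ¬ (b ℕ.* A⁻¹ ≈ a ℕ.* A⁻¹)) bs
      distinct []       []         []                = []
      distinct (a ∷ bs) (a< ∷ bs<) ((_ , a≤) ∷ rngs) =
        All.zipWith (λ {b} (a<b , (_ , b≤)) e → ℕₚ.<⇒≢ a<b (≡.sym (<⇒≡ (ℕₚ.≤-<-trans b≤ i+d<p) (ℕₚ.≤-<-trans a≤ i+d<p)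
          (*-cancelₚ A⁻¹≉0 (trans (*-comm A⁻¹ b) (trans e (*-comm a A⁻¹))))))) (a< , rngs)
        ∷ distinct bs bs< rngs

    length-shifts : ∀ i d → length (shifts i d) ≡ w i d
    length-shifts i d = length-map (ℕ._* A⁻¹) (cands A i d)

    Shifts-take : ∀ k L → Shifts L → Shifts (take k L)
    Shifts-take k L (d , z) = AllPairsₚ.take⁺ k d , Allₚ.take⁺ k z

    pat-cand : ∀ i d b t → pat τ (shifts i d) t ≡ true → hitM A b ≡ true → i ℕ.< b → b ℕ.≤ i ℕ.+ d →
               hit τ (b ℕ.* A⁻¹) t ≡ true
    pat-cand i zero    b t e hb i<b b≤ = contradiction (ℕₚ.<-≤-trans i<b (≡.subst (b ℕ.≤_) (ℕₚ.+-identityʳ i) b≤)) (ℕₚ.n≮n i)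
    pat-cand i (suc d) b t e hb i<b b≤ = byHit (hitM A (suc i)) ≡.refl e
      where
      L = cands A (suc i) d
      ∧₁ : ∀ {x y} → x ∧ y ≡ true → x ≡ true
      ∧₁ {true} _ = ≡.refl
      ∧₂ : ∀ {x y} → x ∧ y ≡ true → y ≡ true
      ∧₂ {true} h = h
      later : pat τ (shifts (suc i) d) t ≡ true → suc i ℕ.< b → hit τ (b ℕ.* A⁻¹) t ≡ true
      later e′ lt = pat-cand (suc i) d b t e′ hb lt (ℕₚ.≤-trans b≤ (ℕₚ.≤-reflexive (ℕₚ.+-suc i d)))
      byHit : ∀ v → hitM A (suc i) ≡ v → pat τ (map (ℕ._* A⁻¹) (if v then suc i ∷ L else L)) t ≡ true → hit τ (b ℕ.* A⁻¹) t ≡ true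
      byHit true he e′ with ℕₚ.m≤n⇒m<n∨m≡n i<b
      ... | inj₁ lt     = later (∧₂ {hit τ (suc i ℕ.* A⁻¹) t} e′) lt
      ... | inj₂ ≡.refl = ∧₁ e′
      byHit false he e′ with ℕₚ.m≤n⇒m<n∨m≡n i<b
      ... | inj₁ lt     = later e′ lt
      ... | inj₂ ≡.refl = contradiction (≡.trans (≡.sym hb) he) (λ ())

    -- k is the largest number of forms for which patterns are counted, b the error, and runs of
    -- sign τ are shorter than H. By `pk` the main term p / 2^k is within the error, and `Ak` keeps
    -- k periods of places below p, where distinct places give distinct forms.
    module Bounds (k b H : ℕ)
      (pats : ∀ L → Shifts L → length L ℕ.≤ k → Near (2 ℕ.^ length L ℕ.* patCount τ L) p (2 ℕ.^ length L ℕ.* b))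
      (pk : p ℕ.≤ 2 ℕ.^ k ℕ.* b) (Ak : A ℕ.* suc k ℕ.≤ p)
      (noRun : ∀ c → ¬ (∀ h → h ℕ.< H → (c + h) ^ n ≈ τ)) where

      E : ℕ
      E = 2 ℕ.* b

      2^>0 : ∀ x → 0 ℕ.< 2 ℕ.^ x
      2^>0 x = ℕₚ.m^n>0 2 x

      in-range : ∀ i d → i ℕ.< A → d ℕ.≤ k ℕ.* A → i ℕ.+ d ℕ.< p
      in-range i d i<A d≤ = ℕₚ.<-≤-trans (ℕₚ.+-mono-<-≤ i<A d≤) (ℕₚ.≤-trans (ℕₚ.≤-reflexive (ℕₚ.*-comm (suc k) A)) Ak)

      N-small : ∀ i d → i ℕ.< A → d ℕ.≤ k ℕ.* A → k ℕ.≤ w i d → N i d ℕ.≤ E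
      N-small i d i<A d≤ k≤w = ℕₚ.*-cancelˡ-≤ (2 ℕ.^ k) {{ℕ.>-nonZero (2^>0 k)}} (begin
        2 ℕ.^ k ℕ.* N i d              ≤⟨ ℕₚ.*-monoʳ-≤ (2 ℕ.^ k) (≡.subst (λ L → patCount τ L ℕ.≤ patCount τ L′) (take++drop≡id k L) (patCount-++ L′ (drop k L))) ⟩
        2 ℕ.^ k ℕ.* patCount τ L′      ≤⟨ proj₁ (≡.subst (λ z → Near (2 ℕ.^ z ℕ.* patCount τ L′) p (2 ℕ.^ z ℕ.* b)) len (pats L′ (Shifts-take k L (shifts-ok i d (in-range i d i<A d≤))) (ℕₚ.≤-reflexive len))) ⟩
        p ℕ.+ 2 ℕ.^ k ℕ.* b            ≤⟨ ℕₚ.+-monoˡ-≤ (2 ℕ.^ k ℕ.* b) pk ⟩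
        2 ℕ.^ k ℕ.* b ℕ.+ 2 ℕ.^ k ℕ.* b ≡⟨ solve 2 (λ x b → x :* b :+ x :* b := x :* (con 2 :* b)) ≡.refl (2 ℕ.^ k) b ⟩
        2 ℕ.^ k ℕ.* E                  ∎)
        where
        open ℕₚ.≤-Reasoning
        open +-*-Solver using (solve; _:+_; _:*_; _:=_; con)
        open import Data.List using (drop)
        open import Data.List.Properties using (take++drop≡id)
        L = shifts i d
        L′ = take k L
        len : length L′ ≡ k
        len = ≡.trans (length-take k L) (ℕₚ.m≤n⇒m⊓n≡m (≡.subst (k ℕ.≤_) (≡.sym (length-shifts i d)) k≤w))

      small⇒near : ∀ x N → k ℕ.≤ x → N ℕ.≤ E → Near (2 ℕ.^ x ℕ.* N) p (2 ℕ.^ x ℕ.* E)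
      small⇒near x N k≤x N≤E =
        ℕₚ.≤-trans (ℕₚ.*-monoʳ-≤ (2 ℕ.^ x) N≤E) (ℕₚ.m≤n+m _ p) ,
        ℕₚ.≤-trans pk (ℕₚ.≤-trans (ℕₚ.*-mono-≤ (ℕₚ.^-monoʳ-≤ 2 k≤x) (ℕₚ.m≤m+n b _)) (ℕₚ.m≤n+m _ (2 ℕ.^ x ℕ.* N)))

      -- With at most k forms this is `pats`. With more, the first k already bring N below 2 b, and
      -- p / 2^w is at most b, so the estimate is trivial. Beyond k A, where places may coincide mod
      -- p, monotonicity in d is used.
      N-near : ∀ i d → i ℕ.< A → Near (2 ℕ.^ w i d ℕ.* N i d) p (2 ℕ.^ w i d ℕ.* E)
      N-near i d i<A with ℕₚ.≤-total d (k ℕ.* A)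
      ... | inj₂ kA≤d = small⇒near (w i d) (N i d) (ℕₚ.≤-trans (w-Ak i k) (w-mono i kA≤d))
              (ℕₚ.≤-trans (N-mono i kA≤d) (N-small i (k ℕ.* A) i<A ℕₚ.≤-refl (w-Ak i k)))
      ... | inj₁ d≤kA with ℕₚ.≤-total k (w i d)
      ...   | inj₁ k≤w = small⇒near (w i d) (N i d) k≤w (N-small i d i<A d≤kA k≤w)
      ...   | inj₂ w≤k = near-weaken (ℕₚ.*-monoʳ-≤ (2 ℕ.^ w i d) (ℕₚ.m≤m+n b _))
                (≡.subst (λ z → Near (2 ℕ.^ z ℕ.* N i d) p (2 ℕ.^ z ℕ.* b)) (length-shifts i d)
                  (pats (shifts i d) (shifts-ok i d (in-range i d i<A d≤kA)) (≡.subst (ℕ._≤ k) (≡.sym (length-shifts i d)) w≤k)))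

      -- Multiples of A are squares mod A, and the shift belonging to A (h + 1) is h + 1 mod p. So a
      -- t counted here would start a run of H equal signs.
      N-zero : ∀ i d → i ℕ.< A → A ℕ.* H ℕ.≤ d → N i d ≡ 0
      N-zero i d i<A AH≤d = Σ-zero p (λ t _ → byPat t (pat τ (shifts i d) t) ≡.refl)
        where
        byPat : ∀ t v → pat τ (shifts i d) t ≡ v → ⟦ pat τ (shifts i d) t ⟧ ≡ 0
        byPat t false e = ≡.cong ⟦_⟧ e
        byPat t true  e = contradiction run (noRun (suc t))
          where
          open import Relation.Binary.Reasoning.Setoid setoid
          open Runs n 1≤n pr using (inverse)
          byDec : ∀ {x y} (d : Dec (x ≈ y)) → does d ≡ true → x ≈ y
          byDec (yes h) _ = h
          run : ∀ h → h ℕ.< H → (suc t + h) ^ n ≈ τ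
          run h h<H = begin
            (suc t + h) ^ n                    ≡⟨ ≡.cong (_^ n) (≡.sym (ℕₚ.+-suc t h)) ⟩
            (t + suc h) ^ n                    ≈⟨ ^-congˡ n (+-congˡ {t} (begin
              suc h                              ≈⟨ *-identityˡ (suc h) ⟨
              1 * suc h                          ≈⟨ *-congʳ {suc h} (proj₂ (inverse A A≉0)) ⟨
              A * A⁻¹ * suc h                    ≈⟨ *-assoc A A⁻¹ (suc h) ⟩
              A * (A⁻¹ * suc h)                  ≈⟨ *-congˡ {A} (*-comm A⁻¹ (suc h)) ⟩
              A * (suc h * A⁻¹)                  ≈⟨ *-assoc A (suc h) A⁻¹ ⟨
              A * suc h * A⁻¹                    ∎)) ⟩
            (t + A * suc h * A⁻¹) ^ n          ≈⟨ byDec (((t + A * suc h * A⁻¹) ^ n) ≟ₚ τ)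
               (pat-cand i d (A ℕ.* suc h) t e (hitM-0 A (suc h)) (ℕₚ.<-≤-trans i<A (ℕₚ.m≤m*n A (suc h)))
                 (ℕₚ.≤-trans (ℕₚ.≤-trans (ℕₚ.*-monoʳ-≤ A h<H) AH≤d) (ℕₚ.m≤n+m d i))) ⟩
            τ                                  ∎

      Y : ℕ → ℕ
      Y d = Σ< A (λ i → N i (suc d))

      span X : ℕ
      span = A ℕ.* H
      X = Σ< span Y

      Y-zero : ∀ d → span ℕ.≤ d → Y d ≡ 0
      Y-zero d le = Σ-zero A (λ i i<A → N-zero i (suc d) i<A (ℕₚ.m≤n⇒m≤1+n le))

      truncate : ∀ k → Σ< (span ℕ.+ k) Y ≡ X
      truncate k = ≡.trans (Σ-split span k Y) (≡.trans (≡.cong (X ℕ.+_) (Σ-zero k (λ j _ → Y-zero (span ℕ.+ j) (ℕₚ.m≤m+n span j)))) (ℕₚ.+-identityʳ X))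

      SR≡ : SR (A ℕ.* p) ≡ A ℕ.* p ℕ.+ 2 ℕ.* X
      -- The cut-off span + M is at least M, as `S≡` requires, and beyond span every summand is
      -- zero.
      SR≡ = ≡.trans (S≡ (span ℕ.+ M) (ℕₚ.m≤n+m M span) (ℕ.>-nonZero⁻¹ M) hit-zero)
        (≡.cong (λ z → M ℕ.+ 2 ℕ.* z)
          (≡.trans (Σ-swap M (span ℕ.+ M) (λ x d → ⟦ miss (hitM M) x (suc d) ⟧))
            (≡.trans (Σ-cong (span ℕ.+ M) (λ d _ → total-misses (suc d))) (truncate M))))
        where
        M = A ℕ.* p
        hit-zero : hitM M 0 ≡ true
        hit-zero = ≡.trans (≡.cong (hitM M) (≡.sym (ℕₚ.*-zeroʳ M))) (hitM-0 M 0)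
        open Gaps (hitM M)
        open Listed M (isSquareMod M) (λ x x<M → ≡.sym (hitM-< M x x<M))
          (≡.trans (≡.cong (hitM M) (≡.sym (ℕₚ.*-identityʳ M))) (hitM-0 M 1))

      R₂ : ℕ
      R₂ = 2 ℕ.^ r A

      -- By `w-+A` an interval longer by A carries r more forms. Both counts, scaled by their powers
      -- of two, are near p, and the common factor 2^w cancels.
      step-near : ∀ i d → i ℕ.< A → Near (R₂ ℕ.* N i (A ℕ.+ d)) (N i d) (R₂ ℕ.* E ℕ.+ E)
      step-near i d i<A = near-cancel-* v (2^>0 (w i d))
        (≡.subst₂ (λ x y → Near x (v ℕ.* N i d) y) e₁ e₂ (near-trans far (near-sym (N-near i d i<A))))
        where
        open +-*-Solver using (solve; _:+_; _:*_; _:=_; con)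
        v = 2 ℕ.^ w i d
        far : Near (R₂ ℕ.* v ℕ.* N i (A ℕ.+ d)) p (R₂ ℕ.* v ℕ.* E)
        far = ≡.subst (λ z → Near (z ℕ.* N i (A ℕ.+ d)) p (z ℕ.* E))
          (≡.trans (≡.cong (2 ℕ.^_) (w-+A i d)) (ℕₚ.^-distribˡ-+-* 2 (r A) (w i d))) (N-near i (A ℕ.+ d) i<A)
        e₁ : R₂ ℕ.* v ℕ.* N i (A ℕ.+ d) ≡ v ℕ.* (R₂ ℕ.* N i (A ℕ.+ d))
        e₁ = solve 3 (λ x v y → x :* v :* y := v :* (x :* y)) ≡.refl R₂ v (N i (A ℕ.+ d))
        e₂ : R₂ ℕ.* v ℕ.* E ℕ.+ v ℕ.* E ≡ v ℕ.* (R₂ ℕ.* E ℕ.+ E)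
        e₂ = solve 3 (λ x v y → x :* v :* y :+ v :* y := v :* (x :* y :+ y)) ≡.refl R₂ v E

      w≤r : ∀ i d → d ℕ.< A → w i (suc d) ℕ.≤ r A
      w≤r i d d<A = ≡.subst (w i (suc d) ℕ.≤_) (w-A i) (w-mono i d<A)

      first-near : ∀ i d → i ℕ.< A → d ℕ.< A →
                   Near (R₂ ℕ.* N i (suc d)) (2 ℕ.^ (r A ℕ.∸ w i (suc d)) ℕ.* p) (R₂ ℕ.* E)
      first-near i d i<A d<A = ≡.subst₂ (λ x y → Near x (u ℕ.* p) y) (e (N i (suc d))) (e E) (near-* u (N-near i (suc d) i<A))
        where
        u = 2 ℕ.^ (r A ℕ.∸ w i (suc d))
        e : ∀ z → u ℕ.* (2 ℕ.^ w i (suc d) ℕ.* z) ≡ R₂ ℕ.* z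
        e z = ≡.trans (≡.sym (ℕₚ.*-assoc u _ z)) (≡.cong (ℕ._* z)
          (≡.trans (≡.sym (ℕₚ.^-distribˡ-+-* 2 (r A ℕ.∸ w i (suc d)) (w i (suc d)))) (≡.cong (2 ℕ.^_) (ℕₚ.m∸n+n≡m (w≤r i d d<A)))))

      PP : ℕ
      PP = Σ< A (λ i → Σ< A (λ d → 2 ℕ.^ (r A ℕ.∸ w i (suc d))))

      -- The geometric series is summed through its functional equation: in 2^r X the first A
      -- lengths contribute PP p, and the others, shifted back by A with `step-near`, reproduce X.
      X-near : Near (R₂ ℕ.* X) (PP ℕ.* p ℕ.+ X) (A ℕ.* (A ℕ.* (R₂ ℕ.* E)) ℕ.+ span ℕ.* (A ℕ.* (R₂ ℕ.* E ℕ.+ E)))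
      X-near = ≡.subst₂ (λ x y → Near x y (A ℕ.* (A ℕ.* (R₂ ℕ.* E)) ℕ.+ span ℕ.* (A ℕ.* (R₂ ℕ.* E ℕ.+ E)))) left right (near-+ first later)
        where
        first : Near (Σ< A (λ d → Σ< A (λ i → R₂ ℕ.* N i (suc d)))) (Σ< A (λ d → Σ< A (λ i → 2 ℕ.^ (r A ℕ.∸ w i (suc d)) ℕ.* p))) (A ℕ.* (A ℕ.* (R₂ ℕ.* E)))
        first = near-Σ A (λ d d<A → near-Σ A (λ i i<A → first-near i d i<A d<A))
        later : Near (Σ< span (λ d → Σ< A (λ i → R₂ ℕ.* N i (A ℕ.+ suc d)))) (Σ< span (λ d → Σ< A (λ i → N i (suc d)))) (span ℕ.* (A ℕ.* (R₂ ℕ.* E ℕ.+ E)))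
        later = near-Σ span (λ d _ → near-Σ A (λ i i<A → step-near i (suc d) i<A))
        pull : ∀ d → Σ< A (λ i → R₂ ℕ.* N i (suc d)) ≡ R₂ ℕ.* Y d
        pull d = Σ-* A R₂ (λ i → N i (suc d))
        pull′ : ∀ d → Σ< A (λ i → R₂ ℕ.* N i (A ℕ.+ suc d)) ≡ R₂ ℕ.* Y (A ℕ.+ d)
        pull′ d = ≡.trans (Σ-cong A (λ i _ → ≡.cong (λ z → R₂ ℕ.* N i z) (ℕₚ.+-suc A d))) (pull (A ℕ.+ d))
        left : Σ< A (λ d → Σ< A (λ i → R₂ ℕ.* N i (suc d))) ℕ.+ Σ< span (λ d → Σ< A (λ i → R₂ ℕ.* N i (A ℕ.+ suc d))) ≡ R₂ ℕ.* X
        left = begin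
          Σ< A (λ d → Σ< A (λ i → R₂ ℕ.* N i (suc d))) ℕ.+ Σ< span (λ d → Σ< A (λ i → R₂ ℕ.* N i (A ℕ.+ suc d)))
            ≡⟨ ≡.cong₂ ℕ._+_ (Σ-cong A (λ d _ → pull d)) (Σ-cong span (λ d _ → pull′ d)) ⟩
          Σ< A (λ d → R₂ ℕ.* Y d) ℕ.+ Σ< span (λ d → R₂ ℕ.* Y (A ℕ.+ d))
            ≡⟨ Σ-split A span (λ d → R₂ ℕ.* Y d) ⟨
          Σ< (A ℕ.+ span) (λ d → R₂ ℕ.* Y d)
            ≡⟨ Σ-* (A ℕ.+ span) R₂ Y ⟩
          R₂ ℕ.* Σ< (A ℕ.+ span) Y
            ≡⟨ ≡.cong (R₂ ℕ.*_) (≡.trans (≡.cong (λ z → Σ< z Y) (ℕₚ.+-comm A span)) (truncate A)) ⟩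
          R₂ ℕ.* X ∎
          where open ≡.≡-Reasoning
        right : Σ< A (λ d → Σ< A (λ i → 2 ℕ.^ (r A ℕ.∸ w i (suc d)) ℕ.* p)) ℕ.+ Σ< span (λ d → Σ< A (λ i → N i (suc d))) ≡ PP ℕ.* p ℕ.+ X
        right = ≡.cong (ℕ._+ X) (begin
          Σ< A (λ d → Σ< A (λ i → e i d ℕ.* p))   ≡⟨ Σ-swap A A (λ d i → e i d ℕ.* p) ⟩
          Σ< A (λ i → Σ< A (λ d → e i d ℕ.* p))   ≡⟨ Σ-cong A (λ i _ → ≡.trans (Σ-cong A (λ d _ → ℕₚ.*-comm (e i d) p)) (Σ-* A p (e i))) ⟩
          Σ< A (λ i → p ℕ.* Σ< A (e i))           ≡⟨ Σ-* A p (λ i → Σ< A (e i)) ⟩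
          p ℕ.* PP                                ≡⟨ ℕₚ.*-comm p PP ⟩
          PP ℕ.* p                                ∎)
          where
          open ≡.≡-Reasoning
          e : ℕ → ℕ → ℕ
          e i d = 2 ℕ.^ (r A ℕ.∸ w i (suc d))

      main-near : ∀ q → suc q ≡ R₂ → 1 ℕ.≤ q → 1 ℕ.≤ H →
                  Near (q ℕ.* SR (A ℕ.* p)) ((q ℕ.* A ℕ.+ 2 ℕ.* PP) ℕ.* p) (q ℕ.* (10 ℕ.* (A ℕ.* A ℕ.* H ℕ.* E)))
      main-near q sq 1≤q 1≤H = ≡.subst₂ (λ x y → Near x y (q ℕ.* (10 ℕ.* (A ℕ.* A ℕ.* H ℕ.* E)))) left right
        (near-weaken err (near-+ (near-≡ {q ℕ.* (A ℕ.* p)} ≡.refl) (near-* 2 (drop-X e X-near))))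
        where
        open +-*-Solver using (solve; _:+_; _:*_; _:=_; con)
        e = A ℕ.* (A ℕ.* (R₂ ℕ.* E)) ℕ.+ span ℕ.* (A ℕ.* (R₂ ℕ.* E ℕ.+ E))
        drop-X : ∀ e → Near (R₂ ℕ.* X) (PP ℕ.* p ℕ.+ X) e → Near (q ℕ.* X) (PP ℕ.* p) e
        drop-X e (a , b) =
          ℕₚ.+-cancelˡ-≤ X _ _ (ℕₚ.≤-trans (ℕₚ.≤-reflexive (≡.cong (ℕ._* X) sq)) (ℕₚ.≤-trans a (ℕₚ.≤-reflexive (solve 3 (λ x y z → x :+ y :+ z := y :+ (x :+ z)) ≡.refl (PP ℕ.* p) X e)))) ,
          ℕₚ.+-cancelˡ-≤ X _ _ (ℕₚ.≤-trans (ℕₚ.≤-reflexive (ℕₚ.+-comm X (PP ℕ.* p))) (ℕₚ.≤-trans b (ℕₚ.≤-reflexive (≡.trans (≡.cong (λ z → z ℕ.* X ℕ.+ e) (≡.sym sq)) (ℕₚ.+-assoc X (q ℕ.* X) e)))))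
        left : q ℕ.* (A ℕ.* p) ℕ.+ 2 ℕ.* (q ℕ.* X) ≡ q ℕ.* SR (A ℕ.* p)
        left = ≡.trans (solve 3 (λ q m x → q :* m :+ con 2 :* (q :* x) := q :* (m :+ con 2 :* x)) ≡.refl q (A ℕ.* p) X) (≡.cong (q ℕ.*_) (≡.sym SR≡))
        right : q ℕ.* (A ℕ.* p) ℕ.+ 2 ℕ.* (PP ℕ.* p) ≡ (q ℕ.* A ℕ.+ 2 ℕ.* PP) ℕ.* p
        right = solve 4 (λ q a p x → q :* (a :* p) :+ con 2 :* (x :* p) := (q :* a :+ con 2 :* x) :* p) ≡.refl q A p PP
        -- As 2^r ≤ 2 q, the two parts of e are at most 2 q A² E and 3 q A² H E; doubling and H ≥ 1
        -- give the constant 10.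
        err : 0 ℕ.+ 2 ℕ.* e ℕ.≤ q ℕ.* (10 ℕ.* (A ℕ.* A ℕ.* H ℕ.* E))
        err = begin
          2 ℕ.* e
            ≡⟨ ≡.cong (λ z → 2 ℕ.* (A ℕ.* (A ℕ.* (z ℕ.* E)) ℕ.+ span ℕ.* (A ℕ.* (z ℕ.* E ℕ.+ E)))) (≡.sym sq) ⟩
          2 ℕ.* (A ℕ.* (A ℕ.* (suc q ℕ.* E)) ℕ.+ A ℕ.* H ℕ.* (A ℕ.* (suc q ℕ.* E ℕ.+ E)))
            ≤⟨ ℕₚ.*-monoʳ-≤ 2 (ℕₚ.+-mono-≤ (ℕₚ.*-monoʳ-≤ A (ℕₚ.*-monoʳ-≤ A (ℕₚ.*-monoˡ-≤ E sq≤)))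
                 (ℕₚ.*-monoʳ-≤ (A ℕ.* H) (ℕₚ.*-monoʳ-≤ A (ℕₚ.+-mono-≤ (ℕₚ.*-monoˡ-≤ E sq≤) (ℕₚ.m≤n*m E q {{ℕ.>-nonZero 1≤q}}))))) ⟩
          2 ℕ.* (A ℕ.* (A ℕ.* (2 ℕ.* q ℕ.* E)) ℕ.+ A ℕ.* H ℕ.* (A ℕ.* (2 ℕ.* q ℕ.* E ℕ.+ q ℕ.* E)))
            ≡⟨ solve 4 (λ a h q e → con 2 :* (a :* (a :* (con 2 :* q :* e)) :+ a :* h :* (a :* (con 2 :* q :* e :+ q :* e))) := q :* (con 4 :* (a :* a :* con 1 :* e) :+ con 6 :* (a :* a :* h :* e))) ≡.refl A H q E ⟩
          q ℕ.* (4 ℕ.* (A ℕ.* A ℕ.* 1 ℕ.* E) ℕ.+ 6 ℕ.* (A ℕ.* A ℕ.* H ℕ.* E))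
            ≤⟨ ℕₚ.*-monoʳ-≤ q (ℕₚ.+-monoˡ-≤ (6 ℕ.* (A ℕ.* A ℕ.* H ℕ.* E)) (ℕₚ.*-monoʳ-≤ 4 (ℕₚ.*-monoˡ-≤ E (ℕₚ.*-monoʳ-≤ (A ℕ.* A) 1≤H)))) ⟩
          q ℕ.* (4 ℕ.* (A ℕ.* A ℕ.* H ℕ.* E) ℕ.+ 6 ℕ.* (A ℕ.* A ℕ.* H ℕ.* E))
            ≡⟨ ≡.cong (q ℕ.*_) (≡.sym (ℕₚ.*-distribʳ-+ (A ℕ.* A ℕ.* H ℕ.* E) 4 6)) ⟩
          q ℕ.* (10 ℕ.* (A ℕ.* A ℕ.* H ℕ.* E)) ∎
          where
          open ℕₚ.≤-Reasoning
          sq≤ : suc q ℕ.≤ 2 ℕ.* q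
          sq≤ = ℕₚ.+-mono-≤ 1≤q (ℕₚ.m≤m+n q 0)

-- Identification of the main term with F(1/2)

module MainTerm where

  open import Defs
  open import Data.Bool as Bool using (Bool; true; false)
  open import Data.Nat
  open import Data.Nat.Properties
  open import Data.Nat.DivMod using (m<n⇒m%n≡m; [m+n]%n≡m%n)
  open import Data.Nat.ListAction using (sum)
  open import Data.Nat.Solver using (module +-*-Solver)
  open import Data.List using (List; []; _∷_; length; map; upTo; applyUpTo)
  open import Data.Sum using (inj₁; inj₂)
  open import Function using (_∘_; id)
  open import Relation.Binary.PropositionalEquality
  open import Relation.Nullary using (¬_; yes; no; contradiction)
  open FiniteSums
  open GapSums
  open SquaresModAp
  open GapAsymptotics

  sumTo≡Σ : ∀ n h → sumTo n h ≡ Σ< n h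
  sumTo≡Σ n h = go n id
    where
    go : ∀ n g → sum (map h (applyUpTo g n)) ≡ Σ< n (h ∘ g)
    go zero    g = refl
    go (suc n) g = cong (h (g 0) +_) (go n (g ∘ suc))

  Tri : ℕ → (ℕ → ℕ → ℕ) → ℕ
  Tri n s = Σ< n (λ z → Σ< z (λ i → s i z))

  Tri-cong : ∀ n {s s′ : ℕ → ℕ → ℕ} → (∀ i z → i < z → z < n → s i z ≡ s′ i z) → Tri n s ≡ Tri n s′
  Tri-cong n e = Σ-cong n (λ z z<n → Σ-cong z (λ i i<z → e i z i<z z<n))

  Tri-+ : ∀ n s s′ → Tri n (λ i z → s i z + s′ i z) ≡ Tri n s + Tri n s′
  Tri-+ n s s′ = trans (Σ-cong n (λ z _ → Σ-+ z (λ i → s i z) (λ i → s′ i z)))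
    (Σ-+ n (λ z → Σ< z (λ i → s i z)) (λ z → Σ< z (λ i → s′ i z)))

  Tri-suc : ∀ n s → Tri (suc n) s ≡ Σ< n (λ z → s 0 (suc z)) + Tri n (λ i z → s (suc i) (suc z))
  Tri-suc n s = Σ-+ n (λ z → s 0 (suc z)) (λ z → Σ< z (λ i → s (suc i) (suc z)))

  Σ-above : ∀ n s → Σ< n (λ i → Σ< (n ∸ suc i) (λ d → s i (suc i + d))) ≡ Tri n s
  Σ-above zero    s = refl
  Σ-above (suc n) s = trans (cong (Σ< n (λ d → s 0 (suc d)) +_) (Σ-above n (λ i z → s (suc i) (suc z)))) (sym (Tri-suc n s))

  Σ-square : ∀ n s → (∀ i z → s i z ≡ s z i) →
             Σ< n (λ i → Σ< n (s i)) ≡ Σ< n (λ i → s i i) + 2 * Tri n s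
  Σ-square zero    s sy = refl
  Σ-square (suc n) s sy = begin
    s 0 0 + a + Σ< n (λ i → s (suc i) 0 + Σ< n (λ z → s (suc i) (suc z)))
      ≡⟨ cong (s 0 0 + a +_) (Σ-+ n (λ i → s (suc i) 0) (λ i → Σ< n (λ z → s (suc i) (suc z)))) ⟩
    s 0 0 + a + (Σ< n (λ i → s (suc i) 0) + Σ< n (λ i → Σ< n (λ z → s (suc i) (suc z))))
      ≡⟨ cong₂ (λ x y → s 0 0 + a + (x + y)) (Σ-cong n (λ i _ → sy (suc i) 0)) (Σ-square n (λ i z → s (suc i) (suc z)) (λ i z → sy (suc i) (suc z))) ⟩
    s 0 0 + a + (a + (d + 2 * t))
      ≡⟨ solve 4 (λ x a d t → x :+ a :+ (a :+ (d :+ con 2 :* t)) := x :+ d :+ con 2 :* (a :+ t)) refl (s 0 0) a d t ⟩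
    s 0 0 + d + 2 * (a + t)
      ≡⟨ cong (λ z → s 0 0 + d + 2 * z) (Tri-suc n s) ⟨
    s 0 0 + d + 2 * Tri (suc n) s ∎
    where
    open ≡-Reasoning
    open +-*-Solver using (solve; _:+_; _:*_; _:=_; con)
    a = Σ< n (λ z → s 0 (suc z))
    d = Σ< n (λ i → s (suc i) (suc i))
    t = Tri n (λ i z → s (suc i) (suc z))

  -- V goes up by one exactly at the elements, so it is constant on each gap. A sum of G (V x) over
  -- positions thereby becomes a sum over gaps weighted by their lengths.
  module BlockSum (h : ℕ → Bool) (V : ℕ → ℕ) (V-suc : ∀ x → V (suc x) ≡ V x + ⟦ h (suc x) ⟧)
    (M : ℕ) (b : ℕ → Bool) (b≡h : ∀ x → x < M → b x ≡ h x) (hM : h M ≡ true) (G : ℕ → ℕ) where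

    open Gaps h using (range; applyUpTo≡range)
    open Gaps.Listed h M b b≡h hM using (select; select-true; select-false)

    bsum : ℕ → List ℕ → ℕ
    bsum v []       = 0
    bsum v (s ∷ ss) = s * G v + bsum (suc v) ss

    bsum-gapsFrom : ∀ k g x → x + (suc g + k) ≡ M → (∀ j → j ≤ g → V (x + j) ≡ V x) →
                    bsum (V x) (gapsFrom M 0 x (select (range (suc x + g) k))) ≡ Σ< (suc g + k) (λ j → G (V (x + j)))
    bsum-gapsFrom zero g x eq flat = begin
      (M ∸ x) * G (V x) + 0               ≡⟨ +-identityʳ _ ⟩
      (M ∸ x) * G (V x)                   ≡⟨ cong (_* G (V x)) M∸x ⟩
      (suc g + 0) * G (V x)               ≡⟨ Σ-const (suc g + 0) (G (V x)) ⟨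
      Σ< (suc g + 0) (λ _ → G (V x))      ≡⟨ Σ-cong (suc g + 0) (λ j j< → cong G (flat j (≤-pred (subst (j <_) (+-identityʳ (suc g)) j<)))) ⟨
      Σ< (suc g + 0) (λ j → G (V (x + j))) ∎
      where
      open ≡-Reasoning
      M∸x : M ∸ x ≡ suc g + 0
      M∸x = trans (cong (_∸ x) (sym eq)) (m+n∸m≡n x (suc g + 0))
    bsum-gapsFrom (suc k) g x eq flat = byHit (h y) refl
      where
      open ≡-Reasoning
      y = suc x + g
      y≡ : y ≡ x + suc g
      y≡ = sym (+-suc x g)
      y+k : y + (1 + k) ≡ M
      y+k = trans (cong suc (+-assoc x g (suc k))) (trans (sym (+-suc x (g + suc k))) eq)
      y<M : y < M
      y<M = ≤-trans (≤-reflexive (+-comm 1 y)) (≤-trans (+-monoʳ-≤ y (s≤s z≤n)) (≤-reflexive y+k))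
      by : b y ≡ h y
      by = b≡h y y<M
      Vy : ∀ {v} → h y ≡ v → V y ≡ V x + ⟦ v ⟧
      Vy e = trans (V-suc (x + g)) (cong₂ (λ p q → p + ⟦ q ⟧) (flat g ≤-refl) e)
      byHit : ∀ v → h y ≡ v → bsum (V x) (gapsFrom M 0 x (select (y ∷ range (suc y) k))) ≡ Σ< (suc g + suc k) (λ j → G (V (x + j)))
      byHit true e = begin
        bsum (V x) (gapsFrom M 0 x (select (y ∷ range (suc y) k)))
          ≡⟨ cong (bsum (V x) ∘ gapsFrom M 0 x) (select-true y (range (suc y) k) (trans by e)) ⟩
        (y ∸ x) * G (V x) + bsum (suc (V x)) (gapsFrom M 0 y (select (range (suc y) k)))
          ≡⟨ cong₂ (λ u w → u * G (V x) + w) (trans (cong (_∸ x) y≡) (m+n∸m≡n x (suc g)))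
               (cong₂ (λ v w → bsum v (gapsFrom M 0 y (select (range w k)))) (trans (+-comm 1 (V x)) (sym (Vy e))) (sym (+-identityʳ (suc y)))) ⟩
        suc g * G (V x) + bsum (V y) (gapsFrom M 0 y (select (range (suc y + 0) k)))
          ≡⟨ cong₂ _+_ (trans (sym (Σ-const (suc g) (G (V x)))) (Σ-cong (suc g) (λ j j< → cong G (sym (flat j (≤-pred j<))))))
               (bsum-gapsFrom k 0 y y+k (λ { zero _ → cong V (+-identityʳ y) ; (suc _) () })) ⟩
        Σ< (suc g) (λ j → G (V (x + j))) + Σ< (suc k) (λ j → G (V (y + j)))
          ≡⟨ cong (Σ< (suc g) (λ j → G (V (x + j))) +_) (Σ-cong (suc k) (λ j _ → cong (G ∘ V) (trans (cong (_+ j) y≡) (+-assoc x (suc g) j)))) ⟩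
        Σ< (suc g) (λ j → G (V (x + j))) + Σ< (suc k) (λ j → G (V (x + (suc g + j))))
          ≡⟨ Σ-split (suc g) (suc k) (λ j → G (V (x + j))) ⟨
        Σ< (suc g + suc k) (λ j → G (V (x + j))) ∎
      byHit false e = begin
        bsum (V x) (gapsFrom M 0 x (select (y ∷ range (suc y) k)))
          ≡⟨ cong (bsum (V x) ∘ gapsFrom M 0 x) (select-false y (range (suc y) k) (trans by e)) ⟩
        bsum (V x) (gapsFrom M 0 x (select (range (suc y) k)))
          ≡⟨ cong (λ w → bsum (V x) (gapsFrom M 0 x (select (range w k)))) (sym (+-suc (suc x) g)) ⟩
        bsum (V x) (gapsFrom M 0 x (select (range (suc x + suc g) k)))
          ≡⟨ bsum-gapsFrom k (suc g) x (trans (cong (λ w → x + suc w) (sym (+-suc g k))) eq) flat′ ⟩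
        Σ< (suc (suc g) + k) (λ j → G (V (x + j)))
          ≡⟨ cong (λ w → Σ< (suc w) (λ j → G (V (x + j)))) (sym (+-suc g k)) ⟩
        Σ< (suc g + suc k) (λ j → G (V (x + j))) ∎
        where
        flat′ : ∀ j → j ≤ suc g → V (x + j) ≡ V x
        flat′ j j≤ with m≤n⇒m<n∨m≡n j≤
        ... | inj₁ j<   = flat j (≤-pred j<)
        ... | inj₂ refl = trans (cong V (sym y≡)) (trans (Vy e) (+-identityʳ (V x)))

    bsum-nth : ∀ v ss → bsum v ss ≡ Σ< (length ss) (λ j → nth ss j * G (v + j))
    bsum-nth v []       = refl
    bsum-nth v (s ∷ ss) = cong₂ _+_ (cong (λ z → s * G z) (sym (+-identityʳ v)))
      (trans (bsum-nth (suc v) ss) (Σ-cong (length ss) (λ j _ → cong (λ z → nth ss j * G z) (sym (+-suc v j)))))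

    length-gapsFrom : ∀ m f x ys → length (gapsFrom m f x ys) ≡ suc (length ys)
    length-gapsFrom m f x []       = refl
    length-gapsFrom m f x (y ∷ ys) = cong suc (length-gapsFrom m f y ys)

    length-gaps : ∀ m ys → length (gaps m ys) ≡ length ys
    length-gaps m []       = refl
    length-gaps m (y ∷ ys) = length-gapsFrom m y y ys

    Σ-blocks : 0 < M → h 0 ≡ true → V 0 ≡ 0 →
               Σ< M (λ x → G (V x)) ≡ Σ< (length (select (upTo M))) (λ j → nth (gaps M (select (upTo M))) j * G j)
    Σ-blocks 0<M h0 V0 = trans (sym (go M refl)) (trans (bsum-nth 0 (gaps M (select (upTo M))))
        (cong (λ z → Σ< z (λ j → nth (gaps M (select (upTo M))) j * G j)) (length-gaps M (select (upTo M)))))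
      where
      open ≡-Reasoning
      go : ∀ M′ → M′ ≡ M → bsum 0 (gaps M (select (upTo M′))) ≡ Σ< M (λ x → G (V x))
      go zero     e = contradiction e (<⇒≢ 0<M)
      go (suc M′) e = begin
        bsum 0 (gaps M (select (0 ∷ applyUpTo suc M′)))
          ≡⟨ cong (bsum 0 ∘ gaps M ∘ select ∘ (0 ∷_)) (applyUpTo≡range 1 M′) ⟩
        bsum 0 (gaps M (select (0 ∷ range 1 M′)))
          ≡⟨ cong (bsum 0 ∘ gaps M) (select-true 0 (range 1 M′) (trans (b≡h 0 0<M) h0)) ⟩
        bsum 0 (gapsFrom M 0 0 (select (range 1 M′)))
          ≡⟨ cong (λ v → bsum v (gapsFrom M 0 0 (select (range 1 M′)))) V0 ⟨
        bsum (V 0) (gapsFrom M 0 0 (select (range 1 M′)))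
          ≡⟨ bsum-gapsFrom M′ 0 0 e (λ { zero _ → refl ; (suc _) () }) ⟩
        Σ< (suc M′) (λ j → G (V j))
          ≡⟨ cong (λ w → Σ< w (λ j → G (V j))) e ⟩
        Σ< M (λ x → G (V x)) ∎

  β-0 : ∀ A → β A 0 ≡ sumTo (r A) (λ i → s A i * s A i)
  β-0 A with 0 ≟ r A
  ... | yes _ = refl
  ... | no _  = refl

  β-r : ∀ A → β A (r A) ≡ sumTo (r A) (λ i → s A i * s A i)
  β-r A with r A ≟ 0 | r A ≟ r A
  ... | yes _ | _     = refl
  ... | no _  | yes _ = refl
  ... | no _  | no ¬e = contradiction refl ¬e

  β-mid : ∀ A k → ¬ (k ≡ 0) → ¬ (k ≡ r A) → β A k ≡ 2 * sumTo (r A) (λ i → s A i * s A (modr (r A) (i + k)))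
  β-mid A k k≢0 k≢r with k ≟ 0 | k ≟ r A
  ... | yes e | _     = contradiction e k≢0
  ... | no _  | yes e = contradiction e k≢r
  ... | no _  | no _  = refl

  -- This is 2^r F(1/2), the numerator of f_A(1/2) cleared of denominators.
  Gsum : ℕ → ℕ
  Gsum A = Σ< (suc (r A)) (λ k → β A k * 2 ^ (r A ∸ k))

  -- On a circle of ρ gaps there are two ways between gaps j and l, of |j - l| and ρ - |j - l|
  -- steps; a way of k steps contributes 2^(ρ - k).
  Φ : ℕ → ℕ → ℕ → ℕ
  Φ ρ j l = 2 ^ (ρ ∸ ∣ j - l ∣) + 2 ^ ∣ j - l ∣

  Φ-sym : ∀ ρ j l → Φ ρ j l ≡ Φ ρ l j
  Φ-sym ρ j l = cong (λ z → 2 ^ (ρ ∸ z) + 2 ^ z) (∣-∣-comm j l)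

  Φ-diag : ∀ ρ j → Φ ρ j j ≡ 2 ^ ρ + 1
  Φ-diag ρ j = cong (λ z → 2 ^ (ρ ∸ z) + 2 ^ z) (∣n-n∣≡0 j)

  ∣i-suc-i+d∣ : ∀ i d → ∣ i - (suc i + d) ∣ ≡ suc d
  ∣i-suc-i+d∣ i d = trans (cong (λ z → ∣ i - z ∣) (sym (+-suc i d))) (∣m-m+n∣≡n i (suc d))

  module Main (A : ℕ) (1≤A : 1 ≤ A) where

    open Candidates A 1≤A

    private instance
      A≢0 : NonZero A
      A≢0 = >-nonZero 1≤A

    c : ℕ → ℕ
    c = s A

    weighted : ℕ
    weighted = Σ< (r A) (λ j → Σ< (r A) (λ l → c j * c l * Φ (r A) j l))

    -- β_0 and β_r together give the diagonal, where Φ is 2^ρ + 1. For 0 < k < ρ the index i + k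
    -- either stays below ρ (`above`) or wraps around (`below`), and the two cases yield the two
    -- summands of Φ over the pairs i < z; symmetry accounts for the factor 2.
    Gsum≡weighted : Gsum A ≡ weighted
    Gsum≡weighted = go (r A) refl
      where
      go : ∀ ρ → r A ≡ ρ → Gsum A ≡ weighted
      go zero     e = contradiction (subst (1 ≤_) e 1≤r) (λ ())
      go (suc ρ′) e = begin
        Gsum A
          ≡⟨ cong (λ z → Σ< (suc z) (λ k → β A k * 2 ^ (z ∸ k))) e ⟩
        β A 0 * 2 ^ ρ + Σ< ρ (λ k → β A (suc k) * 2 ^ (ρ′ ∸ k))
          ≡⟨ cong (β A 0 * 2 ^ ρ +_) (Σ-last ρ′ (λ k → β A (suc k) * 2 ^ (ρ′ ∸ k))) ⟩
        β A 0 * 2 ^ ρ + (Σ< ρ′ (λ k → β A (suc k) * 2 ^ (ρ′ ∸ k)) + β A ρ * 2 ^ (ρ′ ∸ ρ′))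
          ≡⟨ cong₂ (λ x y → x * 2 ^ ρ + (Σ< ρ′ (λ k → β A (suc k) * 2 ^ (ρ′ ∸ k)) + y)) β0 (trans (cong₂ _*_ βρ (cong (2 ^_) (n∸n≡0 ρ′))) (*-identityʳ C₀)) ⟩
        C₀ * 2 ^ ρ + (Σ< ρ′ (λ k → β A (suc k) * 2 ^ (ρ′ ∸ k)) + C₀)
          ≡⟨ cong (λ x → C₀ * 2 ^ ρ + (x + C₀)) middle ⟩
        C₀ * 2 ^ ρ + (2 * Tri ρ sΦ + C₀)
          ≡⟨ solve 3 (λ x y z → x :* y :+ (z :+ x) := (y :+ con 1) :* x :+ z) refl C₀ (2 ^ ρ) (2 * Tri ρ sΦ) ⟩
        (2 ^ ρ + 1) * C₀ + 2 * Tri ρ sΦ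
          ≡⟨ cong (_+ 2 * Tri ρ sΦ) (trans (sym (Σ-* ρ (2 ^ ρ + 1) (λ i → c i * c i)))
               (Σ-cong ρ (λ i _ → trans (*-comm (2 ^ ρ + 1) (c i * c i)) (cong (c i * c i *_) (sym (Φ-diag ρ i)))))) ⟩
        Σ< ρ (λ i → sΦ i i) + 2 * Tri ρ sΦ
          ≡⟨ Σ-square ρ sΦ (λ i z → cong₂ _*_ (*-comm (c i) (c z)) (Φ-sym ρ i z)) ⟨
        Σ< ρ (λ i → Σ< ρ (sΦ i))
          ≡⟨ cong (λ z → Σ< z (λ j → Σ< z (λ l → c j * c l * Φ z j l))) e ⟨
        weighted ∎
        where
        open ≡-Reasoning
        open +-*-Solver using (solve; _:+_; _:*_; _:=_; con)
        ρ = suc ρ′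
        C₀ = Σ< ρ (λ i → c i * c i)
        sΦ : ℕ → ℕ → ℕ
        sΦ i z = c i * c z * Φ ρ i z
        β0 : β A 0 ≡ C₀
        β0 = trans (β-0 A) (trans (sumTo≡Σ (r A) (λ i → c i * c i)) (cong (λ z → Σ< z (λ i → c i * c i)) e))
        βρ : β A ρ ≡ C₀
        βρ = trans (cong (β A) (sym e)) (trans (β-r A) (trans (sumTo≡Σ (r A) (λ i → c i * c i)) (cong (λ z → Σ< z (λ i → c i * c i)) e)))
        βk : ∀ k → k < ρ′ → β A (suc k) ≡ 2 * Σ< ρ (λ i → c i * c ((i + suc k) % ρ))
        βk k k<ρ′ = trans (β-mid A (suc k) (λ ()) (λ eq → <⇒≢ (s≤s k<ρ′) (trans eq e)))
          (cong (2 *_) (trans (sumTo≡Σ (r A) (λ i → c i * c (modr (r A) (i + suc k)))) (cong (λ z → Σ< z (λ i → c i * c (modr z (i + suc k)))) e)))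
        inner : ∀ i → i < ρ → Σ< ρ′ (λ k → c i * c ((i + suc k) % ρ) * 2 ^ (ρ′ ∸ k))
                ≡ Σ< (ρ ∸ suc i) (λ d → c i * c (suc i + d) * 2 ^ (ρ ∸ ∣ i - suc i + d ∣)) + Σ< i (λ l → c l * c i * 2 ^ ∣ l - i ∣)
        inner i i<ρ = begin
          Σ< ρ′ term                                                   ≡⟨ cong (λ z → Σ< z term) (sym (m∸n+n≡m (≤-pred i<ρ))) ⟩
          Σ< (ρ′ ∸ i + i) term                                         ≡⟨ Σ-split (ρ′ ∸ i) i term ⟩
          Σ< (ρ′ ∸ i) term + Σ< i (λ l → term (ρ′ ∸ i + l))            ≡⟨ cong₂ _+_ (Σ-cong (ρ′ ∸ i) above) (Σ-cong i below) ⟩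
          Σ< (ρ ∸ suc i) (λ d → c i * c (suc i + d) * 2 ^ (ρ ∸ ∣ i - suc i + d ∣)) + Σ< i (λ l → c l * c i * 2 ^ ∣ l - i ∣) ∎
          where
          term : ℕ → ℕ
          term k = c i * c ((i + suc k) % ρ) * 2 ^ (ρ′ ∸ k)
          above : ∀ d → d < ρ′ ∸ i → term d ≡ c i * c (suc i + d) * 2 ^ (ρ ∸ ∣ i - suc i + d ∣)
          above d d< = cong₂ (λ x y → c i * c x * 2 ^ y)
            (trans (cong (_% ρ) (+-suc i d)) (m<n⇒m%n≡m (s≤s (≤-trans (≤-reflexive (+-comm (suc i) d)) (≤-trans (+-monoˡ-≤ (suc i) ≤-refl) (≤-trans (≤-reflexive (+-suc d i)) (≤-trans (+-monoˡ-≤ i d<) (≤-reflexive (m∸n+n≡m (≤-pred i<ρ))))))))))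
            (cong (ρ ∸_) (sym (∣i-suc-i+d∣ i d)))
          below : ∀ l → l < i → term (ρ′ ∸ i + l) ≡ c l * c i * 2 ^ ∣ l - i ∣
          below l l<i = trans (cong₂ (λ x y → c i * c x * 2 ^ y) idx expo) (cong (_* 2 ^ ∣ l - i ∣) (*-comm (c i) (c l)))
            where
            idx : (i + suc (ρ′ ∸ i + l)) % ρ ≡ l
            idx = trans (cong (_% ρ) sum≡) (trans ([m+n]%n≡m%n l ρ) (m<n⇒m%n≡m (<-trans l<i i<ρ)))
              where
              sum≡ : i + suc (ρ′ ∸ i + l) ≡ l + ρ
              sum≡ = trans (solve 3 (λ i x l → i :+ (con 1 :+ (x :+ l)) := l :+ (con 1 :+ (x :+ i))) refl i (ρ′ ∸ i) l)
                (cong (λ z → l + suc z) (m∸n+n≡m (≤-pred i<ρ)))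
            expo : ρ′ ∸ (ρ′ ∸ i + l) ≡ ∣ l - i ∣
            expo = trans (sym (∸-+-assoc ρ′ (ρ′ ∸ i) l)) (trans (cong (_∸ l) (m∸[m∸n]≡n (≤-pred i<ρ))) (sym (m≤n⇒∣m-n∣≡n∸m (<⇒≤ l<i))))
        middle : Σ< ρ′ (λ k → β A (suc k) * 2 ^ (ρ′ ∸ k)) ≡ 2 * Tri ρ sΦ
        middle = begin
          Σ< ρ′ (λ k → β A (suc k) * 2 ^ (ρ′ ∸ k))
            ≡⟨ Σ-cong ρ′ (λ k k<ρ′ → trans (cong (_* 2 ^ (ρ′ ∸ k)) (βk k k<ρ′)) (trans (*-assoc 2 (C k) (2 ^ (ρ′ ∸ k)))
                 (cong (2 *_) (trans (*-comm (C k) (2 ^ (ρ′ ∸ k))) (trans (sym (Σ-* ρ (2 ^ (ρ′ ∸ k)) (λ i → c i * c ((i + suc k) % ρ)))) (Σ-cong ρ (λ i _ → *-comm (2 ^ (ρ′ ∸ k)) (c i * c ((i + suc k) % ρ))))))))) ⟩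
          Σ< ρ′ (λ k → 2 * Σ< ρ (λ i → c i * c ((i + suc k) % ρ) * 2 ^ (ρ′ ∸ k)))
            ≡⟨ Σ-* ρ′ 2 (λ k → Σ< ρ (λ i → c i * c ((i + suc k) % ρ) * 2 ^ (ρ′ ∸ k))) ⟩
          2 * Σ< ρ′ (λ k → Σ< ρ (λ i → c i * c ((i + suc k) % ρ) * 2 ^ (ρ′ ∸ k)))
            ≡⟨ cong (2 *_) (Σ-swap ρ′ ρ (λ k i → c i * c ((i + suc k) % ρ) * 2 ^ (ρ′ ∸ k))) ⟩
          2 * Σ< ρ (λ i → Σ< ρ′ (λ k → c i * c ((i + suc k) % ρ) * 2 ^ (ρ′ ∸ k)))
            ≡⟨ cong (2 *_) (trans (Σ-cong ρ inner) (Σ-+ ρ (λ i → Σ< (ρ ∸ suc i) (λ d → sa i (suc i + d))) (λ i → Σ< i (λ l → sb l i)))) ⟩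
          2 * (Σ< ρ (λ i → Σ< (ρ ∸ suc i) (λ d → sa i (suc i + d))) + Tri ρ sb)
            ≡⟨ cong (λ z → 2 * (z + Tri ρ sb)) (Σ-above ρ sa) ⟩
          2 * (Tri ρ sa + Tri ρ sb)
            ≡⟨ cong (2 *_) (trans (sym (Tri-+ ρ sa sb)) (Tri-cong ρ (λ i z _ _ → sym (*-distribˡ-+ (c i * c z) (2 ^ (ρ ∸ ∣ i - z ∣)) (2 ^ ∣ i - z ∣))))) ⟩
          2 * Tri ρ sΦ ∎
          where
          C : ℕ → ℕ
          C k = Σ< ρ (λ i → c i * c ((i + suc k) % ρ))
          sa sb : ℕ → ℕ → ℕ
          sa i z = c i * c z * 2 ^ (ρ ∸ ∣ i - z ∣)
          sb i z = c i * c z * 2 ^ ∣ i - z ∣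

    V : ℕ → ℕ
    V = w 0

    V-suc : ∀ x → V (suc x) ≡ V x + ⟦ hitM A (suc x) ⟧
    V-suc x = trans (w≡Σ 0 (suc x)) (trans (Σ-last x (λ j → ⟦ hitM A (suc j) ⟧)) (cong (_+ ⟦ hitM A (suc x) ⟧) (sym (w≡Σ 0 x))))

    -- The double sum over gaps unfolded to single residues: a gap of length s stands for s residues
    -- with the same value of `V`.
    positions : ℕ
    positions = Σ< A (λ x → Σ< A (λ z → Φ (r A) (V x) (V z)))

    Σ-V : ∀ G → Σ< A (λ x → G (V x)) ≡ Σ< (r A) (λ j → c j * G j)
    Σ-V G = Σ-blocks 1≤A (trans (cong (hitM A) (sym (*-zeroʳ A))) (hitM-0 A 0)) refl
      where open BlockSum (hitM A) V V-suc A (isSquareMod A) (λ x x<A → sym (hitM-< A x x<A))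
                   (trans (cong (hitM A) (sym (*-identityʳ A))) (hitM-0 A 1)) G

    positions≡weighted : positions ≡ weighted
    positions≡weighted = begin
      positions
        ≡⟨ Σ-V (λ v → Σ< A (λ z → Φ ρ v (V z))) ⟩
      Σ< ρ (λ j → c j * Σ< A (λ z → Φ ρ j (V z)))
        ≡⟨ Σ-cong ρ (λ j _ → trans (cong (c j *_) (Σ-V (Φ ρ j))) (trans (sym (Σ-* ρ (c j) (λ l → c l * Φ ρ j l))) (Σ-cong ρ (λ l _ → sym (*-assoc (c j) (c l) (Φ ρ j l)))))) ⟩
      weighted ∎
      where
      open ≡-Reasoning
      ρ = r A

    PP : ℕ
    PP = Σ< A (λ i → Σ< A (λ d → 2 ^ (r A ∸ w i (suc d))))

    V-+ : ∀ i d → V (i + d) ≡ V i + w i d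
    V-+ i d = w-+ 0 i d

    -- Off the diagonal, an interval from i to a later or an earlier residue gives one summand of Φ
    -- each. An interval of full length A returns to i and gives 2^0, so twice the sum has 2 on the
    -- diagonal; the term q A, which stems from the summand A p of S, completes it to q + 2 = 2^ρ +
    -- 1.
    PP≡positions : ∀ q → suc q ≡ 2 ^ r A → q * A + 2 * PP ≡ positions
    PP≡positions q sq = +-cancelˡ-≡ A _ _ (begin
      A + (q * A + 2 * PP)
        ≡⟨ cong (λ z → A + (q * A + 2 * z)) (trans (Σ-cong A inner) (trans (Σ-+ A (λ i → Σ< (A ∸ suc i) (λ d → a′ i (suc i + d))) (λ i → Σ< (suc i) (λ l → b′ l i))) (cong₂ _+_ (Σ-above A a′) (Σ-cong A (λ i _ → lower i))))) ⟩
      A + (q * A + 2 * (Tri A a′ + Σ< A (λ i → Σ< i (λ l → b′ l i) + 1)))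
        ≡⟨ cong (λ z → A + (q * A + 2 * (Tri A a′ + z))) (trans (Σ-+ A (λ i → Σ< i (λ l → b′ l i)) (λ _ → 1)) (cong (Tri A b′ +_) (trans (Σ-const A 1) (*-identityʳ A)))) ⟩
      A + (q * A + 2 * (Tri A a′ + (Tri A b′ + A)))
        ≡⟨ solve 4 (λ a q x y → a :+ (q :* a :+ con 2 :* (x :+ (y :+ a))) := a :+ (a :* ((con 1 :+ q) :+ con 1) :+ con 2 :* (x :+ y))) refl A q (Tri A a′) (Tri A b′) ⟩
      A + (A * (suc q + 1) + 2 * (Tri A a′ + Tri A b′))
        ≡⟨ cong₂ (λ x y → A + (A * (x + 1) + 2 * y)) sq (sym (Tri-+ A a′ b′)) ⟩
      A + (A * (2 ^ ρ + 1) + 2 * Tri A (λ i z → Φ ρ (V i) (V z)))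
        ≡⟨ cong (λ x → A + (x + 2 * Tri A (λ i z → Φ ρ (V i) (V z)))) (trans (sym (Σ-const A (2 ^ ρ + 1))) (Σ-cong A (λ i _ → sym (Φ-diag ρ (V i))))) ⟩
      A + (Σ< A (λ i → Φ ρ (V i) (V i)) + 2 * Tri A (λ i z → Φ ρ (V i) (V z)))
        ≡⟨ cong (A +_) (Σ-square A (λ i z → Φ ρ (V i) (V z)) (λ i z → Φ-sym ρ (V i) (V z))) ⟨
      A + positions ∎)
      where
      open ≡-Reasoning
      open +-*-Solver using (solve; _:+_; _:*_; _:=_; con)
      ρ = r A
      a′ b′ : ℕ → ℕ → ℕ
      a′ i z = 2 ^ (ρ ∸ ∣ V i - V z ∣)
      b′ i z = 2 ^ ∣ V i - V z ∣
      lower : ∀ i → Σ< (suc i) (λ l → b′ l i) ≡ Σ< i (λ l → b′ l i) + 1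
      lower i = trans (Σ-last i (λ l → b′ l i)) (cong (λ z → Σ< i (λ l → b′ l i) + 2 ^ z) (∣n-n∣≡0 (V i)))
      inner : ∀ i → i < A → Σ< A (λ d → 2 ^ (ρ ∸ w i (suc d)))
              ≡ Σ< (A ∸ suc i) (λ d → a′ i (suc i + d)) + Σ< (suc i) (λ l → b′ l i)
      inner i i<A = begin
        Σ< A term                                                       ≡⟨ cong (λ z → Σ< z term) (sym (m∸n+n≡m i<A)) ⟩
        Σ< (A ∸ suc i + suc i) term                                     ≡⟨ Σ-split (A ∸ suc i) (suc i) term ⟩
        Σ< (A ∸ suc i) term + Σ< (suc i) (λ l → term (A ∸ suc i + l))   ≡⟨ cong₂ _+_ (Σ-cong (A ∸ suc i) above) (Σ-cong (suc i) below) ⟩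
        Σ< (A ∸ suc i) (λ d → a′ i (suc i + d)) + Σ< (suc i) (λ l → b′ l i) ∎
        where
        term : ℕ → ℕ
        term d = 2 ^ (ρ ∸ w i (suc d))
        above : ∀ d → d < A ∸ suc i → term d ≡ a′ i (suc i + d)
        above d _ = cong (λ z → 2 ^ (ρ ∸ z)) (sym (trans (cong (λ z → ∣ V i - z ∣) (trans (cong V (sym (+-suc i d))) (V-+ i (suc d)))) (∣m-m+n∣≡n (V i) (w i (suc d)))))
        -- This interval ends at A + l, so what it lacks of a full period are the elements of (l,
        -- i].
        below : ∀ l → l < suc i → term (A ∸ suc i + l) ≡ b′ l i
        below l l≤i = cong (2 ^_) (trans ρ∸w (sym (trans (cong (λ z → ∣ V l - z ∣) Vi) (∣m-m+n∣≡n (V l) e))))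
          where
          wi = w i (suc (A ∸ suc i + l))
          e = w l (i ∸ l)
          Vi : V i ≡ V l + e
          Vi = trans (cong V (sym (m+[n∸m]≡n (≤-pred l≤i)))) (V-+ l (i ∸ l))
          pos : i + suc (A ∸ suc i + l) ≡ A + l
          pos = trans (solve 3 (λ i x l → i :+ (con 1 :+ (x :+ l)) := (x :+ (con 1 :+ i)) :+ l) refl i (A ∸ suc i) l) (cong (_+ l) (m∸n+n≡m i<A))
          e+w : e + wi ≡ ρ
          e+w = +-cancelˡ-≡ (V l) _ _ (begin
            V l + (e + wi)     ≡⟨ +-assoc (V l) e wi ⟨
            V l + e + wi       ≡⟨ cong (_+ wi) Vi ⟨
            V i + wi           ≡⟨ V-+ i (suc (A ∸ suc i + l)) ⟨
            V (i + suc (A ∸ suc i + l)) ≡⟨ cong V pos ⟩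
            V (A + l)          ≡⟨ w-+A 0 l ⟩
            ρ + V l            ≡⟨ +-comm ρ (V l) ⟩
            V l + ρ            ∎)
          ρ∸w : ρ ∸ wi ≡ e
          ρ∸w = trans (cong (_∸ wi) (sym e+w)) (m+n∸n≡m e wi)

    PP≡Gsum : ∀ q → suc q ≡ 2 ^ r A → q * A + 2 * PP ≡ Gsum A
    PP≡Gsum q sq = trans (PP≡positions q sq) (trans positions≡weighted (sym Gsum≡weighted))

-- Choice of parameters and numerical constants

module Constants where

  open import Defs
  open import Data.Nat
  open import Data.Nat.Properties
  open import Data.Nat.DivMod using (m%n<n)
  open import Data.Nat.Divisibility using (divides)
  open import Data.Nat.Primality using (Prime; prime⇒irreducible)
  open import Data.Nat.Coprimality using (Coprime)
  open import Data.Nat.Solver using (module +-*-Solver)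
  open import Data.Unit using (tt)
  open import Data.List using (length; applyUpTo)
  open import Data.List.Properties using (length-applyUpTo)
  import Data.List.Relation.Unary.All.Properties as Allₚ
  import Data.List.Relation.Unary.AllPairs.Properties as AllPairsₚ
  open import Data.Product using (_×_; _,_; proj₁; ∃)
  open import Data.Sum using (inj₁; inj₂; [_,_]′)
  open import Relation.Binary.PropositionalEquality as ≡ using (_≡_; refl; sym; trans; cong; cong₂; subst)
  open import Relation.Nullary using (¬_; yes; no; contradiction)
  open FiniteSums
  open PrimeFields
  open SignPatterns
  open LongRuns
  open SquaresModAp
  open GapAsymptotics
  open MainTerm

  integer-root : ∀ e p → 1 ≤ e → 1 ≤ p → ∃ λ u → 1 ≤ u × u ^ e ≤ p × p < suc u ^ e
  integer-root e@(suc _) (suc zero)    1≤e 1≤p = 1 , ≤-refl , ≤-reflexive (^-zeroˡ e) , ≤-trans (≤-reflexive refl) (m≤m*n 2 (2 ^ pred e) {{m^n≢0 2 (pred e)}})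
  integer-root e (suc p@(suc _)) 1≤e 1≤p with integer-root e p 1≤e (s≤s z≤n)
  ... | u , 1≤u , lo , hi with suc p <? suc u ^ e
  ...   | yes lt = u , 1≤u , m≤n⇒m≤1+n lo , lt
  ...   | no ge  = suc u , s≤s z≤n , ≮⇒≥ ge , ≤-<-trans hi (^-monoˡ-< e {{>-nonZero 1≤e}} (n<1+n (suc u)))

  prime-odd : ∀ p → Prime p → 2 < p → ∃ λ n → p ≡ suc (n + n)
  prime-odd p pr 2<p with halve p
  ... | n , lo , hi with m≤n⇒m<n∨m≡n lo
  ...   | inj₁ lt = n , ≤-antisym hi lt
  ...   | inj₂ eq = contradiction (prime⇒irreducible pr (divides n (trans (sym eq) (trans (cong (n +_) (sym (+-identityʳ n))) (*-comm 2 n)))))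
          [ (λ ()) , (λ e → <⇒≢ 2<p e) ]′

  x<2^x : ∀ x → suc x ≤ 2 ^ x
  x<2^x zero    = ≤-refl
  x<2^x (suc x) = ≤-trans (+-mono-≤ (m^n>0 2 x) (x<2^x x)) (≤-reflexive (cong (2 ^ x +_) (sym (+-identityʳ (2 ^ x)))))

  ^-distribʳ-* : ∀ e x y → (x * y) ^ e ≡ x ^ e * y ^ e
  ^-distribʳ-* zero    x y = refl
  ^-distribʳ-* (suc e) x y = trans (cong (x * y *_) (^-distribʳ-* e x y)) ([m*n]*[o*p]≡[m*o]*[n*p] x y (x ^ e) (y ^ e))

  -- With q = u / e one has u ≤ e (q + 1) ≤ e · 2^q.
  u^e≤2^u : ∀ e .{{_ : NonZero e}} u {t} → t ≡ e ^ e → u ^ e ≤ t * 2 ^ u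
  u^e≤2^u e u refl = begin
    u ^ e                        ≤⟨ ^-monoˡ-≤ e u≤ ⟩
    (e * 2 ^ q) ^ e              ≡⟨ ^-distribʳ-* e e (2 ^ q) ⟩
    e ^ e * (2 ^ q) ^ e          ≡⟨ cong (e ^ e *_) (^-*-assoc 2 q e) ⟩
    e ^ e * 2 ^ (q * e)          ≤⟨ *-monoʳ-≤ (e ^ e) (^-monoʳ-≤ 2 (m/n*n≤m u e)) ⟩
    e ^ e * 2 ^ u                ∎
    where
    open ≤-Reasoning
    open import Data.Nat.DivMod using (m/n*n≤m; m≡m%n+[m/n]*n)
    q = u / e
    u≤ : u ≤ e * 2 ^ q
    u≤ = begin
      u                   ≡⟨ m≡m%n+[m/n]*n u e ⟩
      u % e + q * e       ≤⟨ +-monoˡ-≤ (q * e) (<⇒≤ (m%n<n u e)) ⟩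
      e + q * e           ≡⟨ *-comm (suc q) e ⟩
      e * suc q           ≤⟨ *-monoʳ-≤ e (x<2^x q) ⟩
      e * 2 ^ q           ∎

  -- For u = ⌊p^(1/40)⌋: p ≤ c₀ u^40, sign patterns are counted up to c₁ u^21, and runs of equal
  -- signs are shorter than c₃ u^16.
  abstract
    c₀ c₁ c₂ c₃ c₄ c₅ : ℕ
    c₀ = 2 ^ 40
    c₁ = 2 ^ 45 * 20 ^ 20
    -- Just enough for κ M to exceed 8 b, which `run-bound` forbids.
    c₂ = 8 * c₁ + 1
    c₃ = 2 ^ 280
    c₄ = 20 ^ 20
    c₅ = 1024 ^ 24

    c₀≡ : c₀ ≡ 2 ^ 40
    c₀≡ = refl

    c₂≡ : c₂ ≡ 8 * c₁ + 1
    c₂≡ = refl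

    c₄≡ : c₄ ≡ 20 ^ 20
    c₄≡ = refl

    c₅≡ : c₅ ≡ 1024 ^ 24
    c₅≡ = refl

    -- Covers the error (9 c₀ + 2) (u + 1) u^20 of a pattern count, with u + 1 ≤ 2 u.
    c₁-char : (9 * c₀ + 2) * 2 ≤ c₁
    c₁-char = ≤ᵇ⇒≤ _ _ tt

    -- Makes p / 2^u at most c₁ u^21, through u^20 ≤ c₄ 2^u.
    c₁-tail : c₀ * c₄ ≤ c₁
    c₁-tail = ≤ᵇ⇒≤ _ _ tt

    c₀≤c₁ : c₀ ≤ c₁
    c₀≤c₁ = ≤ᵇ⇒≤ _ _ tt

    4≤c₂ : 4 ≤ c₂
    4≤c₂ = ≤ᵇ⇒≤ _ _ tt

    -- For u ≥ 1024 this puts 10 c₂ u^26, which bounds twice the product of divisor and position,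
    -- below u^40 ≤ p.
    c₂-small : 10 * c₂ < 1024 ^ 14
    c₂-small = ≤ᵇ⇒≤ _ _ tt

    c₃-run : c₂ + 5 ≤ c₃
    c₃-run = ≤ᵇ⇒≤ _ _ tt

    -- In fact an equality; it makes c₃ u^16 at least p for all u ≤ 1024, the range that `c₂-small`
    -- leaves out.
    c₃-trivial : c₀ * c₅ ≤ c₃
    c₃-trivial = ≤ᵇ⇒≤ _ _ tt

  double-^ : ∀ e u {t} → t ≡ 2 ^ e → (2 * u) ^ e ≡ t * u ^ e
  double-^ e u refl = ^-distribʳ-* e 2 u

  pow-mono : ∀ e x y → x ≤ y → x ^ e ≤ y ^ e
  pow-mono e x y le = ^-monoˡ-≤ e le

  1≤u^ : ∀ {u} e → 1 ≤ u → 1 ≤ u ^ e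
  1≤u^ {u} e 1≤u = ≤-trans (≤-reflexive (sym (^-zeroˡ e))) (pow-mono e 1 u 1≤u)

  pow-+ : ∀ x d e → x ^ (d + e) ≡ x ^ d * x ^ e
  pow-+ = ^-distribˡ-+-*

  root-upper : ∀ e u p {t} → t ≡ 2 ^ e → 1 ≤ u → p < suc u ^ e → p ≤ t * u ^ e
  root-upper e u p {t} t≡ 1≤u hi = begin
    p               ≤⟨ <⇒≤ hi ⟩
    suc u ^ e       ≤⟨ pow-mono e (suc u) (2 * u) (≤-trans (+-monoˡ-≤ u 1≤u) (≤-reflexive (cong (u +_) (sym (+-identityʳ u))))) ⟩
    (2 * u) ^ e     ≡⟨ double-^ e u t≡ ⟩
    t * u ^ e       ∎
    where open ≤-Reasoning

  module Parameters (n : ℕ) (1≤n : 1 ≤ n) (pr : Prime (suc (n + n)))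
    (A : ℕ) (1≤A : 1 ≤ A) (cop : Coprime A (suc (n + n)))
    (u : ℕ) (1≤u : 1 ≤ u) (lo : u ^ 40 ≤ suc (n + n)) (p≤ : suc (n + n) ≤ c₀ * u ^ 40)
    (Abound : A * suc u ≤ suc (n + n)) where

    module F = PrimeField n 1≤n pr
    open F using (p; 2<p; _≈_; <⇒≉0; 1≉0; -1ₚ; 0^n; %≈; <⇒≡)
    module P = Patterns n 1≤n pr
    module C = Counting n 1≤n pr A 1≤A cop
    module Rd = Reduction n 1≤n pr A 1≤A cop
    open Rd using (τ; τ-sign)
    open P using (IsSign; Shifts; patCount)

    b H : ℕ
    b = c₁ * u ^ 21
    H = c₃ * u ^ 16

    u^20*u^20 : u ^ 20 * u ^ 20 ≡ u ^ 40
    u^20*u^20 = sym (pow-+ u 20 20)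

    -- p is at most c₀ u^20 · u^20, and one factor u^20 is exchanged for c₄ 2^u.
    tail-bound : p ≤ 2 ^ u * b
    tail-bound = begin
      p                                 ≤⟨ p≤ ⟩
      c₀ * u ^ 40                       ≡⟨ cong (c₀ *_) (sym u^20*u^20) ⟩
      c₀ * (u ^ 20 * u ^ 20)            ≤⟨ *-monoʳ-≤ c₀ (*-mono-≤ (u^e≤2^u 20 u c₄≡) (m≤n*m (u ^ 20) u {{>-nonZero 1≤u}})) ⟩
      c₀ * (c₄ * 2 ^ u * u ^ 21)        ≡⟨ shuffle c₀ c₄ (2 ^ u) (u ^ 21) ⟩
      2 ^ u * (c₀ * c₄ * u ^ 21)        ≤⟨ *-monoʳ-≤ (2 ^ u) (*-monoˡ-≤ (u ^ 21) c₁-tail) ⟩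
      2 ^ u * b                         ∎
      where
      open ≤-Reasoning
      open +-*-Solver using (solve; _:*_; _:=_)
      shuffle : ∀ c t v w → c * (t * v * w) ≡ v * (c * t * w)
      shuffle = solve 4 (λ c t v w → c :* (t :* v :* w) := v :* (c :* t :* w)) refl

    pats : ∀ τ′ → IsSign τ′ → ∀ L → Shifts L → length L ≤ u → Near (2 ^ length L * patCount τ′ L) p (2 ^ length L * b)
    pats τ′ sg L sh le with m≤n⇒m<n∨m≡n 1≤u
    -- For u = 1 the error b is at least p and the estimate is trivial; the other case uses u ≥ 2 in
    -- `big`.
    ... | inj₂ refl = trivial
      where
      p≤b : p ≤ b
      p≤b = ≤-trans p≤ (*-mono-≤ c₀≤c₁ (≤-reflexive (trans (^-zeroˡ 40) (sym (^-zeroˡ 21)))))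
      trivial : Near (2 ^ length L * patCount τ′ L) p (2 ^ length L * b)
      trivial = ≤-trans (*-monoʳ-≤ (2 ^ length L) (≤-trans (count≤ p (P.pat τ′ L)) p≤b)) (m≤n+m _ p) ,
                ≤-trans p≤b (≤-trans (m≤n*m b (2 ^ length L) {{m^n≢0 2 (length L)}}) (m≤n+m _ (2 ^ length L * patCount τ′ L)))
    ... | inj₁ 2≤u = near-weaken (*-monoʳ-≤ (2 ^ length L) bound≤b) (patCount-near L sh le)
      where
      open ≤-Reasoning
      open +-*-Solver using (solve; _:+_; _:*_; _:=_; con)
      big : 14 * u ^ 20 + 7 * (2 + u) < p
      big = begin-strict
        14 * u ^ 20 + 7 * (2 + u)
          ≤⟨ +-monoʳ-≤ (14 * u ^ 20) (*-monoʳ-≤ 7 (+-mono-≤ (≤-trans 2≤u u≤) u≤)) ⟩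
        14 * u ^ 20 + 7 * (u ^ 20 + u ^ 20)
          ≡⟨ solve 1 (λ x → con 14 :* x :+ con 7 :* (x :+ x) := con 28 :* x) refl (u ^ 20) ⟩
        28 * u ^ 20
          <⟨ *-monoˡ-< (u ^ 20) {{>-nonZero (1≤u^ 20 1≤u)}} (≤-trans (≤ᵇ⇒≤ 29 (2 ^ 20) tt) (pow-mono 20 2 u 2≤u)) ⟩
        u ^ 20 * u ^ 20
          ≡⟨ u^20*u^20 ⟩
        u ^ 40
          ≤⟨ lo ⟩
        p ∎
        where
        u≤ : u ≤ u ^ 20
        u≤ = m≤m*n u (u ^ 19) {{>-nonZero (1≤u^ 19 1≤u)}}
      open P.Equidistribution τ′ sg u (u ^ 20) c₀ (1≤u^ 20 1≤u) (≤-trans (≤-reflexive u^20*u^20) lo)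
        (≤-trans p≤ (≤-reflexive (cong (c₀ *_) (sym u^20*u^20)))) big
      bound≤b : bound ≤ b
      bound≤b = begin
        (9 * c₀ + 2) * (suc u * u ^ 20)       ≤⟨ *-monoʳ-≤ (9 * c₀ + 2) (*-monoˡ-≤ (u ^ 20) (+-monoˡ-≤ u 1≤u)) ⟩
        (9 * c₀ + 2) * ((u + u) * u ^ 20)     ≡⟨ shuffle (9 * c₀ + 2) u (u ^ 20) ⟩
        (9 * c₀ + 2) * 2 * (u * u ^ 20)       ≤⟨ *-monoˡ-≤ (u * u ^ 20) c₁-char ⟩
        b                                     ∎
        where
        shuffle : ∀ c u x → c * ((u + u) * x) ≡ c * 2 * (u * x)
        shuffle = solve 3 (λ c u x → c :* ((u :+ u) :* x) := c :* con 2 :* (u :* x)) refl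

    no-sign-zero : ∀ {x} → IsSign x → ¬ (x ≈ 0)
    no-sign-zero (inj₁ x≈1)  e = 1≉0 (F.trans (F.sym x≈1) e)
    no-sign-zero (inj₂ x≈-1) e = 1≉0 (F.trans (F.sym F.-1*-1) (F.trans (F.*-congˡ { -1ₚ} (F.trans (F.sym x≈-1) e)) (F.zeroʳ -1ₚ)))

    noRun : ∀ c → ¬ (∀ h → h < H → (c + h) F.^ n ≈ τ)
    noRun c run with ≤-total 1024 u
    -- Here H is at least p, so the run would contain the residue 0, whose n-th power is 0 and not a
    -- sign.
    ... | inj₂ u≤1024 = no-sign-zero τ-sign (F.trans (F.sym (run h (<-≤-trans (m%n<n (F.- c) p) p≤H))) (0^n zero≈))
      where
      open ≤-Reasoning
      h = (F.- c) % p
      zero≈ : c + h ≈ 0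
      zero≈ = F.trans (F.+-congˡ {c} (%≈ (F.- c))) (F.-‿inverseʳ c)
      p≤H : p ≤ H
      p≤H = begin
        p                              ≤⟨ p≤ ⟩
        c₀ * u ^ 40                    ≡⟨ cong (c₀ *_) (pow-+ u 24 16) ⟩
        c₀ * (u ^ 24 * u ^ 16)         ≤⟨ *-monoʳ-≤ c₀ (*-monoˡ-≤ (u ^ 16) (subst (u ^ 24 ≤_) (sym c₅≡) (pow-mono 24 u 1024 u≤1024))) ⟩
        c₀ * (c₅ * u ^ 16)             ≡⟨ *-assoc c₀ c₅ (u ^ 16) ⟨
        c₀ * c₅ * u ^ 16               ≤⟨ *-monoˡ-≤ (u ^ 16) c₃-trivial ⟩
        H                              ∎
    -- With κ = u^5, L = 4 κ², M = c₂ u^16 and K = u, the product κ M exceeds 8 b, while (L + κ) M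
    -- is of order u^26 and the run length needed, M + (L + κ) K, only of order u^16.
    ... | inj₁ 1024≤u = <⇒≱ too-big (Runs.run-bound n 1≤n pr κ (4 * κ * κ) M u b c τ H τ-sign (1≤u^ 5 1≤u) ≤-refl 4κ≤M small fits run few)
      where
      open ≤-Reasoning
      open +-*-Solver using (solve; _:+_; _:*_; _:=_; con)
      κ = u ^ 5
      M = c₂ * u ^ 16
      κκ : κ * κ ≡ u ^ 10
      κκ = sym (pow-+ u 5 5)
      κ≤κκ : κ ≤ κ * κ
      κ≤κκ = m≤m*n κ κ {{>-nonZero (1≤u^ 5 1≤u)}}
      L+κ≤ : 4 * κ * κ + κ ≤ 5 * u ^ 10
      L+κ≤ = begin
        4 * κ * κ + κ           ≤⟨ +-monoʳ-≤ (4 * κ * κ) κ≤κκ ⟩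
        4 * κ * κ + κ * κ       ≡⟨ solve 1 (λ k → con 4 :* k :* k :+ k :* k := con 5 :* (k :* k)) refl κ ⟩
        5 * (κ * κ)             ≡⟨ cong (5 *_) κκ ⟩
        5 * u ^ 10              ∎
      4κ≤M : 4 * κ ≤ M
      4κ≤M = *-mono-≤ 4≤c₂ (^-monoʳ-≤ u {{>-nonZero 1≤u}} (≤ᵇ⇒≤ 5 16 tt))
      small : 2 * ((4 * κ * κ + κ) * M) < p
      small = begin-strict
        2 * ((4 * κ * κ + κ) * M)          ≤⟨ *-monoʳ-≤ 2 (*-monoˡ-≤ M L+κ≤) ⟩
        2 * (5 * u ^ 10 * (c₂ * u ^ 16))   ≡⟨ solve 3 (λ x c y → con 2 :* (con 5 :* x :* (c :* y)) := con 10 :* c :* (x :* y)) refl (u ^ 10) c₂ (u ^ 16) ⟩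
        10 * c₂ * (u ^ 10 * u ^ 16)        ≡⟨ cong (10 * c₂ *_) (pow-+ u 10 16) ⟨
        10 * c₂ * u ^ 26                   <⟨ *-monoˡ-< (u ^ 26) {{>-nonZero (1≤u^ 26 1≤u)}} (<-≤-trans c₂-small (pow-mono 14 1024 u 1024≤u)) ⟩
        u ^ 14 * u ^ 26                    ≡⟨ pow-+ u 14 26 ⟨
        u ^ 40                             ≤⟨ lo ⟩
        p                                  ∎
      fits : M + (4 * κ * κ + κ) * u ≤ H
      fits = begin
        M + (4 * κ * κ + κ) * u        ≤⟨ +-monoʳ-≤ M (*-monoˡ-≤ u L+κ≤) ⟩
        M + 5 * u ^ 10 * u             ≡⟨ solve 3 (λ m x u → m :+ con 5 :* x :* u := m :+ con 5 :* (u :* x)) refl M (u ^ 10) u ⟩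
        M + 5 * u ^ 11                 ≤⟨ +-monoʳ-≤ M (*-monoʳ-≤ 5 (^-monoʳ-≤ u {{>-nonZero 1≤u}} (≤ᵇ⇒≤ 11 16 tt))) ⟩
        c₂ * u ^ 16 + 5 * u ^ 16       ≡⟨ *-distribʳ-+ (u ^ 16) c₂ 5 ⟨
        (c₂ + 5) * u ^ 16              ≤⟨ *-monoˡ-≤ (u ^ 16) c₃-run ⟩
        H                              ∎
      too-big : 8 * b < κ * M
      too-big = begin-strict
        8 * (c₁ * u ^ 21)              <⟨ m<m+n (8 * (c₁ * u ^ 21)) (1≤u^ 21 1≤u) ⟩
        8 * (c₁ * u ^ 21) + u ^ 21     ≡⟨ solve 2 (λ c x → con 8 :* (c :* x) :+ x := (con 8 :* c :+ con 1) :* x) refl c₁ (u ^ 21) ⟩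
        (8 * c₁ + 1) * u ^ 21          ≡⟨ cong₂ _*_ (sym c₂≡) (pow-+ u 5 16) ⟩
        c₂ * (u ^ 5 * u ^ 16)          ≡⟨ solve 3 (λ c x y → c :* (x :* y) := x :* (c :* y)) refl c₂ (u ^ 5) (u ^ 16) ⟩
        κ * M                          ∎
      few : ∀ τ′ → IsSign τ′ → patCount τ′ (applyUpTo suc u) ≤ 2 * b
      -- u forms bring the main term down to p / 2^u, which by `tail-bound` is no larger than the
      -- error b.
      few τ′ sg = *-cancelˡ-≤ (2 ^ u) {{m^n≢0 2 u}} (begin
        2 ^ u * patCount τ′ bs         ≤⟨ proj₁ (subst (λ z → Near (2 ^ z * patCount τ′ bs) p (2 ^ z * b)) (length-applyUpTo suc u) (pats τ′ sg bs ok (≤-reflexive (length-applyUpTo suc u)))) ⟩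
        p + 2 ^ u * b                  ≤⟨ +-monoˡ-≤ (2 ^ u * b) tail-bound ⟩
        2 ^ u * b + 2 ^ u * b          ≡⟨ solve 2 (λ x b → x :* b :+ x :* b := x :* (con 2 :* b)) refl (2 ^ u) b ⟩
        2 ^ u * (2 * b)                ∎)
        where
        bs = applyUpTo suc u
        u<p : ∀ {i} → i < u → suc i < p
        u<p {i} i<u = ≤-<-trans i<u (<-≤-trans (n<1+n u) (≤-trans (m≤n*m (suc u) A {{>-nonZero 1≤A}}) Abound))
        ok : Shifts bs
        ok = AllPairsₚ.applyUpTo⁺₁ suc u (λ {i} {j} i<j j<u e → <⇒≢ i<j (suc-injective (sym (<⇒≡ (u<p j<u) (u<p (<-trans i<j j<u)) e)))) ,
             Allₚ.applyUpTo⁺₁ suc u (λ i<u → <⇒≉0 z<s (u<p i<u))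

    module B = C.Bounds u b H (pats τ τ-sign) tail-bound Abound noRun

    near-G : ∀ q → suc q ≡ 2 ^ r A → 1 ≤ q →
             Near (q * SR (A * p)) (Gsum A * p) (q * (10 * (A * A * H * (2 * b))))
    near-G q sq 1≤q = subst (λ z → Near (q * SR (A * p)) (z * p) (q * (10 * (A * A * H * (2 * b)))))
      (Main.PP≡Gsum A 1≤A q sq) (B.main-near q sq 1≤q (*-mono-≤ (≤-trans (≤-trans (s≤s z≤n) (m≤n+m 5 c₂)) c₃-run) (1≤u^ 16 1≤u)))

-- Passage to the rational statement

module RationalForm where

  open import Defs
  open import Data.Nat as ℕ using (ℕ; zero; suc)
  import Data.Nat.Properties as ℕₚ
  open import Data.Integer as ℤ using (+_)
  import Data.Integer.Properties as ℤₚ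
  open import Data.Rational as ℚ using (ℚ; 0ℚ; 1ℚ; ½; ∣_∣; Positive; toℚᵘ; _÷_; ≢-nonZero)
  open import Data.Rational.Properties as ℚₚ using (_≟_)
  open import Data.Rational.Unnormalised as ℚᵘ using (mkℚᵘ; *≡*; *≤*; _≃_)
  import Data.Rational.Unnormalised.Properties as ℚᵘₚ
  open import Data.Rational.Solver using (module +-*-Solver)
  open import Data.List using (map; applyUpTo; foldr)
  open import Data.Product using (_,_)
  open import Data.Sum using (inj₁; inj₂)
  open import Function using (_∘_; id)
  open import Relation.Binary.PropositionalEquality
  open import Relation.Nullary using (¬_; yes; no; contradiction)
  open FiniteSums
  open MainTerm using (Gsum)

  ι : ℕ → ℚ
  ι n = + n ℚ./ 1

  toℚᵘ-ι : ∀ n → toℚᵘ (ι n) ≃ mkℚᵘ (+ n) 0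
  toℚᵘ-ι n = ℚₚ.toℚᵘ-fromℚᵘ (mkℚᵘ (+ n) 0)

  ι-+ : ∀ m n → ι (m ℕ.+ n) ≡ ι m ℚ.+ ι n
  ι-+ m n = ℚₚ.toℚᵘ-injective (ℚᵘₚ.≃-trans (toℚᵘ-ι (m ℕ.+ n)) (ℚᵘₚ.≃-sym
    (ℚᵘₚ.≃-trans (ℚₚ.toℚᵘ-homo-+ (ι m) (ι n)) (ℚᵘₚ.≃-trans (ℚᵘₚ.+-cong (toℚᵘ-ι m) (toℚᵘ-ι n)) (*≡* eq)))))
    where
    eq : ((+ m) ℤ.* (+ 1) ℤ.+ (+ n) ℤ.* (+ 1)) ℤ.* (+ 1) ≡ (+ (m ℕ.+ n)) ℤ.* (+ 1)
    eq = cong (ℤ._* (+ 1)) (trans (cong₂ ℤ._+_ (ℤₚ.*-identityʳ (+ m)) (ℤₚ.*-identityʳ (+ n))) refl)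

  ι-* : ∀ m n → ι (m ℕ.* n) ≡ ι m ℚ.* ι n
  ι-* m n = ℚₚ.toℚᵘ-injective (ℚᵘₚ.≃-trans (toℚᵘ-ι (m ℕ.* n)) (ℚᵘₚ.≃-sym
    (ℚᵘₚ.≃-trans (ℚₚ.toℚᵘ-homo-* (ι m) (ι n)) (ℚᵘₚ.≃-trans (ℚᵘₚ.*-cong (toℚᵘ-ι m) (toℚᵘ-ι n)) (*≡* eq)))))
    where
    eq : ((+ m) ℤ.* (+ n)) ℤ.* (+ 1) ≡ (+ (m ℕ.* n)) ℤ.* (+ 1)
    eq = cong (ℤ._* (+ 1)) (sym (ℤₚ.pos-* m n))

  ι-mono : ∀ {m n} → m ℕ.≤ n → ι m ℚ.≤ ι n
  ι-mono {m} {n} le = ℚₚ.toℚᵘ-cancel-≤ (ℚᵘₚ.≤-trans (ℚᵘₚ.≤-reflexive (toℚᵘ-ι m))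
    (ℚᵘₚ.≤-trans (*≤* (ℤₚ.*-monoʳ-≤-nonNeg (+ 1) (ℤ.+≤+ le))) (ℚᵘₚ.≤-reflexive (ℚᵘₚ.≃-sym (toℚᵘ-ι n)))))

  ι-pos : ∀ n → 1 ℕ.≤ n → Positive (ι n)
  ι-pos n le = ℚ.positive (ℚₚ.<-≤-trans (ℚ.*<* (ℤ.+<+ (ℕ.s≤s ℕ.z≤n))) (ι-mono le))

  open +-*-Solver using (solve; _:+_; _:*_; _:-_; :-_; _:=_; con)

  near⇒≤ : ∀ {a b B} → Near a b B → ∣ ι a ℚ.- ι b ∣ ℚ.≤ ι B
  near⇒≤ {a} {b} {B} (le , ge) with ℚₚ.∣p∣≡p∨∣p∣≡-p (ι a ℚ.- ι b)
  ... | inj₁ e = ℚₚ.≤-trans (ℚₚ.≤-reflexive e) (ℚₚ.≤-trans (ℚₚ.+-monoˡ-≤ (ℚ.- ι b) (ℚₚ.≤-trans (ι-mono le) (ℚₚ.≤-reflexive (ι-+ b B))))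
          (ℚₚ.≤-reflexive (solve 2 (λ b B → b :+ B :+ (:- b) := B) refl (ι b) (ι B))))
  ... | inj₂ e = ℚₚ.≤-trans (ℚₚ.≤-reflexive (trans e (solve 2 (λ a b → :- (a :- b) := b :- a) refl (ι a) (ι b))))
          (ℚₚ.≤-trans (ℚₚ.+-monoˡ-≤ (ℚ.- ι a) (ℚₚ.≤-trans (ι-mono ge) (ℚₚ.≤-reflexive (ι-+ a B))))
          (ℚₚ.≤-reflexive (solve 2 (λ b B → b :+ B :+ (:- b) := B) refl (ι a) (ι B))))

  -- The rational x enters only through x q = G, so after multiplication by q the claim is one about
  -- natural numbers.
  quotient-bound : ∀ S G p q B x → 1 ℕ.≤ q → x ℚ.* ι q ≡ ι G → Near (q ℕ.* S) (G ℕ.* p) (q ℕ.* B) →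
                   ∣ ι S ℚ.- x ℚ.* ι p ∣ ℚ.≤ ι B
  quotient-bound S G p q B x 1≤q xq near = ℚₚ.*-cancelʳ-≤-pos (ι q) {{ι-pos q 1≤q}} (begin
    ∣ y ∣ ℚ.* ι q            ≡⟨ cong (∣ y ∣ ℚ.*_) (ℚₚ.0≤p⇒∣p∣≡p (ι-mono {0} {q} ℕ.z≤n)) ⟨
    ∣ y ∣ ℚ.* ∣ ι q ∣        ≡⟨ ℚₚ.∣p*q∣≡∣p∣*∣q∣ y (ι q) ⟨
    ∣ y ℚ.* ι q ∣            ≡⟨ cong ∣_∣ y*q ⟩
    ∣ ι (q ℕ.* S) ℚ.- ι (G ℕ.* p) ∣ ≤⟨ near⇒≤ near ⟩
    ι (q ℕ.* B)              ≡⟨ trans (ι-* q B) (ℚₚ.*-comm (ι q) (ι B)) ⟩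
    ι B ℚ.* ι q              ∎)
    where
    open ℚₚ.≤-Reasoning
    y = ι S ℚ.- x ℚ.* ι p
    y*q : y ℚ.* ι q ≡ ι (q ℕ.* S) ℚ.- ι (G ℕ.* p)
    y*q = trans (solve 4 (λ s x p q → (s :- x :* p) :* q := q :* s :- (x :* q) :* p) refl (ι S) x (ι p) (ι q))
      (cong₂ ℚ._-_ (sym (ι-* q S)) (trans (cong (ℚ._* ι p) xq) (sym (ι-* G p))))

  ι-^ : ∀ n e → ι n ^ℚ e ≡ ι (n ℕ.^ e)
  ι-^ n zero    = refl
  ι-^ n (suc e) = trans (cong (ι n ℚ.*_) (ι-^ n e)) (sym (ι-* n (n ℕ.^ e)))

  ^ℚ-nonNeg : ∀ x e → 0ℚ ℚ.≤ x → 0ℚ ℚ.≤ x ^ℚ e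
  ^ℚ-nonNeg x zero    0≤x = ι-mono {0} {1} ℕ.z≤n
  ^ℚ-nonNeg x (suc e) 0≤x = ℚₚ.≤-trans (ℚₚ.≤-reflexive (sym (ℚₚ.*-zeroʳ x))) (ℚₚ.*-monoˡ-≤-nonNeg x {{ℚ.nonNegative 0≤x}} (^ℚ-nonNeg x e 0≤x))

  ^ℚ-mono : ∀ x y e → 0ℚ ℚ.≤ x → x ℚ.≤ y → x ^ℚ e ℚ.≤ y ^ℚ e
  ^ℚ-mono x y zero    0≤x le = ℚₚ.≤-refl
  ^ℚ-mono x y (suc e) 0≤x le = ℚₚ.≤-trans
    (ℚₚ.*-monoʳ-≤-nonNeg (x ^ℚ e) {{ℚ.nonNegative (^ℚ-nonNeg x e 0≤x)}} le)
    (ℚₚ.*-monoˡ-≤-nonNeg y {{ℚ.nonNegative (ℚₚ.≤-trans 0≤x le)}} (^ℚ-mono x y e 0≤x le))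

  sumℚ-scale : ∀ n (h : ℕ → ℚ) (H : ℕ → ℕ) c → (∀ k → k ℕ.< n → h k ℚ.* c ≡ ι (H k)) → sumℚ n h ℚ.* c ≡ ι (Σ< n H)
  sumℚ-scale n h H c e = go n id e
    where
    go : ∀ n g → (∀ k → k ℕ.< n → h (g k) ℚ.* c ≡ ι (H (g k))) → foldr ℚ._+_ 0ℚ (map h (applyUpTo g n)) ℚ.* c ≡ ι (Σ< n (H ∘ g))
    go zero    g e = ℚₚ.*-zeroˡ c
    go (suc n) g e = trans (ℚₚ.*-distribʳ-+ c (h (g 0)) _)
      (trans (cong₂ ℚ._+_ (e 0 ℕ.z<s) (go n (g ∘ suc) (λ k k<n → e (suc k) (ℕ.s<s k<n)))) (sym (ι-+ (H (g 0)) _)))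

  ½^*2^ : ∀ k → (½ ^ℚ k) ℚ.* ι (2 ℕ.^ k) ≡ 1ℚ
  ½^*2^ zero    = refl
  ½^*2^ (suc k) = trans (cong ((½ ℚ.* (½ ^ℚ k)) ℚ.*_) (ι-* 2 (2 ℕ.^ k)))
    (trans (solve 4 (λ h x t y → (h :* x) :* (t :* y) := (h :* t) :* (x :* y)) refl ½ (½ ^ℚ k) (ι 2) (ι (2 ℕ.^ k)))
      (trans (cong (½ ℚ.* ι 2 ℚ.*_) (½^*2^ k)) refl))

  ½^*2^r : ∀ r k → k ℕ.≤ r → (½ ^ℚ k) ℚ.* ι (2 ℕ.^ r) ≡ ι (2 ℕ.^ (r ℕ.∸ k))
  ½^*2^r r k k≤r = trans (cong (λ z → (½ ^ℚ k) ℚ.* ι z) (trans (cong (2 ℕ.^_) (sym (ℕₚ.m+[n∸m]≡n k≤r))) (ℕₚ.^-distribˡ-+-* 2 k (r ℕ.∸ k))))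
    (trans (cong ((½ ^ℚ k) ℚ.*_) (ι-* (2 ℕ.^ k) (2 ℕ.^ (r ℕ.∸ k))))
      (trans (sym (ℚₚ.*-assoc (½ ^ℚ k) (ι (2 ℕ.^ k)) (ι (2 ℕ.^ (r ℕ.∸ k)))))
        (trans (cong (ℚ._* ι (2 ℕ.^ (r ℕ.∸ k))) (½^*2^ k)) (ℚₚ.*-identityˡ _))))

  geometric : ∀ r q → suc q ≡ 2 ℕ.^ r → Σ< r (λ k → 2 ℕ.^ (r ℕ.∸ k)) ≡ 2 ℕ.* q
  geometric r q sq = ℕₚ.+-cancelʳ-≡ 2 _ _ (trans (go r) (trans (cong (2 ℕ.*_) (sym sq)) (trans (ℕₚ.*-suc 2 q) (ℕₚ.+-comm 2 (2 ℕ.* q)))))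
    where
    go : ∀ r → Σ< r (λ k → 2 ℕ.^ (r ℕ.∸ k)) ℕ.+ 2 ≡ 2 ℕ.* 2 ℕ.^ r
    go zero    = refl
    go (suc r) = trans (ℕₚ.+-assoc (2 ℕ.^ suc r) _ 2) (trans (cong (2 ℕ.^ suc r ℕ.+_) (go r)) (cong (2 ℕ.^ suc r ℕ.+_) (sym (ℕₚ.+-identityʳ (2 ℕ.* 2 ℕ.^ r)))))

  F-scaled : ∀ A → F A ½ ℚ.* ι (2 ℕ.^ r A) ≡ ι (Gsum A)
  F-scaled A = sumℚ-scale (suc (r A)) (λ k → ι (β A k) ℚ.* (½ ^ℚ k)) (λ k → β A k ℕ.* 2 ℕ.^ (r A ℕ.∸ k)) (ι (2 ℕ.^ r A)) (λ k k≤r →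
    trans (ℚₚ.*-assoc (ι (β A k)) (½ ^ℚ k) (ι (2 ℕ.^ r A)))
      (trans (cong (ι (β A k) ℚ.*_) (½^*2^r (r A) k (ℕₚ.≤-pred k≤r))) (sym (ι-* (β A k) (2 ℕ.^ (r A ℕ.∸ k))))))

  Q-scaled : ∀ A q → suc q ≡ 2 ℕ.^ r A → Q A ½ ℚ.* ι (2 ℕ.^ r A) ≡ ι (2 ℕ.* q)
  Q-scaled A q sq = trans (sumℚ-scale (r A) (½ ^ℚ_) (λ k → 2 ℕ.^ (r A ℕ.∸ k)) (ι (2 ℕ.^ r A)) (λ k k<r → ½^*2^r (r A) k (ℕₚ.<⇒≤ k<r)))
    (cong ι (geometric (r A) q sq))

  -- The factor 2^r turns F(1/2) into `Gsum` and the geometric sum Q(1/2) into 2 q, so 2 F(1/2) /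
  -- Q(1/2) = Gsum / q.
  2f-scaled : ∀ A q → suc q ≡ 2 ℕ.^ r A → 1 ℕ.≤ q → ι 2 ℚ.* f A ½ ℚ.* ι q ≡ ι (Gsum A)
  2f-scaled A q sq 1≤q = trans (solve 3 (λ t f q → t :* f :* q := f :* (t :* q)) refl (ι 2) (f A ½) (ι q))
    (trans (cong (f A ½ ℚ.*_) (trans (sym (ι-* 2 q)) (sym (Q-scaled A q sq))))
      (trans (sym (ℚₚ.*-assoc (f A ½) (Q A ½) (ι (2 ℕ.^ r A))))
        (trans (cong (ℚ._* ι (2 ℕ.^ r A)) (÷-* (F A ½) (Q A ½) Q≢0)) (F-scaled A))))
    where
    Q≢0 : ¬ (Q A ½ ≡ 0ℚ)
    Q≢0 e = contradiction (ℚₚ.positive⁻¹ (ι (2 ℕ.* q)) {{ι-pos (2 ℕ.* q) (ℕₚ.≤-trans 1≤q (ℕₚ.m≤m+n q _))}})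
      (ℚₚ.<-irrefl (trans (sym (trans (cong (ℚ._* ι (2 ℕ.^ r A)) e) (ℚₚ.*-zeroˡ (ι (2 ℕ.^ r A))))) (Q-scaled A q sq)))
    ÷-* : ∀ x y → ¬ (y ≡ 0ℚ) → (x ÷' y) ℚ.* y ≡ x
    ÷-* x y y≢0 with y ≟ 0ℚ
    ... | yes e = contradiction e y≢0
    ... | no ne = trans (ℚₚ.*-assoc x _ y) (trans (cong (x ℚ.*_) (ℚₚ.*-inverseˡ y {{≢-nonZero ne}})) (ℚₚ.*-identityʳ x))

  -- The exponent 0.95 = 19/20 is expressed by comparing 20-th powers, which stay rational.
  power-bound : ∀ e x B T → ∣ x ∣ ℚ.≤ ι B → B ℕ.^ e ℕ.≤ T → (∣ x ∣ ^ℚ e) ℚ.≤ ι T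
  power-bound e x B T le le′ = ℚₚ.≤-trans (^ℚ-mono ∣ x ∣ (ι B) e (ℚₚ.0≤∣p∣ x) le)
    (ℚₚ.≤-trans (ℚₚ.≤-reflexive (ι-^ B e)) (ι-mono le′))

-- The final estimate

open import Defs
open import Data.Nat as ℕ using (ℕ; _≤_)
open import Data.Nat.Primality using (Prime)
open import Data.Nat.Coprimality using (Coprime)
open import Data.Product using (∃)
open import Data.Integer using (+_)
open import Data.Rational as ℚ using (ℚ; ½; ∣_∣)
import Data.Nat.Properties as ℕₚ
open import Data.Nat using (suc; z≤n; s≤s)
open import Data.Nat.Solver using (module +-*-Solver)
open import Data.Product using (_×_; _,_)
open import Data.Sum using (_⊎_; inj₁; inj₂)
open import Data.Unit using (tt)
open import Relation.Binary.PropositionalEquality as ≡ using (_≡_; refl; sym; trans; cong; cong₂; subst)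
open FiniteSums
open GapAsymptotics
open Constants
open RationalForm
open MainTerm using (Gsum)

x≤pow : ∀ x e → 1 ≤ x → x ≤ x ℕ.^ suc e
x≤pow x e 1≤x = ℕₚ.m≤m*n x (x ℕ.^ e) {{ℕ.>-nonZero (1≤u^ e 1≤x)}}

x²≤pow : ∀ x e → 1 ≤ x → x ℕ.* x ≤ x ℕ.^ suc (suc e)
x²≤pow x e 1≤x = ℕₚ.*-monoʳ-≤ x (x≤pow x e 1≤x)

x³≤pow : ∀ x e → 1 ≤ x → x ℕ.* (x ℕ.* x) ≤ x ℕ.^ suc (suc (suc e))
x³≤pow x e 1≤x = ℕₚ.*-monoʳ-≤ x (x²≤pow x e 1≤x)

-- For u ≤ A the product is at most (10 A)², for A ≤ u with u ≥ 2 it is at most u³, and what remains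
-- is A ≤ u = 1.
A[u+1]≤p : ∀ A u p d e → 1 ≤ A → 1 ≤ u → (10 ℕ.* A) ℕ.^ suc (suc d) ≤ p → u ℕ.^ suc (suc (suc e)) ≤ p → A ℕ.* suc u ≤ p
A[u+1]≤p A u p d e 1≤A 1≤u hA hu = byOrder (ℕₚ.≤-total u A) (ℕₚ.m≤n⇒m<n∨m≡n 1≤u)
  where
  open ℕₚ.≤-Reasoning
  2≤10A : 2 ≤ 10 ℕ.* A
  2≤10A = ℕₚ.*-mono-≤ {2} {10} (s≤s (s≤s z≤n)) 1≤A
  1≤10A : 1 ≤ 10 ℕ.* A
  1≤10A = ℕₚ.≤-trans (s≤s z≤n) 2≤10A
  byOrder : u ≤ A ⊎ A ≤ u → (2 ≤ u) ⊎ (1 ≡ u) → A ℕ.* suc u ≤ p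
  byOrder (inj₁ u≤A) _ = begin
    A ℕ.* suc u                        ≤⟨ ℕₚ.*-mono-≤ (ℕₚ.m≤n*m A 10) (ℕₚ.≤-trans (ℕₚ.+-mono-≤ 1≤A u≤A) (ℕₚ.+-monoʳ-≤ A (ℕₚ.m≤m+n A (8 ℕ.* A)))) ⟩
    (10 ℕ.* A) ℕ.* (10 ℕ.* A)          ≤⟨ x²≤pow (10 ℕ.* A) d 1≤10A ⟩
    (10 ℕ.* A) ℕ.^ suc (suc d)         ≤⟨ hA ⟩
    p                                  ∎
  byOrder (inj₂ A≤1) (inj₂ refl) = ℕₚ.≤-trans (ℕₚ.*-monoˡ-≤ 2 A≤1) (ℕₚ.≤-trans 2≤10A (ℕₚ.≤-trans (x≤pow (10 ℕ.* A) (suc d) 1≤10A) hA))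
  byOrder (inj₂ A≤u) (inj₁ 2≤u) = begin
    A ℕ.* suc u                        ≤⟨ ℕₚ.*-mono-≤ A≤u (ℕₚ.≤-trans (ℕₚ.+-monoˡ-≤ u 1≤u) (ℕₚ.≤-trans (ℕₚ.≤-reflexive (cong (u ℕ.+_) (sym (ℕₚ.+-identityʳ u)))) (ℕₚ.*-monoˡ-≤ u 2≤u))) ⟩
    u ℕ.* (u ℕ.* u)                    ≤⟨ x³≤pow u e 1≤u ⟩
    u ℕ.^ suc (suc (suc e))            ≤⟨ hu ⟩
    p                                  ∎

pow-pow : ∀ x a b c → a ℕ.* b ≡ c → (x ℕ.^ a) ℕ.^ b ≡ x ℕ.^ c
pow-pow x a b c e = trans (ℕₚ.^-*-assoc x a b) (cong (x ℕ.^_) e)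

-- With j e = i k, the e-th power of u^j is the k-th power of u^i ≤ p.
error-bound : ∀ e j i k m l X C A u p → X ≤ C ℕ.* (A ℕ.^ l ℕ.* u ℕ.^ j) → u ℕ.^ i ≤ p → j ℕ.* e ≡ i ℕ.* k → l ℕ.* e ≡ m →
              X ℕ.^ e ≤ C ℕ.^ e ℕ.* A ℕ.^ m ℕ.* p ℕ.^ k
error-bound e j i k m l X C A u p h hu je le = begin
  X ℕ.^ e                                             ≤⟨ pow-mono e X (C ℕ.* (A ℕ.^ l ℕ.* u ℕ.^ j)) h ⟩
  (C ℕ.* (A ℕ.^ l ℕ.* u ℕ.^ j)) ℕ.^ e                 ≡⟨ split e C (A ℕ.^ l) (u ℕ.^ j) ⟩
  C ℕ.^ e ℕ.* (A ℕ.^ l) ℕ.^ e ℕ.* (u ℕ.^ j) ℕ.^ e     ≡⟨ cong₂ (λ x y → C ℕ.^ e ℕ.* x ℕ.* y) (pow-pow A l e m le) (trans (pow-pow u j e (i ℕ.* k) je) (sym (pow-pow u i k (i ℕ.* k) refl))) ⟩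
  C ℕ.^ e ℕ.* A ℕ.^ m ℕ.* (u ℕ.^ i) ℕ.^ k             ≤⟨ ℕₚ.*-monoʳ-≤ (C ℕ.^ e ℕ.* A ℕ.^ m) (pow-mono k (u ℕ.^ i) p hu) ⟩
  C ℕ.^ e ℕ.* A ℕ.^ m ℕ.* p ℕ.^ k                     ∎
  where
  open ℕₚ.≤-Reasoning
  split : ∀ e x y z → (x ℕ.* (y ℕ.* z)) ℕ.^ e ≡ x ℕ.^ e ℕ.* y ℕ.^ e ℕ.* z ℕ.^ e
  split e x y z = trans (^-distribʳ-* e x (y ℕ.* z)) (trans (cong (x ℕ.^ e ℕ.*_) (^-distribʳ-* e y z)) (sym (ℕₚ.*-assoc (x ℕ.^ e) (y ℕ.^ e) (z ℕ.^ e))))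

-- The true size A² u^(i + j), with i + j = 37, is rounded up to A³ u^38, since 38/40 is exactly
-- 0.95.
error-size : ∀ k₁ k₃ A u i j → 1 ≤ A → 1 ≤ u →
             10 ℕ.* (A ℕ.* A ℕ.* (k₃ ℕ.* u ℕ.^ i) ℕ.* (2 ℕ.* (k₁ ℕ.* u ℕ.^ j))) ≤ 20 ℕ.* (k₁ ℕ.* k₃) ℕ.* (A ℕ.^ 3 ℕ.* u ℕ.^ suc (i ℕ.+ j))
error-size k₁ k₃ A u i j 1≤A 1≤u = begin
  10 ℕ.* (A ℕ.* A ℕ.* (k₃ ℕ.* x) ℕ.* (2 ℕ.* (k₁ ℕ.* y)))     ≡⟨ shuffle A k₃ x k₁ y ⟩
  20 ℕ.* (k₁ ℕ.* k₃) ℕ.* (A ℕ.* A ℕ.* (x ℕ.* y))             ≤⟨ ℕₚ.*-monoʳ-≤ (20 ℕ.* (k₁ ℕ.* k₃)) (ℕₚ.*-mono-≤ (x²≤pow A 1 1≤A) (ℕₚ.≤-trans (ℕₚ.≤-reflexive (sym (pow-+ u i j))) (ℕₚ.m≤n*m (u ℕ.^ (i ℕ.+ j)) u {{ℕ.>-nonZero 1≤u}}))) ⟩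
  20 ℕ.* (k₁ ℕ.* k₃) ℕ.* (A ℕ.^ 3 ℕ.* u ℕ.^ suc (i ℕ.+ j))   ∎
  where
  open ℕₚ.≤-Reasoning
  open +-*-Solver using (solve; _:*_; _:=_; con)
  x = u ℕ.^ i
  y = u ℕ.^ j
  shuffle : ∀ a k x l y → 10 ℕ.* (a ℕ.* a ℕ.* (k ℕ.* x) ℕ.* (2 ℕ.* (l ℕ.* y))) ≡ 20 ℕ.* (l ℕ.* k) ℕ.* (a ℕ.* a ℕ.* (x ℕ.* y))
  shuffle = solve 5 (λ a k x l y → con 10 :* (a :* a :* (k :* x) :* (con 2 :* (l :* y))) := con 20 :* (l :* k) :* (a :* a :* (x :* y))) refl

near-root : ∀ e p {t} → 1 ≤ e → 1 ≤ p → t ≡ 2 ℕ.^ e → ∃ λ u → 1 ≤ u × u ℕ.^ e ≤ p × p ≤ t ℕ.* u ℕ.^ e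
near-root e p 1≤e 1≤p t≡ with integer-root e p 1≤e 1≤p
... | u , 1≤u , lo , hi = u , 1≤u , lo , root-upper e u p t≡ 1≤u hi

error : ℕ → ℕ → ℕ
error A u = 10 ℕ.* (A ℕ.* A ℕ.* (c₃ ℕ.* u ℕ.^ 16) ℕ.* (2 ℕ.* (c₁ ℕ.* u ℕ.^ 21)))

near-Gsum : ∀ n p A q u → p ≡ suc (n ℕ.+ n) → 2 ℕ.< p → Prime p → 1 ≤ A → Coprime A p → suc q ≡ 2 ℕ.^ r A → 1 ≤ q →
            1 ≤ u → u ℕ.^ 40 ≤ p → p ≤ c₀ ℕ.* u ℕ.^ 40 → A ℕ.* suc u ≤ p →
            Near (q ℕ.* SR (A ℕ.* p)) (Gsum A ℕ.* p) (q ℕ.* error A u)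
near-Gsum n _ A q u refl 2<p pr 1≤A cop sq 1≤q 1≤u lo p≤ Au =
  Parameters.near-G n (positive n 2<p) pr A 1≤A cop u 1≤u lo p≤ Au q sq 1≤q
  where
  positive : ∀ n → 2 ℕ.< suc (n ℕ.+ n) → 1 ≤ n
  positive ℕ.zero    (s≤s ())
  positive (ℕ.suc _) _        = s≤s z≤n

theorem1p3 : ∃ λ (C : ℕ) → ∀ (p A : ℕ) → Prime p → SquareFree A → 1 ≤ A →
    (10 ℕ.* A) ℕ.^ 10 ≤ p → Coprime A p →
    (∣ (+ SR (A ℕ.* p) ℚ./ 1) ℚ.- (+ 2 ℚ./ 1) ℚ.* f A ½ ℚ.* (+ p ℚ./ 1) ∣ ^ℚ 20)
    ℚ.≤ (+ (C ℕ.^ 20 ℕ.* A ℕ.^ 60 ℕ.* p ℕ.^ 19) ℚ./ 1)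
theorem1p3 = 20 ℕ.* (c₁ ℕ.* c₃) , λ p A pr _ 1≤A hA cop →
  let 10≤10A = ℕₚ.m≤m*n 10 A {{ℕ.>-nonZero 1≤A}}
      2<p = ℕₚ.≤-trans (ℕₚ.≤-trans (ℕₚ.≤ᵇ⇒≤ 3 10 tt) 10≤10A)
              (ℕₚ.≤-trans (x≤pow (10 ℕ.* A) 9 (ℕₚ.≤-trans (s≤s z≤n) 10≤10A)) hA)
      -- 2^r - 1, the denominator from the geometric series of ratio 2^(-r).
      q = ℕ.pred (2 ℕ.^ r A)
      sq = ℕₚ.suc-pred (2 ℕ.^ r A) {{ℕₚ.m^n≢0 2 (r A)}}
      1≤q = ℕ.s≤s⁻¹ (≡.subst (2 ≤_) (sym sq) (ℕₚ.^-monoʳ-≤ 2 (Candidates.1≤r A 1≤A)))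
      n , p≡ = prime-odd p pr 2<p
      u , 1≤u , lo , p≤ = near-root 40 p (s≤s z≤n) (ℕₚ.<⇒≤ (ℕₚ.<-trans (s≤s (s≤s z≤n)) 2<p)) c₀≡
  in power-bound 20 ((+ SR (A ℕ.* p) ℚ./ 1) ℚ.- (+ 2 ℚ./ 1) ℚ.* f A ½ ℚ.* (+ p ℚ./ 1)) (error A u)
       ((20 ℕ.* (c₁ ℕ.* c₃)) ℕ.^ 20 ℕ.* A ℕ.^ 60 ℕ.* p ℕ.^ 19)
       (quotient-bound (SR (A ℕ.* p)) (Gsum A) p q (error A u) (ι 2 ℚ.* f A ½) 1≤q (2f-scaled A q sq 1≤q)
         -- The arguments 8 and 37 stand for the exponents 10 of 10 A and 40 of u.
         (near-Gsum n p A q u p≡ 2<p pr 1≤A cop sq 1≤q 1≤u lo p≤ (A[u+1]≤p A u p 8 37 1≤A 1≤u hA lo)))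
       -- 20 · 38 = 40 · 19 turns u^38 into p^19, and 3 · 20 = 60 is the exponent of A.
       (error-bound 20 38 40 19 60 3 (error A u) (20 ℕ.* (c₁ ℕ.* c₃)) A u p (error-size c₁ c₃ A u 16 21 1≤A 1≤u) lo refl refl)
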